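{- For all integers $n\ge 0$, $$c\phi_{16}(4n+3)\equiv 0\pmod{1024},\qquad c\phi_{16}(8n+7)\equiv 0\pmod{2048}.$$
   Context: For a positive integer $k$ and an integer $n\ge 0$, $c\phi_k(n)$ denotes the number of $k$-colored generalized Frobenius partitions of $n$ (Andrews): two-rowed arrays $\begin{pmatrix} a_1 & a_2 & \cdots & a_r\\ b_1 & b_2 & \cdots & b_r\end{pmatrix}$ (with $r\ge 0$) in which every entry is a non-negative integer carrying one of $k$ colors, no integer occurs twice in the same color in the same row, each row is arranged in non-increasing order (equal integers being ordered by a fixed order on colors, so that a row is just a set of $r$ colored non-negative integers), and $n=r+\sum_{j=1}^r(a_j+b_j)$ (colors do not contribute to the sum). Equivalently, $\sum_{n\ge0}c\phi_k(n)q^n$ is the coefficient of $z^0$ in $\prod_{j\ge 0}(1+zq^{j+1})^k(1+z^{ -1}q^{j})^k$. -}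

module Defs where

open import Data.Empty using (⊥)
open import Data.Fin.Base as Fin using (Fin)
import Data.Fin.Properties as Fin
open import Data.List.Base
  using (List; []; _∷_; _++_; map; length; filter; allFin; cartesianProduct)
open import Data.List.Membership.Propositional using (_∈_)
open import Data.List.Membership.Propositional.Properties
  using (∈-++⁺ˡ; ∈-++⁺ʳ; ∈-++⁻; ∈-map⁺; ∈-map⁻; ∈-allFin; ∈-filter⁺; ∈-filter⁻
        ; ∈-cartesianProduct⁺)
open import Data.List.Relation.Unary.All as All using (All; []; _∷_)
import Data.List.Relation.Unary.All.Properties as All
open import Data.List.Relation.Unary.AllPairs as AllPairs using (AllPairs; []; _∷_)
import Data.List.Relation.Unary.AllPairs.Properties as AllPairs
open import Data.List.Relation.Unary.Any using (here; there)
open import Data.List.Relation.Unary.Linked using (Linked; linked?)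
open import Data.List.Relation.Unary.Linked.Properties using (Linked⇒AllPairs)
open import Data.List.Relation.Unary.Unique.Propositional using (Unique)
import Data.List.Relation.Unary.Unique.Propositional.Properties as Unique
open import Data.List.Properties using (∷-injectiveʳ)
open import Data.Nat.Base using (ℕ; zero; suc; _+_; _≤_; _<_; _>_; s≤s)
open import Data.Nat.ListAction using (sum)
import Data.Nat.Properties as ℕ
open import Data.Product.Base using (∃; _×_; _,_; proj₁; proj₂)
open import Data.Product.Relation.Binary.Lex.Strict
  using (×-Lex; ×-decidable; ×-transitive)
open import Data.Sum.Base using (inj₁; inj₂)
open import Function.Base using (_∘_)
open import Function.Bundles using (_⇔_; mk⇔)
open import Level using (Level; 0ℓ)
open import Relation.Binary.Core using (Rel)
open import Relation.Binary.Definitions using (Decidable; Transitive)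
open import Relation.Binary.PropositionalEquality
  using (_≡_; refl; cong; resp₂; isEquivalence)
open import Relation.Nullary.Decidable using (Dec; yes; no; _×-dec_)
open import Relation.Nullary.Negation using (¬_; contradiction)

private
  variable
    a : Level
    A : Set a
    k n : ℕ

ColoredInt : ℕ → Set
ColoredInt k = ℕ × Fin k

-- Entries of a row are listed by decreasing value, equal values by increasing
-- color.  The order is strict, so no integer repeats in the same color.
infix 4 _≻_ _≻?_

_≻_ : Rel (ColoredInt k) 0ℓ
_≻_ = ×-Lex _≡_ _>_ Fin._<_

_≻?_ : Decidable (_≻_ {k})
_≻?_ = ×-decidable ℕ._≟_ ℕ._>?_ Fin._<?_

Row : ℕ → Set
Row k = List (ColoredInt k)

rowSum : Row k → ℕ
rowSum xs = sum (map proj₁ xs)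

record IsFrobeniusPartition (k n : ℕ) (array : Row k × Row k) : Set where
  constructor isFrobeniusPartition
  top    = proj₁ array
  bottom = proj₂ array
  field
    top-ordered    : Linked _≻_ top
    bottom-ordered : Linked _≻_ bottom
    equal-length   : length top ≡ length bottom
    weight         : length top + (rowSum top + rowSum bottom) ≡ n

isFrobeniusPartition? : ∀ k n array → Dec (IsFrobeniusPartition k n array)
isFrobeniusPartition? k n (xs , ys)
  with linked? _≻?_ xs ×-dec linked? _≻?_ ys
     ×-dec length xs ℕ.≟ length ys
     ×-dec length xs + (rowSum xs + rowSum ys) ℕ.≟ n
... | yes (p , q , r , s) = yes (isFrobeniusPartition p q r s)
... | no ¬p = no λ (isFrobeniusPartition p q r s) → ¬p (p , q , r , s)

sublists : List A → List (List A)
sublists []       = [] ∷ []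
sublists (x ∷ xs) = map (x ∷_) (sublists xs) ++ sublists xs

-- The colored integers of value less than n, in the order _≻_.
entriesBelow : ∀ k → ℕ → Row k
entriesBelow k zero    = []
entriesBelow k (suc n) = map (n ,_) (allFin k) ++ entriesBelow k n

-- Every entry of a partition of n is less than n, because a row containing an
-- entry a has length at least 1; ∈-frobeniusPartitions below shows that nothing
-- is lost by this bound.
frobeniusPartitions : ∀ k n → List (Row k × Row k)
frobeniusPartitions k n =
  filter (isFrobeniusPartition? k n) (cartesianProduct rows rows)
  where rows = sublists (entriesBelow k n)

cφ : ℕ → ℕ → ℕ
cφ k n = length (frobeniusPartitions k n)

-- The rest shows that cφ k n is the number of arrays satisfying
-- IsFrobeniusPartition k n: the list frobeniusPartitions k n contains each of
-- them exactly once, and nothing else.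

private
  ≻-trans : Transitive (_≻_ {k})
  ≻-trans = ×-transitive {_<₂_ = Fin._<_} isEquivalence (resp₂ _>_)
    (λ p q → ℕ.<-trans q p) Fin.<-trans

  ≻⇒≢ : {x y : ColoredInt k} → x ≻ y → ¬ x ≡ y
  ≻⇒≢ (inj₁ p)       refl = ℕ.<-irrefl refl p
  ≻⇒≢ (inj₂ (_ , p)) refl = ℕ.<-irrefl refl p

  entriesBelow-< : ∀ n → All ((_< n) ∘ proj₁) (entriesBelow k n)
  entriesBelow-< zero    = []
  entriesBelow-< (suc n) = All.++⁺
    (All.map⁺ (All.universal (λ _ → ℕ.n<1+n n) _))
    (All.map ℕ.m<n⇒m<1+n (entriesBelow-< n))

  entriesBelow-ordered : ∀ n → AllPairs _≻_ (entriesBelow k n)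
  entriesBelow-ordered zero    = []
  entriesBelow-ordered (suc n) = AllPairs.++⁺
    (AllPairs.map⁺ (AllPairs.tabulate⁺-< λ i<j → inj₂ (refl , i<j)))
    (entriesBelow-ordered n)
    (All.map⁺ (All.universal (λ _ → All.map inj₁ (entriesBelow-< n)) _))

  ∈-entriesBelow : ∀ n {x : ColoredInt k} → proj₁ x < n → x ∈ entriesBelow k n
  ∈-entriesBelow (suc n) {m , c} (s≤s m≤n) with ℕ.m≤n⇒m<n∨m≡n m≤n
  ... | inj₁ m<n  = ∈-++⁺ʳ _ (∈-entriesBelow n m<n)
  ... | inj₂ refl = ∈-++⁺ˡ (∈-map⁺ (n ,_) (∈-allFin c))

  sublists-⊆ : ∀ (xs : List A) {x ys} → ys ∈ sublists xs → x ∈ ys → x ∈ xs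
  sublists-⊆ []       (here refl) ()
  sublists-⊆ (z ∷ xs) ys∈ x∈ with ∈-++⁻ (map (z ∷_) (sublists xs)) ys∈
  ... | inj₂ ys∈′ = there (sublists-⊆ xs ys∈′ x∈)
  ... | inj₁ ys∈′ with ∈-map⁻ (z ∷_) ys∈′ | x∈
  ...   | _ , zs∈ , refl | here refl = here refl
  ...   | _ , zs∈ , refl | there x∈′ = there (sublists-⊆ xs zs∈ x∈′)

  sublists-unique : {xs : List A} → Unique xs → Unique (sublists xs)
  sublists-unique []                    = [] ∷ []
  sublists-unique {xs = x ∷ xs} (x∉ ∷ u) = Unique.++⁺
    (Unique.map⁺ ∷-injectiveʳ (sublists-unique u))
    (sublists-unique u)
    λ (p , q) → disjoint (∈-map⁻ (x ∷_) p) q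
    where
    disjoint : ∀ {ys} → (∃ λ zs → zs ∈ sublists xs × ys ≡ x ∷ zs) →
               ys ∈ sublists xs → ⊥
    disjoint (_ , _ , refl) q = All.lookup x∉ (sublists-⊆ xs q (here refl)) refl

  []∈sublists : (xs : List A) → [] ∈ sublists xs
  []∈sublists []       = here refl
  []∈sublists (x ∷ xs) = ∈-++⁺ʳ _ ([]∈sublists xs)

  drop-head : {l : ColoredInt k} {ls xs : Row k} →
              All (l ≻_) xs → All (_∈ l ∷ ls) xs → All (_∈ ls) xs
  drop-head []        []                = []
  drop-head (l≻x ∷ _) (here refl ∷ _)   = contradiction refl (≻⇒≢ l≻x)
  drop-head (_ ∷ p)   (there x∈ ∷ q)    = x∈ ∷ drop-head p q

  ∈-sublists : {ls xs : Row k} → AllPairs _≻_ ls → AllPairs _≻_ xs →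
               All (_∈ ls) xs → xs ∈ sublists ls
  ∈-sublists {ls = ls} _ [] [] = []∈sublists ls
  ∈-sublists (l≻ ∷ o) (x≻ ∷ o′) (here refl ∷ xs∈) =
    ∈-++⁺ˡ (∈-map⁺ _ (∈-sublists o o′ (drop-head x≻ xs∈)))
  ∈-sublists (l≻ ∷ o) (x≻ ∷ o′) (there x∈ ∷ xs∈) =
    ∈-++⁺ʳ _ (∈-sublists o (x≻ ∷ o′)
      (x∈ ∷ drop-head (All.map (≻-trans (All.lookup l≻ x∈)) x≻) xs∈))

  entry-< : {xs : Row k} → All (λ x → proj₁ x < length xs + rowSum xs) xs
  entry-< {xs = []}     = []
  entry-< {xs = x ∷ xs} =
    s≤s (ℕ.≤-trans (ℕ.m≤m+n _ _) (ℕ.m≤n+m _ (length xs)))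
    ∷ All.map (λ p → ℕ.m<n⇒m<1+n (ℕ.<-≤-trans p
        (ℕ.+-monoʳ-≤ (length xs) (ℕ.m≤n+m _ (proj₁ x))))) entry-<

  ∈-rows : {xs : Row k} → Linked _≻_ xs → length xs + rowSum xs ≤ n →
           xs ∈ sublists (entriesBelow k n)
  ∈-rows {n = n} o bound = ∈-sublists (entriesBelow-ordered n)
    (Linked⇒AllPairs ≻-trans o)
    (All.map (λ p → ∈-entriesBelow n (ℕ.<-≤-trans p bound)) entry-<)

frobeniusPartitions-unique : ∀ k n → Unique (frobeniusPartitions k n)
frobeniusPartitions-unique k n =
  Unique.filter⁺ (isFrobeniusPartition? k n) (Unique.cartesianProduct⁺ u u)
  where u = sublists-unique (AllPairs.map ≻⇒≢ (entriesBelow-ordered n))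

∈-frobeniusPartitions : ∀ {k n} {array : Row k × Row k} →
  array ∈ frobeniusPartitions k n ⇔ IsFrobeniusPartition k n array
∈-frobeniusPartitions {k} {n} {xs , ys} = mk⇔
  (λ p → proj₂ (∈-filter⁻ P? {xs = cartesianProduct rows rows} p))
  λ F@(isFrobeniusPartition p q r s) → ∈-filter⁺ P?
    (∈-cartesianProduct⁺ (∈-rows p (top-bound s)) (∈-rows q (bottom-bound r s)))
    F
  where
  open ℕ.≤-Reasoning
  P?   = isFrobeniusPartition? k n
  rows = sublists (entriesBelow k n)

  top-bound : length xs + (rowSum xs + rowSum ys) ≡ n → length xs + rowSum xs ≤ n
  top-bound s = begin
    length xs + rowSum xs               ≤⟨ ℕ.+-monoʳ-≤ (length xs) (ℕ.m≤m+n _ _) ⟩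
    length xs + (rowSum xs + rowSum ys) ≡⟨ s ⟩
    n                                   ∎

  bottom-bound : length xs ≡ length ys →
                 length xs + (rowSum xs + rowSum ys) ≡ n → length ys + rowSum ys ≤ n
  bottom-bound r s = begin
    length ys + rowSum ys               ≡⟨ cong (_+ rowSum ys) r ⟨
    length xs + rowSum ys               ≤⟨ ℕ.+-monoʳ-≤ (length xs) (ℕ.m≤n+m _ _) ⟩
    length xs + (rowSum xs + rowSum ys) ≡⟨ s ⟩
    n                                   ∎

{-# OPTIONS --safe #-}

-- The generating function of cφ₁₆ is the z⁰-coefficient of F¹⁶, where
-- F = ∏ (1 + z q^(j+1/2)) (1 + z⁻¹ q^(j+1/2)) = P(q) T, P is the partition generating
-- function and T = Σ zᵐ q^(m²/2).
--
-- Comparing F(z) F(-z) with F(-z²) at q² gives P(q)² φ(-q) = P(q²), and with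
-- φ(q) φ(-q) = φ(-q²)² this yields P(q)¹⁶ = κ φ(q)⁸ φ(q²)²⁰ for a series κ in q⁴.
--
-- The square of a theta function Σ z^(dm+r) X^(e(dm+r)²) is a combination of two theta
-- functions for 2d and e/2, with values of theta functions at z = 1 as coefficients.
-- Squaring four times expresses the constant term of T¹⁶ as a polynomial in φ(q⁴),
-- 2qψ(q⁸), φ(q⁸) and 2q²ψ(q¹⁶).  Modulo 2048 its product with φ(q)⁸ φ(q²)²⁰ is short, and
-- its only term with exponents of q congruent to 3 modulo 4 is
-- 1024 q³ φ(q⁴)³⁹ ψ(q⁸)³ φ(q⁸).  Modulo 2048, κ times this term equals
-- 1024 q³ P(q⁸)² ψ(q⁸)³, which has no exponents congruent to 7 modulo 8.
--
-- All computations take place modulo 2048 and up to degree n in q, so that the sums and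
-- products are finite; q = X³² makes every exponent an integer.

module Submission where

open import Defs

open import Algebra.Bundles using (CommutativeSemiring; RawRing)
import Algebra.Properties.CommutativeSemigroup
import Algebra.Properties.CommutativeSemiring.Exp
import Algebra.Properties.Semiring.Exp
import Algebra.Properties.Semiring.Mult
import Algebra.Solver.Ring
open import Algebra.Solver.Ring.AlmostCommutativeRing
  using (fromCommutativeSemiring; _-Raw-AlmostCommutative⟶_)
import Algebra.Structures.Biased as Biased
open import Data.Bool.Base as Bool using (if_then_else_)
open import Data.Fin using (Fin; #_)
open import Data.Integer.Base as ℤ using (ℤ; +_; -[1+_]; ∣_∣; 0ℤ; 1ℤ; -1ℤ)
import Data.Integer.Properties as ℤ
open import Data.Integer.Tactic.RingSolver using (solve-∀)
open import Data.List.Base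
  using (List; []; _∷_; _++_; map; length; filter; allFin; cartesianProduct)
open import Data.List.Properties using (length-tabulate)
open import Data.List.Relation.Unary.All as All using (All; []; _∷_)
import Data.List.Relation.Unary.All.Properties as All
open import Data.List.Relation.Unary.AllPairs as AllPairs using (AllPairs; []; _∷_)
import Data.List.Relation.Unary.AllPairs.Properties as AllPairs
open import Data.List.Relation.Unary.Linked using (Linked)
open import Data.List.Relation.Unary.Linked.Properties using (AllPairs⇒Linked)
open import Data.Maybe.Base using (Maybe; just; nothing; is-just)
open import Data.Nat.Base as ℕ using (ℕ; zero; suc; _<_; _≤_; NonZero)
open import Data.Nat.DivMod
  using (_%_; _/_; m≡m%n+[m/n]*n; m*n%n≡0; [m+kn]%n≡m%n; %-distribˡ-+; %-distribˡ-*)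
open import Data.Nat.Divisibility using (_∣_; divides; ∣m∣n⇒∣m+n; ∣m⇒∣m*n; ∣n⇒∣m*n; %-presˡ-∣; m%n≡0⇒n∣m)
import Data.Nat.Properties as ℕ
open import Data.Nat.Solver using (module +-*-Solver)
import Data.Nat.Tactic.RingSolver as ℕRing
open import Data.Product.Base using (∃; _×_; _,_; proj₁; proj₂)
open import Data.Sum.Base using (inj₁; inj₂)
open import Data.Vec.Base using ([]; _∷_)
open import Data.Vec.Relation.Binary.Pointwise.Inductive as Pointwise using (Pointwise; []; _∷_)
import Data.Vec.Relation.Unary.All as VecAll
open VecAll using ([]; _∷_)
import Data.Vec.Relation.Unary.All.Properties as VecAll
open import Function.Base using (_∘_; id)
open import Level using (0ℓ; _⊔_)
open import Relation.Binary.Bundles using (Setoid)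
open import Relation.Binary.Core using (Rel)
open import Relation.Binary.PropositionalEquality as ≡
  using (_≡_; cong; cong₂; module ≡-Reasoning)
import Relation.Binary.Reasoning.Setoid
open import Relation.Binary.Structures using (IsEquivalence)
open import Relation.Nullary.Decidable using (Dec; yes; no; does)
open import Relation.Nullary.Negation using (¬_; contradiction)
open import Relation.Unary using (Pred; Decidable)

-- Polynomial identities modulo M

-- The difficulty is to make the 2-adic size of every term visible. Once a series in q⁴ is taken out
-- of P(q)¹⁶, what remains is φ(q)⁸ φ(q²)²⁰, and φ(q) = γ + d, φ(q²)² = γ² + d² for γ = φ(q⁴) and d
-- = 2qψ(q⁸). Hence only a polynomial in γ, ε = φ(q⁸), d = 2D and e = 2E has to be sorted by
-- exponents modulo 4, where D lives in degrees 1 and E in degrees 2 modulo 4, and each of them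
-- brings a factor 2. Modulo 2048 a factor 2 cannot be cancelled, so D and E are constructed as
-- explicit half sums. The surviving coefficient 1024 means that its cofactor matters only modulo 2,
-- where φ is 1 and P(q)² is P(q²); this is what makes the cofactor of D³ a series in q⁸. Working
-- modulo 2048 in a semiring of finite sums also provides -1 (as 2047) and turns each expansion into
-- a decidable polynomial identity. Evaluation at z = 1 or z = -1 is never performed: the
-- specialised theta series are separate sums, given by the parameter `c` and by signs.

module ModularSolver 
  {c ℓ} (S : CommutativeSemiring c ℓ)
  (M : ℕ) .{{_ : NonZero M}}
  (M✕1≈0 : CommutativeSemiring._≈_ S
    (Algebra.Properties.Semiring.Mult._×_ (CommutativeSemiring.semiring S) M (CommutativeSemiring.1# S))
    (CommutativeSemiring.0# S))
  where
  open CommutativeSemiring S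
  open Algebra.Properties.Semiring.Mult semiring renaming (_×_ to _✕_)
  open Algebra.Properties.Semiring.Exp semiring using (_^_; ^-congˡ)
  open Relation.Binary.Reasoning.Setoid setoid

  opaque
    -- Opaque, so that a numeral such as `⟨ 1024 ⟩` is not unfolded into a sum of ones during type
    -- checking.
    ⟨_⟩ : ℕ → Carrier
    ⟨ n ⟩ = n ✕ 1#

    ⟨⟩-≈× : ∀ n → ⟨ n ⟩ ≈ n ✕ 1#
    ⟨⟩-≈× n = refl

    ⟨⟩-% : ∀ n → ⟨ n % M ⟩ ≈ ⟨ n ⟩
    ⟨⟩-% n = sym (begin
      n ✕ 1#                                  ≡⟨ ≡.cong (_✕ 1#) (m≡m%n+[m/n]*n n M) ⟩
      (n % M ℕ.+ n / M ℕ.* M) ✕ 1#            ≈⟨ ×-homo-+ 1# (n % M) (n / M ℕ.* M) ⟩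
      (n % M) ✕ 1# + (n / M ℕ.* M) ✕ 1#       ≈⟨ +-congˡ (×1-homo-* (n / M) M) ⟩
      (n % M) ✕ 1# + ((n / M) ✕ 1#) * (M ✕ 1#) ≈⟨ +-congˡ (*-congˡ M✕1≈0) ⟩
      (n % M) ✕ 1# + ((n / M) ✕ 1#) * 0#      ≈⟨ +-congˡ (zeroʳ _) ⟩
      (n % M) ✕ 1# + 0#                       ≈⟨ +-identityʳ _ ⟩
      (n % M) ✕ 1#                            ∎)

    ⟨⟩-+ : ∀ m n → ⟨ m ℕ.+ n ⟩ ≈ ⟨ m ⟩ + ⟨ n ⟩
    ⟨⟩-+ = ×-homo-+ 1#

    ⟨⟩-* : ∀ m n → ⟨ m ℕ.* n ⟩ ≈ ⟨ m ⟩ * ⟨ n ⟩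
    ⟨⟩-* = ×1-homo-*

    ⟨M⟩≈0 : ⟨ M ⟩ ≈ 0#
    ⟨M⟩≈0 = M✕1≈0

    ⟨0⟩ : ⟨ 0 ⟩ ≈ 0#
    ⟨0⟩ = refl

    ⟨1⟩ : ⟨ 1 ⟩ ≈ 1#
    ⟨1⟩ = +-identityʳ 1#

  residues : RawRing _ _
  residues = record
    { Carrier = ℕ ; _≈_ = _≡_
    ; _+_ = λ m n → (m ℕ.+ n) % M
    ; _*_ = λ m n → (m ℕ.* n) % M
    ; -_ = id ; 0# = 0 ; 1# = 1 }

  morphism : residues -Raw-AlmostCommutative⟶ fromCommutativeSemiring S
  morphism = record
    { ⟦_⟧ = ⟨_⟩
    ; +-homo = λ m n → trans (⟨⟩-% _) (⟨⟩-+ m n)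
    ; *-homo = λ m n → trans (⟨⟩-% _) (⟨⟩-* m n)
    ; -‿homo = λ _ → refl ; 0-homo = ⟨0⟩ ; 1-homo = ⟨1⟩ }

  _≟ᶜ_ : ∀ m n → Maybe (⟨ m ⟩ ≈ ⟨ n ⟩)
  m ≟ᶜ n with m ℕ.≟ n
  ... | yes m≡n = just (reflexive (≡.cong ⟨_⟩ m≡n))
  ... | no _    = nothing

  open Algebra.Solver.Ring residues (fromCommutativeSemiring S) morphism _≟ᶜ_ public

  -- Residues have zero divisors, so the Horner forms of the solver need not be
  -- canonical; equality is tested by deciding whether all coefficients of
  -- p + (M - 1) q vanish.
  vanishesN? : ∀ {n} (p : Normal n) → Maybe (∀ ρ → ⟦ p ⟧N ρ ≈ 0#)
  vanishesH? : ∀ {n} (p : HNF (suc n)) → Maybe (∀ ρ → ⟦ p ⟧H ρ ≈ 0#)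
  vanishesN? (con m) with m ≟ᶜ 0
  ... | just m≈0 = just λ _ → trans m≈0 ⟨0⟩
  ... | nothing  = nothing
  vanishesN? (poly p) = vanishesH? p
  vanishesH? ∅ = just λ _ → refl
  vanishesH? (p *x+ q) with vanishesH? p | vanishesN? q
  ... | just p≈0 | just q≈0 = just λ where
    (x ∷ ρ) → trans (+-cong (trans (*-congʳ (p≈0 (x ∷ ρ))) (zeroˡ x)) (q≈0 ρ)) (+-identityˡ 0#)
  ... | _ | _ = nothing

  ⟨M∸1⟩-cancel : ∀ {x y} → x + ⟨ ℕ.pred M ⟩ * y ≈ 0# → x ≈ y
  ⟨M∸1⟩-cancel {x} {y} eq = begin
    x                               ≈⟨ +-identityʳ x ⟨
    x + 0#                          ≈⟨ +-congˡ neg ⟨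
    x + (⟨ ℕ.pred M ⟩ * y + y)      ≈⟨ +-assoc _ _ _ ⟨
    x + ⟨ ℕ.pred M ⟩ * y + y        ≈⟨ +-congʳ eq ⟩
    0# + y                          ≈⟨ +-identityˡ y ⟩
    y                               ∎
    where
    neg : ⟨ ℕ.pred M ⟩ * y + y ≈ 0#
    neg = begin
      ⟨ ℕ.pred M ⟩ * y + y         ≈⟨ +-congˡ (*-identityˡ y) ⟨
      ⟨ ℕ.pred M ⟩ * y + 1# * y    ≈⟨ distribʳ _ _ _ ⟨
      (⟨ ℕ.pred M ⟩ + 1#) * y      ≈⟨ *-congʳ (+-congˡ ⟨1⟩) ⟨
      (⟨ ℕ.pred M ⟩ + ⟨ 1 ⟩) * y   ≈⟨ *-congʳ (⟨⟩-+ _ 1) ⟨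
      ⟨ ℕ.pred M ℕ.+ 1 ⟩ * y       ≡⟨ ≡.cong (λ k → ⟨ k ⟩ * y) (≡.trans (ℕ.+-comm (ℕ.pred M) 1) (ℕ.suc-pred M)) ⟩
      ⟨ M ⟩ * y                    ≈⟨ *-congʳ ⟨M⟩≈0 ⟩
      0# * y                       ≈⟨ zeroˡ y ⟩
      0#                           ∎

  -- The implicit argument reduces to the unit type when the test succeeds, so a use of `solveMod`
  -- is settled by computation.
  solveMod : ∀ {n} (p q : Polynomial n) →
             {Bool.T (is-just (vanishesN? (normalise (p :+ con (ℕ.pred M) :* q))))} →
             ∀ ρ → ⟦ p ⟧ ρ ≈ ⟦ q ⟧ ρ
  solveMod p q {t} ρ with vanishesN? (normalise (p :+ con (ℕ.pred M) :* q))
  ... | just r≈0 = ⟨M∸1⟩-cancel (trans (sym (correct (p :+ con (ℕ.pred M) :* q) ρ)) (r≈0 ρ))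

  ⟦⟧-cong : ∀ {n} (p : Polynomial n) {ρ σ} → Pointwise _≈_ ρ σ → ⟦ p ⟧ ρ ≈ ⟦ p ⟧ σ
  ⟦⟧-cong (op [+] p q) eq = +-cong (⟦⟧-cong p eq) (⟦⟧-cong q eq)
  ⟦⟧-cong (op [*] p q) eq = *-cong (⟦⟧-cong p eq) (⟦⟧-cong q eq)
  ⟦⟧-cong (con c)      eq = refl
  ⟦⟧-cong (var i)      eq = Pointwise.lookup eq i
  ⟦⟧-cong (p :^ n)     eq = ^-congˡ n (⟦⟧-cong p eq)
  ⟦⟧-cong (:- p)       eq = ⟦⟧-cong p eq

-- Laurent polynomials in X and z as lists of monomials

Monomial : Set
Monomial = ℕ × ℤ

infixl 7 _·_
_·_ : Monomial → Monomial → Monomial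
(m , i) · (n , j) = m ℕ.+ n , i ℤ.+ j

·-comm : ∀ x y → x · y ≡ y · x
·-comm (m , i) (n , j) = cong₂ _,_ (ℕ.+-comm m n) (ℤ.+-comm i j)

·-assoc : ∀ x y z → (x · y) · z ≡ x · (y · z)
·-assoc (m , i) (n , j) (k , l) = cong₂ _,_ (ℕ.+-assoc m n k) (ℤ.+-assoc i j l)

unit : Monomial
unit = 0 , + 0

·-identityˡ : ∀ x → unit · x ≡ x
·-identityˡ (m , i) = cong (m ,_) (ℤ.+-identityˡ i)

Series : Set
Series = List Monomial

opaque
  -- A list stands for the formal sum of its entries, and `∫ u f` is the value on it of the linear
  -- functional that is `f` on monomials. Series are compared through these values, never by
  -- bringing lists into a normal form.
  ∫ : {A : Set} → List A → (A → ℕ) → ℕ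
  ∫ []      f = 0
  ∫ (x ∷ u) f = f x ℕ.+ ∫ u f

module _ {A : Set} where
  opaque
    unfolding ∫

    ∫-[] : (f : A → ℕ) → ∫ [] f ≡ 0
    ∫-[] f = ≡.refl

    ∫-∷ : ∀ x u (f : A → ℕ) → ∫ (x ∷ u) f ≡ f x ℕ.+ ∫ u f
    ∫-∷ x u f = ≡.refl

    ∫-single : ∀ x (f : A → ℕ) → ∫ (x ∷ []) f ≡ f x
    ∫-single x f = ℕ.+-identityʳ (f x)

    ∫-cong : ∀ u {f g : A → ℕ} → (∀ x → f x ≡ g x) → ∫ u f ≡ ∫ u g
    ∫-cong []      eq = ≡.refl
    ∫-cong (x ∷ u) eq = cong₂ ℕ._+_ (eq x) (∫-cong u eq)

    ∫-map : {C : Set} (h : C → A) → ∀ u f → ∫ (map h u) f ≡ ∫ u (λ x → f (h x))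
    ∫-map h []      f = ≡.refl
    ∫-map h (x ∷ u) f = cong (f (h x) ℕ.+_) (∫-map h u f)

    ∫-++ : ∀ (u v : List A) f → ∫ (u ++ v) f ≡ ∫ u f ℕ.+ ∫ v f
    ∫-++ []      v f = ≡.refl
    ∫-++ (x ∷ u) v f = ≡.trans (cong (f x ℕ.+_) (∫-++ u v f)) (≡.sym (ℕ.+-assoc (f x) _ _))

    ∫-0 : ∀ (u : List A) → ∫ u (λ _ → 0) ≡ 0
    ∫-0 []      = ≡.refl
    ∫-0 (x ∷ u) = ∫-0 u

    ∫-+ : ∀ u (f g : A → ℕ) → ∫ u (λ x → f x ℕ.+ g x) ≡ ∫ u f ℕ.+ ∫ u g
    ∫-+ []      f g = ≡.refl
    ∫-+ (x ∷ u) f g = ≡.trans (cong ((f x ℕ.+ g x) ℕ.+_) (∫-+ u f g))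
      (solve 4 (λ a b c d → (a :+ b) :+ (c :+ d) := (a :+ c) :+ (b :+ d)) ≡.refl (f x) (g x) _ _)
      where open +-*-Solver

∫-swap : {A C : Set} (u : List A) (v : List C) (f : A → C → ℕ) →
         ∫ u (λ x → ∫ v (f x)) ≡ ∫ v (λ y → ∫ u (λ x → f x y))
∫-swap []      v f = ≡.trans (∫-[] _) (≡.sym (≡.trans (∫-cong v (λ y → ∫-[] (λ x → f x y))) (∫-0 v)))
∫-swap (x ∷ u) v f = begin
  ∫ (x ∷ u) (λ x → ∫ v (f x))                            ≡⟨ ∫-∷ x u (λ x → ∫ v (f x)) ⟩
  ∫ v (f x) ℕ.+ ∫ u (λ x → ∫ v (f x))                    ≡⟨ cong (∫ v (f x) ℕ.+_) (∫-swap u v f) ⟩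
  ∫ v (f x) ℕ.+ ∫ v (λ y → ∫ u (λ x → f x y))            ≡⟨ ∫-+ v (f x) (λ y → ∫ u (λ x → f x y)) ⟨
  ∫ v (λ y → f x y ℕ.+ ∫ u (λ x → f x y))                ≡⟨ ∫-cong v (λ y → ∫-∷ x u (λ x → f x y)) ⟨
  ∫ v (λ y → ∫ (x ∷ u) (λ x → f x y))                    ∎
  where open ≡-Reasoning

opaque
  infixl 6 _⊕_
  infixl 7 _⊗_

  _⊕_ _⊗_ : Series → Series → Series
  _⊕_ = _++_

  []      ⊗ v = []
  (x ∷ u) ⊗ v = map (x ·_) v ⊕ u ⊗ v

  𝟘 𝟙 : Series
  𝟘 = []
  𝟙 = unit ∷ []

  ∫-𝟘 : ∀ f → ∫ 𝟘 f ≡ 0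
  ∫-𝟘 f = ∫-[] f

  ∫-𝟙 : ∀ f → ∫ 𝟙 f ≡ f unit
  ∫-𝟙 f = ∫-single unit f

  ∫-⊕ : ∀ u v f → ∫ (u ⊕ v) f ≡ ∫ u f ℕ.+ ∫ v f
  ∫-⊕ = ∫-++

  ∫-⊗ : ∀ u v f → ∫ (u ⊗ v) f ≡ ∫ u (λ x → ∫ v (λ y → f (x · y)))
  ∫-⊗ []      v f = ≡.trans (∫-[] f) (≡.sym (∫-[] _))
  ∫-⊗ (x ∷ u) v f = ≡.trans (∫-⊕ (map (x ·_) v) (u ⊗ v) f)
    (≡.trans (cong₂ ℕ._+_ (∫-map (x ·_) v f) (∫-⊗ u v f)) (≡.sym (∫-∷ x u (λ x → ∫ v (λ y → f (x · y))))))

-- Truncated Laurent series in X, z: a monomial (m , i) stands for Xᵐ zⁱ, and a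
-- list of monomials for their sum.  Two sums are equal when every functional
-- that ignores the degrees above N takes the same value modulo M on them, so
-- that M ≈ 0 and Xᵐ ≈ 0 for m > N.
module Truncated (M : ℕ) .{{_ : NonZero M}} (N : ℕ) where

  infix 4 _∼_ _≈_
  -- A record, because `a` and `b` could not be inferred from `a % M ≡ b % M`.
  record _∼_ (a b : ℕ) : Set where
    constructor mk∼
    field %-≡ : a % M ≡ b % M
  open _∼_ public

  ∼-reflexive : ∀ {a b} → a ≡ b → a ∼ b
  ∼-reflexive ≡.refl = mk∼ ≡.refl

  ∼-setoid : Setoid 0ℓ 0ℓ
  ∼-setoid = record
    { Carrier = ℕ ; _≈_ = _∼_
    ; isEquivalence = record
      { refl = mk∼ ≡.refl ; sym = λ p → mk∼ (≡.sym (%-≡ p))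
      ; trans = λ p q → mk∼ (≡.trans (%-≡ p) (%-≡ q)) } }

  module ∼ = Setoid ∼-setoid

  +-∼-cong : ∀ {a b c d} → a ∼ b → c ∼ d → a ℕ.+ c ∼ b ℕ.+ d
  +-∼-cong {a} {b} {c} {d} p q = mk∼ (≡.trans (%-distribˡ-+ a c M)
    (≡.trans (cong₂ (λ x y → (x ℕ.+ y) % M) (%-≡ p) (%-≡ q)) (≡.sym (%-distribˡ-+ b d M))))

  opaque
    unfolding ∫
    ∫-∼-cong : ∀ (u : Series) {f g} → (∀ x → f x ∼ g x) → ∫ u f ∼ ∫ u g
    ∫-∼-cong []      eq = ∼.refl
    ∫-∼-cong (x ∷ u) eq = +-∼-cong (eq x) (∫-∼-cong u eq)

  Bounded : (Monomial → ℕ) → Set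
  Bounded f = ∀ x → N < proj₁ x → f x ≡ 0

  record _≈_ (u v : Series) : Set where
    constructor mk≈
    field test : ∀ f → Bounded f → ∫ u f ∼ ∫ v f
  open _≈_ public

  Bounded-· : ∀ {f} x → Bounded f → Bounded (λ y → f (x · y))
  Bounded-· x b y N<y = b (x · y) (ℕ.<-≤-trans N<y (ℕ.m≤n+m _ (proj₁ x)))

  Bounded-∫ : ∀ {f} v → Bounded f → Bounded (λ x → ∫ v (λ y → f (x · y)))
  Bounded-∫ {f} v b x N<x = ≡.trans
    (∫-cong v (λ y → b (x · y) (ℕ.<-≤-trans N<x (ℕ.m≤m+n (proj₁ x) _)))) (∫-0 v)

  exact : ∀ {u v} → (∀ f → ∫ u f ≡ ∫ v f) → u ≈ v
  exact eq = mk≈ λ f _ → ∼-reflexive (eq f)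

  ⊗-comm : ∀ u v → u ⊗ v ≈ v ⊗ u
  ⊗-comm u v = exact λ f → begin
    ∫ (u ⊗ v) f                          ≡⟨ ∫-⊗ u v f ⟩
    ∫ u (λ x → ∫ v (λ y → f (x · y)))    ≡⟨ ∫-swap u v _ ⟩
    ∫ v (λ y → ∫ u (λ x → f (x · y)))    ≡⟨ ∫-cong v (λ y → ∫-cong u (λ x → cong f (·-comm x y))) ⟩
    ∫ v (λ y → ∫ u (λ x → f (y · x)))    ≡⟨ ∫-⊗ v u f ⟨
    ∫ (v ⊗ u) f                          ∎
    where open ≡-Reasoning

  series : CommutativeSemiring 0ℓ 0ℓ
  series = record
    { Carrier = Series ; _≈_ = _≈_ ; _+_ = _⊕_ ; _*_ = _⊗_ ; 0# = 𝟘 ; 1# = 𝟙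
    ; isCommutativeSemiring = Biased.isCommutativeSemiringˡ record
      { +-isCommutativeMonoid = record
        { isMonoid = record
          { isSemigroup = record
            { isMagma = record { isEquivalence = isEquivalence ; ∙-cong = ⊕-cong }
            ; assoc = λ u v w → exact λ f → begin
                ∫ ((u ⊕ v) ⊕ w) f             ≡⟨ ∫-⊕ (u ⊕ v) w f ⟩
                ∫ (u ⊕ v) f ℕ.+ ∫ w f          ≡⟨ cong (ℕ._+ ∫ w f) (∫-⊕ u v f) ⟩
                ∫ u f ℕ.+ ∫ v f ℕ.+ ∫ w f       ≡⟨ ℕ.+-assoc (∫ u f) _ _ ⟩
                ∫ u f ℕ.+ (∫ v f ℕ.+ ∫ w f)     ≡⟨ cong (∫ u f ℕ.+_) (∫-⊕ v w f) ⟨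
                ∫ u f ℕ.+ ∫ (v ⊕ w) f          ≡⟨ ∫-⊕ u (v ⊕ w) f ⟨
                ∫ (u ⊕ (v ⊕ w)) f             ∎ }
          ; identity = (λ u → exact λ f → ≡.trans (∫-⊕ 𝟘 u f) (cong (ℕ._+ ∫ u f) (∫-𝟘 f)))
                     , (λ u → exact λ f → ≡.trans (∫-⊕ u 𝟘 f) (≡.trans (cong (∫ u f ℕ.+_) (∫-𝟘 f)) (ℕ.+-identityʳ _))) }
        ; comm = λ u v → exact λ f → begin
            ∫ (u ⊕ v) f         ≡⟨ ∫-⊕ u v f ⟩
            ∫ u f ℕ.+ ∫ v f      ≡⟨ ℕ.+-comm (∫ u f) _ ⟩
            ∫ v f ℕ.+ ∫ u f      ≡⟨ ∫-⊕ v u f ⟨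
            ∫ (v ⊕ u) f         ∎ }
      ; *-isCommutativeMonoid = record
        { isMonoid = record
          { isSemigroup = record
            { isMagma = record { isEquivalence = isEquivalence ; ∙-cong = ⊗-cong }
            ; assoc = λ u v w → exact λ f → begin
                ∫ ((u ⊗ v) ⊗ w) f                                       ≡⟨ ∫-⊗ (u ⊗ v) w f ⟩
                ∫ (u ⊗ v) (λ x → ∫ w (λ y → f (x · y)))                 ≡⟨ ∫-⊗ u v _ ⟩
                ∫ u (λ x → ∫ v (λ y → ∫ w (λ z → f (x · y · z))))       ≡⟨ ∫-cong u (λ x → ∫-cong v (λ y → ∫-cong w (λ z → cong f (·-assoc x y z)))) ⟩
                ∫ u (λ x → ∫ v (λ y → ∫ w (λ z → f (x · (y · z)))))     ≡⟨ ∫-cong u (λ x → ∫-⊗ v w (λ y → f (x · y))) ⟨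
                ∫ u (λ x → ∫ (v ⊗ w) (λ y → f (x · y)))                 ≡⟨ ∫-⊗ u (v ⊗ w) f ⟨
                ∫ (u ⊗ (v ⊗ w)) f                                       ∎ }
          ; identity = ⊗-identityˡ , λ u → ≈-trans (⊗-comm u _) (⊗-identityˡ u) }
        ; comm = ⊗-comm }
      ; distribʳ = λ w u v → exact λ f → begin
          ∫ ((u ⊕ v) ⊗ w) f                                 ≡⟨ ∫-⊗ (u ⊕ v) w f ⟩
          ∫ (u ⊕ v) (λ x → ∫ w (λ y → f (x · y)))           ≡⟨ ∫-⊕ u v _ ⟩
          ∫ u (λ x → ∫ w (λ y → f (x · y))) ℕ.+ ∫ v (λ x → ∫ w (λ y → f (x · y)))
                                                             ≡⟨ cong₂ ℕ._+_ (∫-⊗ u w f) (∫-⊗ v w f) ⟨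
          ∫ (u ⊗ w) f ℕ.+ ∫ (v ⊗ w) f                        ≡⟨ ∫-⊕ (u ⊗ w) (v ⊗ w) f ⟨
          ∫ (u ⊗ w ⊕ v ⊗ w) f                               ∎
      ; zeroˡ = λ u → exact λ f → ≡.trans (∫-⊗ 𝟘 u f) (≡.trans (∫-𝟘 _) (≡.sym (∫-𝟘 f))) } }
    where
    open ≡-Reasoning

    ≈-trans : ∀ {u v w} → u ≈ v → v ≈ w → u ≈ w
    ≈-trans p q = mk≈ λ f b → ∼.trans (test p f b) (test q f b)

    isEquivalence : IsEquivalence _≈_
    isEquivalence = record
      { refl = exact (λ _ → ≡.refl)
      ; sym = λ p → mk≈ λ f b → ∼.sym (test p f b)
      ; trans = ≈-trans }

    ⊕-cong : ∀ {u v w t} → u ≈ v → w ≈ t → u ⊕ w ≈ v ⊕ t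
    ⊕-cong {u} {v} {w} {t} p q = mk≈ λ f b →
      ∼.trans (∼-reflexive (∫-⊕ u w f))
        (∼.trans (+-∼-cong (test p f b) (test q f b)) (∼-reflexive (≡.sym (∫-⊕ v t f))))

    -- Testing `u ⊗ v` by `f` means testing `v` by the translates of `f` along the monomials of `u`.
    -- Translates of a bounded test are bounded, as exponents of X are natural numbers.
    ⊗-congˡ : ∀ u {v w} → v ≈ w → u ⊗ v ≈ u ⊗ w
    ⊗-congˡ u {v} {w} p = mk≈ λ f b →
      ∼.trans (∼-reflexive (∫-⊗ u v f))
        (∼.trans (∫-∼-cong u (λ x → test p _ (Bounded-· x b))) (∼-reflexive (≡.sym (∫-⊗ u w f))))

    ⊗-cong : ∀ {u v w t} → u ≈ v → w ≈ t → u ⊗ w ≈ v ⊗ t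
    ⊗-cong {u} {v} {w} {t} p q =
      ≈-trans (⊗-congˡ u q) (≈-trans (⊗-comm u t) (≈-trans (⊗-congˡ t p) (⊗-comm t v)))

    ⊗-identityˡ : ∀ u → 𝟙 ⊗ u ≈ u
    ⊗-identityˡ u = exact λ f → ≡.trans (∫-⊗ 𝟙 u f)
      (≡.trans (∫-𝟙 _) (∫-cong u (λ x → cong f (·-identityˡ x))))

  open CommutativeSemiring series public
    hiding (_≈_; zero)
  open Algebra.Properties.Semiring.Mult semiring public using () renaming (_×_ to _✕_)

  ∫-✕ : ∀ k u f → ∫ (k ✕ u) f ≡ k ℕ.* ∫ u f
  ∫-✕ zero    u f = ∫-𝟘 f
  ∫-✕ (suc k) u f = ≡.trans (∫-⊕ u (k ✕ u) f) (cong (∫ u f ℕ.+_) (∫-✕ k u f))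

  M✕≈0 : ∀ u → M ✕ u ≈ 0#
  M✕≈0 u = mk≈ λ f _ → mk∼ (≡.trans (cong (_% M) (≡.trans (∫-✕ M u f) (ℕ.*-comm M _)))
    (≡.trans (m*n%n≡0 (∫ u f) M) (≡.trans (≡.sym (m*n%n≡0 0 M)) (cong (_% M) (≡.sym (∫-𝟘 f))))))

  mono : ℕ → ℤ → Series
  mono m i = (m , i) ∷ []

  mono-* : ∀ m i n j → mono m i * mono n j ≈ mono (m ℕ.+ n) (i ℤ.+ j)
  mono-* m i n j = exact λ f → ≡.trans (∫-⊗ (mono m i) (mono n j) f)
    (≡.trans (∫-single (m , i) _) (≡.trans (∫-single (n , j) _) (≡.sym (∫-single _ f))))

  mono-1 : mono 0 (+ 0) ≈ 1#
  mono-1 = exact λ f → ≡.trans (∫-single _ f) (≡.sym (∫-𝟙 f))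

  mono-large : ∀ {m i} → N < m → mono m i ≈ 0#
  mono-large N<m = mk≈ λ f b → ∼-reflexive (≡.trans (∫-single _ f) (≡.trans (b _ N<m) (≡.sym (∫-𝟘 f))))

  -- Supp Q u: the monomials of u outside Q cancel.
  record Supp (Q : Monomial → Set) (u : Series) : Set where
    constructor mkSupp
    field apply : ∀ {f g} → Bounded f → Bounded g → (∀ x → Q x → f x ∼ g x) → ∫ u f ∼ ∫ u g
  open Supp public

  module _ {Q : Monomial → Set} where
    Supp-≈ : ∀ {u v} → u ≈ v → Supp Q u → Supp Q v
    Supp-≈ p s = mkSupp λ bf bg eq →
      ∼.trans (∼.sym (test p _ bf)) (∼.trans (apply s bf bg eq) (test p _ bg))

    Supp-0 : Supp Q 0#
    Supp-0 = mkSupp λ {f} {g} _ _ _ → ∼-reflexive (≡.trans (∫-𝟘 f) (≡.sym (∫-𝟘 g)))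

    Supp-mono : ∀ {m i} → Q (m , i) → Supp Q (mono m i)
    Supp-mono q = mkSupp λ {f} {g} _ _ eq →
      ∼.trans (∼-reflexive (∫-single _ f)) (∼.trans (eq _ q) (∼-reflexive (≡.sym (∫-single _ g))))

    Supp-+ : ∀ {u v} → Supp Q u → Supp Q v → Supp Q (u + v)
    Supp-+ {u} {v} s t = mkSupp λ bf bg eq →
      ∼.trans (∼-reflexive (∫-⊕ u v _))
        (∼.trans (+-∼-cong (apply s bf bg eq) (apply t bf bg eq)) (∼-reflexive (≡.sym (∫-⊕ u v _))))

  Supp-* : ∀ {Q R T : Monomial → Set} → (∀ {x y} → Q x → R y → T (x · y)) →
           ∀ {u v} → Supp Q u → Supp R v → Supp T (u * v)
  Supp-* QR⇒T {u} {v} s t = mkSupp λ bf bg eq →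
    ∼.trans (∼-reflexive (∫-⊗ u v _))
      (∼.trans (apply s (Bounded-∫ v bf) (Bounded-∫ v bg)
                 (λ x qx → apply t (Bounded-· x bf) (Bounded-· x bg) (λ y ry → eq _ (QR⇒T qx ry))))
        (∼-reflexive (≡.sym (∫-⊗ u v _))))

  -- Equality of the coefficients of z⁰.
  infix 4 _≈₀_
  record _≈₀_ (u v : Series) : Set where
    constructor mk≈₀
    field test₀ : ∀ f → Bounded f → (∀ m i → ¬ i ≡ + 0 → f (m , i) ≡ 0) → ∫ u f ∼ ∫ v f
  open _≈₀_ public

  Constant : Monomial → Set
  Constant x = proj₂ x ≡ + 0

  ≈⇒≈₀ : ∀ {u v} → u ≈ v → u ≈₀ v
  ≈⇒≈₀ p = mk≈₀ λ f b _ → test p f b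

  ≈₀-setoid : Setoid 0ℓ 0ℓ
  ≈₀-setoid = record
    { Carrier = Series ; _≈_ = _≈₀_
    ; isEquivalence = record
      { refl = ≈⇒≈₀ (exact λ _ → ≡.refl)
      ; sym = λ p → mk≈₀ λ f b c → ∼.sym (test₀ p f b c)
      ; trans = λ p q → mk≈₀ λ f b c → ∼.trans (test₀ p f b c) (test₀ q f b c) } }

  module ≈₀ = Setoid ≈₀-setoid

  ≈₀-+ : ∀ {u v w t} → u ≈₀ v → w ≈₀ t → u + w ≈₀ v + t
  ≈₀-+ {u} {v} {w} {t} p q = mk≈₀ λ f b c →
    ∼.trans (∼-reflexive (∫-⊕ u w f))
      (∼.trans (+-∼-cong (test₀ p f b c) (test₀ q f b c)) (∼-reflexive (≡.sym (∫-⊕ v t f))))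

  -- `≈₀` is not a congruence for products in general. A factor free of z is harmless, because
  -- translating a test along it preserves vanishing off z⁰.
  ≈₀-*ˡ : ∀ {u v w} → Supp Constant u → v ≈₀ w → u * v ≈₀ u * w
  ≈₀-*ˡ {u} {v} {w} s p = mk≈₀ λ f b c →
    ∼.trans (∼-reflexive (∫-⊗ u v f))
      (∼.trans (apply s (Bounded-∫ v b) (Bounded-∫ w b)
        (λ { (m , _) ≡.refl → test₀ p _ (Bounded-· (m , + 0) b)
          (λ n j j≢0 → c (m ℕ.+ n) _ (λ eq → j≢0 (≡.trans (≡.sym (ℤ.+-identityˡ j)) eq))) }))
        (∼-reflexive (≡.sym (∫-⊗ u w f))))

  ≈₀-0 : ∀ {u} → Supp (λ x → ¬ Constant x) u → u ≈₀ 0#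
  ≈₀-0 {u} s = mk≈₀ λ f b c →
    ∼.trans (apply s b (λ _ _ → ≡.refl) (λ x i≢0 → ∼-reflexive (c _ _ i≢0))) (∼-reflexive (≡.trans (∫-0 u) (≡.sym (∫-𝟘 f))))

  -- On series free of z, a test `f` can be replaced by `cut f`, its restriction to the monomials
  -- without z.
  ≈₀⇒≈ : ∀ {u v} → Supp Constant u → Supp Constant v → u ≈₀ v → u ≈ v
  ≈₀⇒≈ {u} {v} s t p = mk≈ λ f b →
    ∼.trans (apply s b (bounded f b) (agree f))
      (∼.trans (test₀ p (cut f) (bounded f b) (off f)) (∼.sym (apply t b (bounded f b) (agree f))))
    where
    cut : (Monomial → ℕ) → Monomial → ℕ
    cut f (m , i) with i ℤ.≟ + 0
    ... | yes _ = f (m , i)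
    ... | no _  = 0

    bounded : ∀ f → Bounded f → Bounded (cut f)
    bounded f b (m , i) N<m with i ℤ.≟ + 0
    ... | yes _ = b _ N<m
    ... | no _  = ≡.refl

    agree : ∀ f x → Constant x → f x ∼ cut f x
    agree f (m , i) i≡0 with i ℤ.≟ + 0
    ... | yes _  = ∼.refl
    ... | no i≢0 = contradiction i≡0 i≢0

    off : ∀ f m i → ¬ i ≡ + 0 → cut f (m , i) ≡ 0
    off f m i i≢0 with i ℤ.≟ + 0
    ... | yes i≡0 = contradiction i≡0 i≢0
    ... | no _    = ≡.refl

  indicator : ℕ → Monomial → ℕ
  indicator m (n , i) with n ℕ.≟ m | i ℤ.≟ + 0
  ... | yes _ | yes _ = 1
  ... | _     | _     = 0

  indicator-≢ : ∀ {m} x → ¬ x ≡ (m , + 0) → indicator m x ≡ 0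
  indicator-≢ {m} (n , i) ne with n ℕ.≟ m | i ℤ.≟ + 0
  ... | yes ≡.refl | yes ≡.refl = contradiction ≡.refl ne
  ... | yes _      | no _       = ≡.refl
  ... | no _       | _          = ≡.refl

  indicator-≡ : ∀ {m x} → x ≡ (m , + 0) → indicator m x ≡ 1
  indicator-≡ {m} ≡.refl with m ℕ.≟ m | + 0 ℤ.≟ + 0
  ... | yes _ | yes _ = ≡.refl
  ... | no ¬p | _     = contradiction ≡.refl ¬p
  ... | yes _ | no ¬p = contradiction ≡.refl ¬p

  coeff : ℕ → Series → ℕ
  coeff m u = ∫ u (indicator m)

  indicator-bounded : ∀ {m} → m ≤ N → Bounded (indicator m)
  indicator-bounded m≤N x N<n = indicator-≢ x λ { ≡.refl → ℕ.<⇒≱ N<n m≤N }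

  coeff-≈₀ : ∀ {m u v} → m ≤ N → u ≈₀ v → coeff m u ∼ coeff m v
  coeff-≈₀ m≤N p = test₀ p _ (indicator-bounded m≤N)
    (λ n i i≢0 → indicator-≢ (n , i) λ { ≡.refl → i≢0 ≡.refl })

  coeff-Supp : ∀ {m u Q} → m ≤ N → Supp Q u → ¬ Q (m , + 0) → coeff m u ∼ 0
  coeff-Supp {u = u} m≤N s ¬q = ∼.trans
    (apply s (indicator-bounded m≤N) (λ _ _ → ≡.refl)
      (λ x qx → ∼-reflexive (indicator-≢ x λ { ≡.refl → ¬q qx })))
    (∼-reflexive (∫-0 u))

-- Sums over ℤ

-m-1+1 : ∀ m → -[1+ m ] ℤ.+ 1ℤ ≡ ℤ.- (+ m)
-m-1+1 zero    = ≡.refl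
-m-1+1 (suc m) = ≡.refl

R+∣t∣<∣m∣⇒R<∣m+t∣ : ∀ {R} t m → R ℕ.+ ∣ t ∣ < ∣ m ∣ → R < ∣ m ℤ.+ t ∣
R+∣t∣<∣m∣⇒R<∣m+t∣ {R} t m p = ℕ.+-cancelʳ-< ∣ t ∣ R _ (ℕ.<-≤-trans p (begin
  ∣ m ∣                               ≡⟨ cong ∣_∣ (m≡m+t-t m t) ⟩
  ∣ (m ℤ.+ t) ℤ.+ (ℤ.- t) ∣           ≤⟨ ℤ.∣i+j∣≤∣i∣+∣j∣ (m ℤ.+ t) (ℤ.- t) ⟩
  ∣ m ℤ.+ t ∣ ℕ.+ ∣ ℤ.- t ∣           ≡⟨ cong (∣ m ℤ.+ t ∣ ℕ.+_) (ℤ.∣-i∣≡∣i∣ t) ⟩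
  ∣ m ℤ.+ t ∣ ℕ.+ ∣ t ∣               ∎))
  where
  open ℕ.≤-Reasoning
  m≡m+t-t : ∀ m t → m ≡ (m ℤ.+ t) ℤ.+ (ℤ.- t)
  m≡m+t-t = solve-∀

∣m+m∣ : ∀ m → ∣ m ℤ.+ m ∣ ≡ ∣ m ∣ ℕ.+ ∣ m ∣
∣m+m∣ (+ m)    = ≡.refl
∣m+m∣ -[1+ m ] = cong suc (≡.sym (ℕ.+-suc m m))

module BilateralSum {c ℓ} (S : CommutativeSemiring c ℓ) where
  open CommutativeSemiring S
  open Relation.Binary.Reasoning.Setoid setoid
  open Algebra.Properties.CommutativeSemigroup +-commutativeSemigroup using (interchange; xy∙z≈xz∙y)

  ∑ : ℕ → (ℕ → Carrier) → Carrier
  ∑ zero    f = 0#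
  ∑ (suc n) f = ∑ n f + f n

  ∑-cong : ∀ n {f g} → (∀ i → f i ≈ g i) → ∑ n f ≈ ∑ n g
  ∑-cong zero    eq = refl
  ∑-cong (suc n) eq = +-cong (∑-cong n eq) (eq n)

  ∑-+ : ∀ n f g → ∑ n (λ i → f i + g i) ≈ ∑ n f + ∑ n g
  ∑-+ zero    f g = sym (+-identityˡ 0#)
  ∑-+ (suc n) f g = trans (+-congʳ (∑-+ n f g)) (interchange _ _ _ _)

  ∑-0 : ∀ n {f} → (∀ i → f i ≈ 0#) → ∑ n f ≈ 0#
  ∑-0 zero    eq = refl
  ∑-0 (suc n) eq = trans (+-cong (∑-0 n eq) (eq n)) (+-identityˡ 0#)

  ∑-*ˡ : ∀ n a f → a * ∑ n f ≈ ∑ n (λ i → a * f i)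
  ∑-*ˡ zero    a f = zeroʳ a
  ∑-*ˡ (suc n) a f = trans (distribˡ a _ _) (+-congʳ (∑-*ˡ n a f))

  ∑-swap : ∀ m n (f : ℕ → ℕ → Carrier) → ∑ m (λ i → ∑ n (f i)) ≈ ∑ n (λ j → ∑ m (λ i → f i j))
  ∑-swap zero    n f = sym (∑-0 n {λ _ → 0#} (λ _ → refl))
  ∑-swap (suc m) n f = trans (+-congʳ (∑-swap m n f)) (sym (∑-+ n (λ j → ∑ m (λ i → f i j)) (f m)))

  Supported : ℕ → (ℤ → Carrier) → Set ℓ
  Supported R g = ∀ m → R < ∣ m ∣ → g m ≈ 0#

  opaque
    -- ∑ᶻ B g is the sum of g m over -B ≤ m < B.
    ∑ᶻ : ℕ → (ℤ → Carrier) → Carrier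
    ∑ᶻ B g = ∑ B (λ i → g (+ i) + g -[1+ i ])

    ∑ᶻ-cong : ∀ B {g h} → (∀ m → g m ≈ h m) → ∑ᶻ B g ≈ ∑ᶻ B h
    ∑ᶻ-cong B eq = ∑-cong B (λ i → +-cong (eq _) (eq _))

    ∑ᶻ-0 : ∀ B {g} → (∀ m → g m ≈ 0#) → ∑ᶻ B g ≈ 0#
    ∑ᶻ-0 B eq = ∑-0 B (λ i → trans (+-cong (eq _) (eq _)) (+-identityˡ 0#))

    ∑ᶻ-*ˡ : ∀ B a g → a * ∑ᶻ B g ≈ ∑ᶻ B (λ m → a * g m)
    ∑ᶻ-*ˡ B a g = trans (∑-*ˡ B a _) (∑-cong B (λ i → distribˡ a _ _))

    ∑ᶻ-swap : ∀ A B (w : ℤ → ℤ → Carrier) → ∑ᶻ A (λ m → ∑ᶻ B (w m)) ≈ ∑ᶻ B (λ n → ∑ᶻ A (λ m → w m n))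
    ∑ᶻ-swap A B w = begin
      ∑ A (λ i → ∑ B (λ j → w (+ i) (+ j) + w (+ i) -[1+ j ]) + ∑ B (λ j → w -[1+ i ] (+ j) + w -[1+ i ] -[1+ j ]))
        ≈⟨ ∑-cong A (λ i → sym (∑-+ B _ _)) ⟩
      ∑ A (λ i → ∑ B (λ j → (w (+ i) (+ j) + w (+ i) -[1+ j ]) + (w -[1+ i ] (+ j) + w -[1+ i ] -[1+ j ])))
        ≈⟨ ∑-swap A B _ ⟩
      ∑ B (λ j → ∑ A (λ i → (w (+ i) (+ j) + w (+ i) -[1+ j ]) + (w -[1+ i ] (+ j) + w -[1+ i ] -[1+ j ])))
        ≈⟨ ∑-cong B (λ j → trans (∑-cong A (λ i → interchange _ _ _ _)) (∑-+ A _ _)) ⟩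
      ∑ B (λ j → ∑ A (λ i → w (+ i) (+ j) + w -[1+ i ] (+ j)) + ∑ A (λ i → w (+ i) -[1+ j ] + w -[1+ i ] -[1+ j ]))
        ∎

    ∑ᶻ-extend : ∀ {R g} → Supported R g → ∀ B k → R < B → ∑ᶻ (k ℕ.+ B) g ≈ ∑ᶻ B g
    ∑ᶻ-extend s B zero    R<B = refl
    ∑ᶻ-extend {R} s B (suc k) R<B = trans
      (+-cong (∑ᶻ-extend s B k R<B)
        (trans (+-cong (s _ R<k+B) (s _ (ℕ.m<n⇒m<1+n R<k+B))) (+-identityˡ 0#)))
      (+-identityʳ _)
      where
      R<k+B : R < k ℕ.+ B
      R<k+B = ℕ.<-≤-trans R<B (ℕ.m≤n+m B k)

    -- Both sides run over -B ≤ m ≤ B. The boundary terms stand on both sides for want of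
    -- subtraction.
    ∑ᶻ-suc : ∀ B g → ∑ᶻ B (λ m → g (m ℤ.+ 1ℤ)) + g (ℤ.- (+ B)) ≈ ∑ᶻ B g + g (+ B)
    ∑ᶻ-suc zero    g = refl
    ∑ᶻ-suc (suc B) g = begin
      ∑ᶻ B (λ m → g (m ℤ.+ 1ℤ)) + (g (+ (B ℕ.+ 1)) + g (-[1+ B ] ℤ.+ 1ℤ)) + g -[1+ B ]
        ≈⟨ +-congʳ (+-congˡ (trans (+-cong (reflexive (cong (λ k → g (+ k)) (ℕ.+-comm B 1)))
                                           (reflexive (cong g (-m-1+1 B)))) (+-comm _ _))) ⟩
      ∑ᶻ B (λ m → g (m ℤ.+ 1ℤ)) + (g (ℤ.- (+ B)) + g (+ suc B)) + g -[1+ B ]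
        ≈⟨ +-congʳ (+-assoc _ _ _) ⟨
      ∑ᶻ B (λ m → g (m ℤ.+ 1ℤ)) + g (ℤ.- (+ B)) + g (+ suc B) + g -[1+ B ]
        ≈⟨ +-congʳ (+-congʳ (∑ᶻ-suc B g)) ⟩
      ∑ᶻ B g + g (+ B) + g (+ suc B) + g -[1+ B ]
        ≈⟨ xy∙z≈xz∙y _ _ _ ⟩
      ∑ᶻ B g + g (+ B) + g -[1+ B ] + g (+ suc B)
        ≈⟨ +-congʳ (+-assoc _ _ _) ⟩
      ∑ᶻ (suc B) g + g (+ suc B) ∎

    -- The half-open window makes this exact, with no boundary terms: 2s and 2s + 1 for -B ≤ s < B
    -- fill -2B ≤ k < 2B.
    ∑ᶻ-parity : ∀ B h → ∑ᶻ (B ℕ.+ B) h ≈ ∑ᶻ B (λ s → h (s ℤ.+ s)) + ∑ᶻ B (λ s → h (s ℤ.+ s ℤ.+ 1ℤ))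
    ∑ᶻ-parity zero    h = sym (+-identityˡ 0#)
    ∑ᶻ-parity (suc B) h rewrite ℕ.+-suc B B = begin
      ∑ᶻ (B ℕ.+ B) h + (h (+ (B ℕ.+ B)) + h -[1+ B ℕ.+ B ]) + (h (+ suc (B ℕ.+ B)) + h -[1+ suc (B ℕ.+ B) ])
        ≈⟨ +-assoc _ _ _ ⟩
      ∑ᶻ (B ℕ.+ B) h + ((h (+ (B ℕ.+ B)) + h -[1+ B ℕ.+ B ]) + (h (+ suc (B ℕ.+ B)) + h -[1+ suc (B ℕ.+ B) ]))
        ≈⟨ +-cong (∑ᶻ-parity B h) (trans (+-congˡ (+-comm _ _)) (interchange _ _ _ _)) ⟩
      E + O + ((h (+ (B ℕ.+ B)) + h -[1+ suc (B ℕ.+ B) ]) + (h -[1+ B ℕ.+ B ] + h (+ suc (B ℕ.+ B))))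
        ≈⟨ interchange _ _ _ _ ⟩
      E + (h (+ (B ℕ.+ B)) + h -[1+ suc (B ℕ.+ B) ]) + (O + (h -[1+ B ℕ.+ B ] + h (+ suc (B ℕ.+ B))))
        ≈⟨ +-congˡ (+-congˡ (trans (+-comm _ _) (+-cong
             (reflexive (cong (λ k → h (+ k)) (ℕ.+-comm 1 (B ℕ.+ B))))
             (reflexive (cong h (≡.sym (-m-1+1 (suc (B ℕ.+ B))))))))) ⟩
      ∑ᶻ (suc B) (λ s → h (s ℤ.+ s)) + ∑ᶻ (suc B) (λ s → h (s ℤ.+ s ℤ.+ 1ℤ)) ∎
      where
      E O : Carrier
      E = ∑ᶻ B (λ s → h (s ℤ.+ s))
      O = ∑ᶻ B (λ s → h (s ℤ.+ s ℤ.+ 1ℤ))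

  ∑ᶻ-*ʳ : ∀ B a g → ∑ᶻ B g * a ≈ ∑ᶻ B (λ m → g m * a)
  ∑ᶻ-*ʳ B a g = trans (*-comm _ a) (trans (∑ᶻ-*ˡ B a g) (∑ᶻ-cong B (λ m → *-comm a _)))

  ∑ᶻ-* : ∀ B g h → ∑ᶻ B g * ∑ᶻ B h ≈ ∑ᶻ B (λ m → ∑ᶻ B (λ n → g m * h n))
  ∑ᶻ-* B g h = trans (∑ᶻ-*ʳ B _ g) (∑ᶻ-cong B (λ m → ∑ᶻ-*ˡ B (g m) h))

  ∑ᶻ-suc-vanishing : ∀ B g → g (ℤ.- (+ B)) ≈ 0# → g (+ B) ≈ 0# → ∑ᶻ B (λ m → g (m ℤ.+ 1ℤ)) ≈ ∑ᶻ B g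
  ∑ᶻ-suc-vanishing B g lo hi = begin
    ∑ᶻ B (λ m → g (m ℤ.+ 1ℤ))                     ≈⟨ +-identityʳ _ ⟨
    ∑ᶻ B (λ m → g (m ℤ.+ 1ℤ)) + 0#                ≈⟨ +-congˡ lo ⟨
    ∑ᶻ B (λ m → g (m ℤ.+ 1ℤ)) + g (ℤ.- (+ B))     ≈⟨ ∑ᶻ-suc B g ⟩
    ∑ᶻ B g + g (+ B)                              ≈⟨ +-congˡ hi ⟩
    ∑ᶻ B g + 0#                                   ≈⟨ +-identityʳ _ ⟩
    ∑ᶻ B g                                        ∎

  module _ {R : ℕ} {g : ℤ → Carrier} (supp : Supported R g) {B : ℕ} where
    private
      shift⁺ : ∀ k → R ℕ.+ k < B → ∑ᶻ B (λ m → g (m ℤ.+ (+ k))) ≈ ∑ᶻ B g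
      shift⁺ zero    p = ∑ᶻ-cong B (λ m → reflexive (cong g (ℤ.+-identityʳ m)))
      shift⁺ (suc k) p = begin
        ∑ᶻ B (λ m → g (m ℤ.+ (+ suc k)))          ≈⟨ ∑ᶻ-cong B (λ m → reflexive (cong g (≡.sym (ℤ.+-assoc m 1ℤ (+ k))))) ⟩
        ∑ᶻ B (λ m → g ((m ℤ.+ 1ℤ) ℤ.+ (+ k)))     ≈⟨ ∑ᶻ-suc-vanishing B (λ m → g (m ℤ.+ (+ k)))
                                                       (supp _ (R+∣t∣<∣m∣⇒R<∣m+t∣ (+ k) (ℤ.- (+ B)) (≡.subst (R ℕ.+ k <_) (≡.sym (ℤ.∣-i∣≡∣i∣ (+ B))) p′)))
                                                       (supp _ (R+∣t∣<∣m∣⇒R<∣m+t∣ (+ k) (+ B) p′)) ⟩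
        ∑ᶻ B (λ m → g (m ℤ.+ (+ k)))              ≈⟨ shift⁺ k p′ ⟩
        ∑ᶻ B g                                    ∎
        where p′ = ℕ.<-trans (ℕ.+-monoʳ-< R (ℕ.n<1+n k)) p

      shift⁻ : ∀ k → R ℕ.+ k < B → ∑ᶻ B (λ m → g (m ℤ.+ (ℤ.- (+ k)))) ≈ ∑ᶻ B g
      shift⁻ zero    p = ∑ᶻ-cong B (λ m → reflexive (cong g (ℤ.+-identityʳ m)))
      shift⁻ (suc k) p = begin
        ∑ᶻ B (λ m → g (m ℤ.+ -[1+ k ]))                    ≈⟨ ∑ᶻ-suc-vanishing B (λ m → g (m ℤ.+ -[1+ k ]))
                                                       (supp _ (R+∣t∣<∣m∣⇒R<∣m+t∣ -[1+ k ] (ℤ.- (+ B)) (≡.subst (R ℕ.+ suc k <_) (≡.sym (ℤ.∣-i∣≡∣i∣ (+ B))) p)))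
                                                       (supp _ (R+∣t∣<∣m∣⇒R<∣m+t∣ -[1+ k ] (+ B) p)) ⟨
        ∑ᶻ B (λ m → g ((m ℤ.+ 1ℤ) ℤ.+ -[1+ k ]))           ≈⟨ ∑ᶻ-cong B (λ m → reflexive (cong g
                                                                (≡.trans (ℤ.+-assoc m 1ℤ -[1+ k ]) (cong (λ t → m ℤ.+ t)
                                                                  (≡.trans (ℤ.+-comm 1ℤ -[1+ k ]) (-m-1+1 k)))))) ⟩
        ∑ᶻ B (λ m → g (m ℤ.+ (ℤ.- (+ k))))                 ≈⟨ shift⁻ k (ℕ.<-trans (ℕ.+-monoʳ-< R (ℕ.n<1+n k)) p) ⟩
        ∑ᶻ B g                                             ∎

    ∑ᶻ-shift : ∀ t → R ℕ.+ ∣ t ∣ < B → ∑ᶻ B (λ m → g (m ℤ.+ t)) ≈ ∑ᶻ B g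
    ∑ᶻ-shift (+ k)    = shift⁺ k
    ∑ᶻ-shift -[1+ k ] = shift⁻ (suc k)

  module _ {R : ℕ} {w : ℤ → ℤ → Carrier}
           (suppˡ : ∀ m n → R < ∣ m ∣ → w m n ≈ 0#)
           (suppʳ : ∀ m n → R < ∣ n ∣ → w m n ≈ 0#)
           {B : ℕ} (bound : R ℕ.+ suc (suc (R ℕ.+ R)) < B) where
    private
      far : ∀ {m n} k → m ℤ.+ n ≡ k → R ℕ.+ R < ∣ k ∣ → w m n ≈ 0#
      far {m} {n} _ ≡.refl p with R ℕ.<? ∣ m ∣
      ... | yes R<m = suppˡ m n R<m
      ... | no  R≮m = suppʳ m n (ℕ.+-cancelˡ-< R R _
        (ℕ.<-≤-trans p (ℕ.≤-trans (ℤ.∣i+j∣≤∣i∣+∣j∣ m n) (ℕ.+-monoˡ-≤ ∣ n ∣ (ℕ.≮⇒≥ R≮m)))))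

      2R<B : R ℕ.+ R < B
      2R<B = ℕ.≤-<-trans (ℕ.+-monoʳ-≤ R (ℕ.m≤n⇒m≤1+n (ℕ.m≤n⇒m≤1+n (ℕ.m≤m+n R R)))) bound

      h : ℤ → Carrier
      h k = ∑ᶻ B (λ m → w m (k ℤ.+ (ℤ.- m)))

      h-supp : Supported (R ℕ.+ R) h
      h-supp k p = ∑ᶻ-0 B (λ m → far k (m+k-m m k) p)
        where
        m+k-m : ∀ m k → m ℤ.+ (k ℤ.+ (ℤ.- m)) ≡ k
        m+k-m = solve-∀

      antidiagonal : ∀ m → ∑ᶻ B (w m) ≈ ∑ᶻ B (λ k → w m (k ℤ.+ (ℤ.- m)))
      antidiagonal m with R ℕ.<? ∣ m ∣
      ... | yes R<m = trans (∑ᶻ-0 B (λ n → suppˡ m n R<m)) (sym (∑ᶻ-0 B (λ n → suppˡ m _ R<m)))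
      ... | no  R≮m = sym (∑ᶻ-shift (suppʳ m) (ℤ.- m)
        (ℕ.≤-<-trans (ℕ.+-monoʳ-≤ R (≡.subst (ℕ._≤ R) (≡.sym (ℤ.∣-i∣≡∣i∣ m)) (ℕ.≮⇒≥ R≮m))) 2R<B))

      -- For fixed k, the substitution m = a + t turns h k into a sum over t.
      recentre : ∀ k a → (∣ k ∣ ≤ R ℕ.+ R → ∣ a ∣ ≤ suc (suc (R ℕ.+ R))) →
                 h k ≈ ∑ᶻ B (λ t → w (t ℤ.+ a) (k ℤ.+ (ℤ.- (t ℤ.+ a))))
      recentre k a small with (R ℕ.+ R) ℕ.<? ∣ k ∣
      ... | yes p = trans (h-supp k p) (sym (∑ᶻ-0 B (λ t → far k (m+k-m (t ℤ.+ a) k) p)))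
        where
        m+k-m : ∀ m k → m ℤ.+ (k ℤ.+ (ℤ.- m)) ≡ k
        m+k-m = solve-∀
      ... | no ¬p = sym (∑ᶻ-shift {R} (λ m → suppˡ m (k ℤ.+ (ℤ.- m))) a
                      (ℕ.≤-<-trans (ℕ.+-monoʳ-≤ R (small (ℕ.≮⇒≥ ¬p))) bound))

      half : ∀ s → ∣ s ∣ ≤ ∣ s ℤ.+ s ∣
      half s = ≡.subst (∣ s ∣ ≤_) (≡.sym (∣m+m∣ s)) (ℕ.m≤m+n ∣ s ∣ ∣ s ∣)

      small-even : ∀ s → ∣ s ℤ.+ s ∣ ≤ R ℕ.+ R → ∣ s ∣ ≤ suc (suc (R ℕ.+ R))
      small-even s p = ℕ.m≤n⇒m≤1+n (ℕ.m≤n⇒m≤1+n (ℕ.≤-trans (half s) p))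

      -- The double of s + 1 exceeds 2s + 1 by one only. Recentring thus shifts by at most 2R + 2,
      -- which is where `bound` comes from.
      small-odd : ∀ s → ∣ s ℤ.+ s ℤ.+ 1ℤ ∣ ≤ R ℕ.+ R → ∣ s ℤ.+ 1ℤ ∣ ≤ suc (suc (R ℕ.+ R))
      small-odd s p = ℕ.≤-trans (half (s ℤ.+ 1ℤ)) (ℕ.≤-trans
        (≡.subst (λ k → ∣ k ∣ ≤ ∣ s ℤ.+ s ℤ.+ 1ℤ ∣ ℕ.+ 1) (eq s) (ℤ.∣i+j∣≤∣i∣+∣j∣ (s ℤ.+ s ℤ.+ 1ℤ) 1ℤ))
        (≡.subst (_≤ suc (suc (R ℕ.+ R))) (ℕ.+-comm 1 _) (ℕ.m≤n⇒m≤1+n (ℕ.s≤s p))))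
        where
        eq : ∀ s → s ℤ.+ s ℤ.+ 1ℤ ℤ.+ 1ℤ ≡ s ℤ.+ 1ℤ ℤ.+ (s ℤ.+ 1ℤ)
        eq = solve-∀

    -- ℤ² is the disjoint union of the images of (s , t) ↦ (s + t , s - t) and
    -- (s , t) ↦ (s + t + 1 , s - t).
    ∑ᶻ-lattice : ∑ᶻ B (λ m → ∑ᶻ B (w m)) ≈
                 ∑ᶻ B (λ s → ∑ᶻ B (λ t → w (s ℤ.+ t) (s ℤ.+ (ℤ.- t)))) +
                 ∑ᶻ B (λ s → ∑ᶻ B (λ t → w (s ℤ.+ t ℤ.+ 1ℤ) (s ℤ.+ (ℤ.- t))))
    ∑ᶻ-lattice = begin
      ∑ᶻ B (λ m → ∑ᶻ B (w m))                                 ≈⟨ ∑ᶻ-cong B antidiagonal ⟩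
      ∑ᶻ B (λ m → ∑ᶻ B (λ k → w m (k ℤ.+ (ℤ.- m))))           ≈⟨ ∑ᶻ-swap B B (λ m k → w m (k ℤ.+ (ℤ.- m))) ⟩
      -- The window is doubled to split it by parity; this adds nothing, since `h` vanishes beyond
      -- 2R < B.
      ∑ᶻ B h                                                  ≈⟨ ∑ᶻ-extend h-supp B B 2R<B ⟨
      ∑ᶻ (B ℕ.+ B) h                                          ≈⟨ ∑ᶻ-parity B h ⟩
      ∑ᶻ B (λ s → h (s ℤ.+ s)) + ∑ᶻ B (λ s → h (s ℤ.+ s ℤ.+ 1ℤ))
        ≈⟨ +-cong
             (∑ᶻ-cong B (λ s → trans (recentre (s ℤ.+ s) s (small-even s))
               (∑ᶻ-cong B (λ t → reflexive (≡.cong₂ w (ℤ.+-comm t s) (even s t))))))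
             (∑ᶻ-cong B (λ s → trans (recentre (s ℤ.+ s ℤ.+ 1ℤ) (s ℤ.+ 1ℤ) (small-odd s))
               (∑ᶻ-cong B (λ t → reflexive (≡.cong₂ w (odd₁ s t) (odd₂ s t)))))) ⟩
      _ ∎
      where
      even : ∀ s t → s ℤ.+ s ℤ.+ (ℤ.- (t ℤ.+ s)) ≡ s ℤ.+ (ℤ.- t)
      even = solve-∀
      odd₁ : ∀ s t → t ℤ.+ (s ℤ.+ 1ℤ) ≡ s ℤ.+ t ℤ.+ 1ℤ
      odd₁ = solve-∀
      odd₂ : ∀ s t → s ℤ.+ s ℤ.+ 1ℤ ℤ.+ (ℤ.- (t ℤ.+ (s ℤ.+ 1ℤ))) ≡ s ℤ.+ (ℤ.- t)
      odd₂ = solve-∀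

  -- On each of the two cosets the summand separates in `s` and `t`, so both double sums of
  -- `∑ᶻ-lattice` are products again.
  ∑ᶻ-product : ∀ {R g h g₀ h₀ g₁ h₁} → Supported R g → Supported R h →
    (∀ s t → g (s ℤ.+ t) * h (s ℤ.+ (ℤ.- t)) ≈ g₀ s * h₀ t) →
    (∀ s t → g (s ℤ.+ t ℤ.+ 1ℤ) * h (s ℤ.+ (ℤ.- t)) ≈ g₁ s * h₁ t) →
    ∀ {B} → R ℕ.+ suc (suc (R ℕ.+ R)) < B →
    ∑ᶻ B g * ∑ᶻ B h ≈ ∑ᶻ B g₀ * ∑ᶻ B h₀ + ∑ᶻ B g₁ * ∑ᶻ B h₁
  ∑ᶻ-product {g = g} {h} suppᵍ suppʰ even odd {B} bound = begin
    ∑ᶻ B g * ∑ᶻ B h                          ≈⟨ ∑ᶻ-* B g h ⟩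
    ∑ᶻ B (λ m → ∑ᶻ B (λ n → g m * h n))
      ≈⟨ ∑ᶻ-lattice {w = λ m n → g m * h n} (λ m n p → trans (*-congʳ (suppᵍ m p)) (zeroˡ _))
           (λ m n p → trans (*-congˡ (suppʰ n p)) (zeroʳ _)) bound ⟩
    _                                        ≈⟨ +-cong (∑ᶻ-cong B (λ s → ∑ᶻ-cong B (even s)))
                                                       (∑ᶻ-cong B (λ s → ∑ᶻ-cong B (odd s))) ⟩
    _                                        ≈⟨ +-cong (∑ᶻ-* B _ _) (∑ᶻ-* B _ _) ⟨
    _                                        ∎

-- The Jacobi triple product

sq : ℤ → ℕ
sq m = ∣ m ∣ ℕ.* ∣ m ∣

+sq : ∀ m → + sq m ≡ m ℤ.* m
+sq (+ m)    = ℤ.pos-* m m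
+sq -[1+ m ] = ≡.refl

module JacobiTripleProduct {c ℓ} (S : CommutativeSemiring c ℓ) where
  open CommutativeSemiring S hiding (zero)
  open Relation.Binary.Reasoning.Setoid setoid
  open Algebra.Properties.CommutativeSemigroup +-commutativeSemigroup using (interchange; xy∙z≈y∙xz)
  open Algebra.Properties.CommutativeSemigroup *-commutativeSemigroup using ()
    renaming (interchange to *-interchange; xy∙z≈xz∙y to *-xy∙z≈xz∙y; x∙yz≈y∙xz to *-x∙yz≈y∙xz)
  open Algebra.Properties.CommutativeSemiring.Exp S
  open BilateralSum S

  -- Sum over i + j = n. Both indices are kept, so that the sides of a box never involve truncated
  -- subtraction.
  ∑▵ : ℕ → (ℕ → ℕ → Carrier) → Carrier
  ∑▵ zero    h = h 0 0
  ∑▵ (suc n) h = h 0 (suc n) + ∑▵ n (λ i j → h (suc i) j)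

  ∑▵-cong : ∀ n {g h} → (∀ i j → i ℕ.+ j ≡ n → g i j ≈ h i j) → ∑▵ n g ≈ ∑▵ n h
  ∑▵-cong zero    eq = eq 0 0 ≡.refl
  ∑▵-cong (suc n) eq = +-cong (eq 0 (suc n) ≡.refl) (∑▵-cong n (λ i j p → eq (suc i) j (cong suc p)))

  ∑▵-+ : ∀ n g h → ∑▵ n (λ i j → g i j + h i j) ≈ ∑▵ n g + ∑▵ n h
  ∑▵-+ zero    g h = refl
  ∑▵-+ (suc n) g h = trans (+-congˡ (∑▵-+ n (λ i j → g (suc i) j) (λ i j → h (suc i) j))) (interchange _ _ _ _)

  ∑▵-*ʳ : ∀ n h a → ∑▵ n h * a ≈ ∑▵ n (λ i j → h i j * a)
  ∑▵-*ʳ zero    h a = refl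
  ∑▵-*ʳ (suc n) h a = trans (distribʳ a _ _) (+-congˡ (∑▵-*ʳ n (λ i j → h (suc i) j) a))

  ∑▵-last : ∀ n h → ∑▵ (suc n) h ≈ ∑▵ n (λ i j → h i (suc j)) + h (suc n) 0
  ∑▵-last zero    h = refl
  ∑▵-last (suc n) h = trans (+-congˡ (∑▵-last n (λ i j → h (suc i) j))) (sym (+-assoc _ _ _))

  -- As in Pascal's triangle, an inner entry of the next row receives one contribution from each of
  -- its two neighbours above, and an end of the row only one.
  ∑▵-pascal : ∀ {f g h} → (∀ i → h (suc i) 0 ≈ f i 0) → (∀ j → h 0 (suc j) ≈ g 0 j) →
              (∀ i j → h (suc i) (suc j) ≈ f i (suc j) + g (suc i) j) →
              ∀ n → ∑▵ n f + ∑▵ n g ≈ ∑▵ (suc n) h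
  ∑▵-pascal hᶠ hᵍ hᶠᵍ zero    = trans (+-comm _ _) (sym (+-cong (hᵍ 0) (hᶠ 0)))
  ∑▵-pascal {f} {g} {h} hᶠ hᵍ hᶠᵍ (suc n) = begin
    ∑▵ (suc n) f + ∑▵ (suc n) g
      ≈⟨ +-congʳ (∑▵-last n f) ⟩
    (∑▵ n (λ i j → f i (suc j)) + f (suc n) 0) + (g 0 (suc n) + ∑▵ n (λ i j → g (suc i) j))
      ≈⟨ +-cong refl (+-comm _ _) ⟩
    (∑▵ n (λ i j → f i (suc j)) + f (suc n) 0) + (∑▵ n (λ i j → g (suc i) j) + g 0 (suc n))
      ≈⟨ interchange _ _ _ _ ⟩
    (∑▵ n (λ i j → f i (suc j)) + ∑▵ n (λ i j → g (suc i) j)) + (f (suc n) 0 + g 0 (suc n))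
      ≈⟨ +-cong (trans (sym (∑▵-+ n _ _)) (sym (∑▵-cong n (λ i j _ → hᶠᵍ i j))))
                (+-cong (sym (hᶠ (suc n))) (sym (hᵍ (suc n)))) ⟩
    ∑▵ n (λ i j → h (suc i) (suc j)) + (h (suc (suc n)) 0 + h 0 (suc (suc n)))
      ≈⟨ +-assoc _ _ _ ⟨
    ∑▵ n (λ i j → h (suc i) (suc j)) + h (suc (suc n)) 0 + h 0 (suc (suc n))
      ≈⟨ +-congʳ (∑▵-last n (λ i j → h (suc i) j)) ⟨
    ∑▵ (suc n) (λ i j → h (suc i) j) + h 0 (suc (suc n))
      ≈⟨ +-comm _ _ ⟩
    ∑▵ (suc (suc n)) h ∎

  -- The indices i - L fill -L ≤ m ≤ L, and one more term at the lower end completes the half-open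
  -- window.
  ∑▵-centred : ∀ L g → ∑▵ (L ℕ.+ L) (λ i _ → g (+ i ℤ.- + L)) + g -[1+ L ] ≈ ∑ᶻ (suc L) g
  ∑▵-centred zero    g = trans (sym (+-identityˡ _)) (sym ∑ᶻ-1)
    where
    opaque
      unfolding ∑ᶻ
      ∑ᶻ-1 : ∑ᶻ 1 g ≈ 0# + (g 0ℤ + g -1ℤ)
      ∑ᶻ-1 = refl
  ∑▵-centred (suc L) g rewrite ℕ.+-suc L L = begin
    g (ℤ.- (+ suc L)) + ∑▵ (suc (L ℕ.+ L)) (λ i _ → g (+ suc i ℤ.- + suc L)) + g -[1+ suc L ]
      ≈⟨ +-congʳ (+-congˡ (∑▵-last (L ℕ.+ L) (λ i _ → g (+ suc i ℤ.- + suc L)))) ⟩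
    g -[1+ L ] + (∑▵ (L ℕ.+ L) (λ i _ → g (+ suc i ℤ.- + suc L)) + g (+ suc (suc (L ℕ.+ L)) ℤ.- + suc L)) + g -[1+ suc L ]
      ≈⟨ +-congʳ (+-congˡ (+-cong (∑▵-cong (L ℕ.+ L) (λ i _ _ → reflexive (cong g (cancel i))))
                                  (reflexive (cong g (≡.trans (cancel (suc (L ℕ.+ L))) last))))) ⟩
    g -[1+ L ] + (∑▵ (L ℕ.+ L) (λ i _ → g (+ i ℤ.- + L)) + g (+ suc L)) + g -[1+ suc L ]
      ≈⟨ +-congʳ (trans (sym (+-assoc _ _ _)) (+-congʳ (+-comm _ _))) ⟩
    ∑▵ (L ℕ.+ L) (λ i _ → g (+ i ℤ.- + L)) + g -[1+ L ] + g (+ suc L) + g -[1+ suc L ]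
      ≈⟨ trans (+-assoc _ _ _) (+-congʳ (∑▵-centred L g)) ⟩
    ∑ᶻ (suc L) g + (g (+ suc L) + g -[1+ suc L ])
      ≈⟨ ∑ᶻ-step ⟨
    ∑ᶻ (suc (suc L)) g ∎
    where
    opaque
      unfolding ∑ᶻ
      ∑ᶻ-step : ∑ᶻ (suc (suc L)) g ≈ ∑ᶻ (suc L) g + (g (+ suc L) + g -[1+ suc L ])
      ∑ᶻ-step = refl
    cancel : ∀ i → + suc i ℤ.- + suc L ≡ + i ℤ.- + L
    cancel i = ≡.trans (ℤ.m-n≡m⊖n (suc i) (suc L)) (≡.trans (ℤ.[1+m]⊖[1+n]≡m⊖n i L) (≡.sym (ℤ.m-n≡m⊖n i L)))
    last : + suc (L ℕ.+ L) ℤ.- + L ≡ + suc L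
    last = eq (+ suc L) (+ L)
      where
      eq : ∀ a b → a ℤ.+ b ℤ.- b ≡ a
      eq = solve-∀

  ∏ : ℕ → (ℕ → Carrier) → Carrier
  ∏ zero    f = 1#
  ∏ (suc n) f = ∏ n f * f n

  ∏-cong : ∀ n {f g} → (∀ i → f i ≈ g i) → ∏ n f ≈ ∏ n g
  ∏-cong zero    eq = refl
  ∏-cong (suc n) eq = *-cong (∏-cong n eq) (eq n)

  ∏-* : ∀ n f g → ∏ n (λ i → f i * g i) ≈ ∏ n f * ∏ n g
  ∏-* zero    f g = sym (*-identityˡ 1#)
  ∏-* (suc n) f g = trans (*-congʳ (∏-* n f g)) (*-interchange _ _ _ _)

  -- The generating polynomial in q of the partitions fitting in an i × j box.
  box : Carrier → ℕ → ℕ → Carrier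
  box q zero    j       = 1#
  box q (suc i) zero    = 1#
  box q (suc i) (suc j) = box q i (suc j) + q ^ suc i * box q (suc i) j

  box-0 : ∀ q i → box q i 0 ≈ 1#
  box-0 q zero    = refl
  box-0 q (suc i) = refl

  -- The second Pascal rule for Gaussian binomials: `box` is defined by recursion along one side,
  -- this is the recursion along the other. The two rules handle the two kinds of factors of the
  -- triple product.
  box-pascal : ∀ q i j → box q (suc i) (suc j) ≈ box q (suc i) j + q ^ suc j * box q i (suc j)
  box-pascal q zero    zero    = refl
  box-pascal q zero    (suc j) = begin
    1# + q ^ 1 * box q 1 (suc j)                            ≈⟨ +-congˡ (*-congˡ (box-pascal q zero j)) ⟩
    1# + q ^ 1 * (box q 1 j + q ^ suc j * 1#)               ≈⟨ +-congˡ (distribˡ _ _ _) ⟩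
    1# + (q ^ 1 * box q 1 j + q ^ 1 * (q ^ suc j * 1#))     ≈⟨ +-assoc _ _ _ ⟨
    (1# + q ^ 1 * box q 1 j) + q ^ 1 * (q ^ suc j * 1#)     ≈⟨ +-congˡ (*-assoc _ _ _) ⟨
    (1# + q ^ 1 * box q 1 j) + (q ^ 1 * q ^ suc j) * 1#     ≈⟨ +-congˡ (*-congʳ (^-homo-* q 1 (suc j))) ⟨
    (1# + q ^ 1 * box q 1 j) + q ^ suc (suc j) * 1#         ∎
  box-pascal q (suc i) zero    = begin
    box q (suc i) 1 + q ^ suc (suc i) * 1#                  ≈⟨ +-congʳ (box-pascal q i zero) ⟩
    (1# + q ^ 1 * box q i 1) + q ^ suc (suc i) * 1#         ≈⟨ +-assoc _ _ _ ⟩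
    1# + (q ^ 1 * box q i 1 + q ^ suc (suc i) * 1#)         ≈⟨ +-congˡ (+-congˡ (*-congʳ (^-homo-* q 1 (suc i)))) ⟩
    1# + (q ^ 1 * box q i 1 + (q ^ 1 * q ^ suc i) * 1#)     ≈⟨ +-congˡ (+-congˡ (*-assoc _ _ _)) ⟩
    1# + (q ^ 1 * box q i 1 + q ^ 1 * (q ^ suc i * 1#))     ≈⟨ +-congˡ (distribˡ _ _ _) ⟨
    1# + q ^ 1 * box q (suc i) 1                            ∎
  box-pascal q (suc i) (suc j) = begin
    box q (suc i) (suc (suc j)) + q ^ suc (suc i) * box q (suc (suc i)) (suc j)
      ≈⟨ +-cong (box-pascal q i (suc j)) (*-congˡ (box-pascal q (suc i) j)) ⟩
    (b₁₁ + qʲ * b₀₂) + qⁱ * (b₂₀ + q ^ suc j * b₁₁)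
      ≈⟨ +-congˡ (distribˡ _ _ _) ⟩
    (b₁₁ + qʲ * b₀₂) + (qⁱ * b₂₀ + qⁱ * (q ^ suc j * b₁₁))
      ≈⟨ interchange _ _ _ _ ⟩
    (b₁₁ + qⁱ * b₂₀) + (qʲ * b₀₂ + qⁱ * (q ^ suc j * b₁₁))
      ≈⟨ +-congˡ (+-congˡ (trans (sym (*-assoc _ _ _)) (trans (*-congʳ swap) (*-assoc _ _ _)))) ⟩
    (b₁₁ + qⁱ * b₂₀) + (qʲ * b₀₂ + qʲ * (q ^ suc i * b₁₁))
      ≈⟨ +-congˡ (distribˡ _ _ _) ⟨
    box q (suc (suc i)) (suc j) + qʲ * box q (suc i) (suc (suc j)) ∎
    where
    b₁₁ = box q (suc i) (suc j)
    b₀₂ = box q i (suc (suc j))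
    b₂₀ = box q (suc (suc i)) j
    qⁱ = q ^ suc (suc i)
    qʲ = q ^ suc (suc j)
    swap : qⁱ * q ^ suc j ≈ qʲ * q ^ suc i
    swap = trans (sym (^-homo-* q (suc (suc i)) (suc j)))
      (trans (reflexive (cong (q ^_) (eq i j))) (^-homo-* q (suc (suc j)) (suc i)))
      where
      eq : ∀ i j → suc (suc i) ℕ.+ suc j ≡ suc (suc j) ℕ.+ suc i
      eq = ℕRing.solve-∀

  ^-vanish : ∀ {q y m} → y * q ^ m ≈ 0# → ∀ k → y * q ^ (k ℕ.+ m) ≈ 0#
  ^-vanish {q} {y} {m} p zero    = p
  ^-vanish {q} {y} {m} p (suc k) = trans (*-x∙yz≈y∙xz _ _ _) (trans (*-congˡ (^-vanish p k)) (zeroʳ q))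

  -- Adding rows or columns of length > m changes box q i j by multiples of q^(m+1).
  box-stable : ∀ {q y} m → y * q ^ suc m ≈ 0# → ∀ a b → y * box q (a ℕ.+ m) (b ℕ.+ m) ≈ y * box q m m
  box-stable {q} {y} m p (suc a) b with b ℕ.+ m in eq
  ... | zero  = *-congˡ (sym (reflexive (cong (λ k → box q k k) (ℕ.m+n≡0⇒n≡0 b eq))))
  ... | suc l = begin
    y * (box q (a ℕ.+ m) (suc l) + q ^ suc (a ℕ.+ m) * box q (suc (a ℕ.+ m)) l)
      ≈⟨ distribˡ _ _ _ ⟩
    y * box q (a ℕ.+ m) (suc l) + y * (q ^ suc (a ℕ.+ m) * box q (suc (a ℕ.+ m)) l)
      ≈⟨ +-congˡ (trans (sym (*-assoc _ _ _)) (trans (*-congʳ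
           (trans (reflexive (cong (λ k → y * q ^ k) (≡.sym (ℕ.+-suc a m)))) (^-vanish p a))) (zeroˡ _))) ⟩
    y * box q (a ℕ.+ m) (suc l) + 0#
      ≈⟨ +-identityʳ _ ⟩
    y * box q (a ℕ.+ m) (suc l)
      ≡⟨ cong (λ k → y * box q (a ℕ.+ m) k) eq ⟨
    y * box q (a ℕ.+ m) (b ℕ.+ m)
      ≈⟨ box-stable m p a b ⟩
    y * box q m m ∎
  box-stable {q} {y} m p zero zero = refl
  box-stable {q} {y} zero p zero (suc b) = refl
  box-stable {q} {y} m@(suc l) p zero (suc b) = begin
    y * box q (suc l) (suc (b ℕ.+ m))
      ≈⟨ *-congˡ (box-pascal q l (b ℕ.+ m)) ⟩
    y * (box q (suc l) (b ℕ.+ m) + q ^ suc (b ℕ.+ m) * box q l (suc (b ℕ.+ m)))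
      ≈⟨ distribˡ _ _ _ ⟩
    y * box q (suc l) (b ℕ.+ m) + y * (q ^ suc (b ℕ.+ m) * box q l (suc (b ℕ.+ m)))
      ≈⟨ +-congˡ (trans (sym (*-assoc _ _ _)) (trans (*-congʳ
           (trans (reflexive (cong (λ k → y * q ^ k) (≡.sym (ℕ.+-suc b m)))) (^-vanish p b))) (zeroˡ _))) ⟩
    y * box q (suc l) (b ℕ.+ m) + 0#
      ≈⟨ +-identityʳ _ ⟩
    y * box q (suc l) (b ℕ.+ m)
      ≈⟨ box-stable m p zero b ⟩
    y * box q m m ∎

  -- An abstract m ↦ zᵐ, negative m included, so that one proof of the triple product serves z, -z
  -- and -z².
  record Character : Set (c ⊔ ℓ) where
    field
      χ   : ℤ → Carrier
      χ-0 : χ 0ℤ ≈ 1#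
      χ-+ : ∀ m n → χ (m ℤ.+ n) ≈ χ m * χ n

  module _ (X : Character) (x : Carrier) where
    open Character X

    term : ℤ → Carrier
    term m = χ m * x ^ sq m

    tripleProduct : ℕ → ℕ → Carrier
    tripleProduct a b = ∏ a (λ j → 1# + χ 1ℤ * x ^ suc (2 ℕ.* j)) * ∏ b (λ j → 1# + χ -1ℤ * x ^ suc (2 ℕ.* j))

    private
      q = x ^ 2

      -- Multiplication by a monomial of a factor moves the index from `m` to `n`; the surplus in
      -- the exponent of x is even and becomes the power of q that a Pascal rule asks for.
      term-*χ : ∀ {m n k} l p → sq m ℕ.+ k ≡ sq n ℕ.+ 2 ℕ.* l → m ℤ.+ p ≡ n → ∀ b →
                term m * b * (χ p * x ^ k) ≈ term n * (q ^ l * b)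
      term-*χ {m} {n} {k} l p eq ≡.refl b = begin
        (χ m * x ^ sq m) * b * (χ p * x ^ k)         ≈⟨ *-xy∙z≈xz∙y _ _ _ ⟩
        (χ m * x ^ sq m) * (χ p * x ^ k) * b         ≈⟨ *-congʳ (*-interchange _ _ _ _) ⟩
        (χ m * χ p) * (x ^ sq m * x ^ k) * b         ≈⟨ *-congʳ (*-cong (sym (χ-+ m p)) powers) ⟩
        χ n * (x ^ sq n * q ^ l) * b                 ≈⟨ *-congʳ (*-assoc _ _ _) ⟨
        (χ n * x ^ sq n) * q ^ l * b                 ≈⟨ *-assoc _ _ _ ⟩
        (χ n * x ^ sq n) * (q ^ l * b)               ∎
        where
        powers : x ^ sq m * x ^ k ≈ x ^ sq n * q ^ l
        powers = begin
          x ^ sq m * x ^ k             ≈⟨ ^-homo-* x (sq m) k ⟨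
          x ^ (sq m ℕ.+ k)             ≡⟨ cong (x ^_) eq ⟩
          x ^ (sq n ℕ.+ 2 ℕ.* l)       ≈⟨ ^-homo-* x (sq n) (2 ℕ.* l) ⟩
          x ^ sq n * x ^ (2 ℕ.* l)     ≈⟨ *-congˡ (^-assocʳ x 2 l) ⟨
          x ^ sq n * q ^ l             ∎

    private
      pos-odd : ∀ k → + suc (2 ℕ.* k) ≡ 1ℤ ℤ.+ + 2 ℤ.* + k
      pos-odd k = cong (λ m → 1ℤ ℤ.+ m) (ℤ.pos-* 2 k)

      row⁻ : ∀ i b → sq (+ i ℤ.- + b) ℕ.+ suc (2 ℕ.* b) ≡ sq (+ i ℤ.- + suc b) ℕ.+ 2 ℕ.* i
      row⁻ i b = ℤ.+-injective (≡.trans (≡.cong₂ ℤ._+_ (+sq (+ i ℤ.- + b)) (pos-odd b))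
        (≡.trans (eq (+ i) (+ b)) (≡.sym (≡.cong₂ ℤ._+_ (+sq (+ i ℤ.- + suc b)) (ℤ.pos-* 2 i)))))
        where
        eq : ∀ i b → (i ℤ.- b) ℤ.* (i ℤ.- b) ℤ.+ (1ℤ ℤ.+ + 2 ℤ.* b) ≡
                     (i ℤ.- (1ℤ ℤ.+ b)) ℤ.* (i ℤ.- (1ℤ ℤ.+ b)) ℤ.+ + 2 ℤ.* i
        eq = solve-∀

      row⁺ : ∀ i j a b → i ℕ.+ j ≡ a ℕ.+ b →
             sq (+ i ℤ.- + b) ℕ.+ suc (2 ℕ.* a) ≡ sq (+ suc i ℤ.- + b) ℕ.+ 2 ℕ.* j
      -- With 2b added on both sides, `a` enters only through a + b, which is i + j.
      row⁺ i j a b p = ℕ.+-cancelʳ-≡ (2 ℕ.* b) _ _ (≡.trans (ℕ.+-assoc (sq (+ i ℤ.- + b)) _ _) (≡.trans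
        (cong (sq (+ i ℤ.- + b) ℕ.+_) (≡.trans (dist a b) (cong (λ m → suc (2 ℕ.* m)) (≡.sym p))))
        (ℤ.+-injective (≡.trans (≡.cong₂ ℤ._+_ (+sq (+ i ℤ.- + b)) (pos-odd (i ℕ.+ j)))
          (≡.trans (eq (+ i) (+ j) (+ b))
            (≡.sym (≡.cong₂ ℤ._+_ (≡.cong₂ ℤ._+_ (+sq (+ suc i ℤ.- + b)) (ℤ.pos-* 2 j)) (ℤ.pos-* 2 b))))))))
        where
        dist : ∀ a b → suc (2 ℕ.* a) ℕ.+ 2 ℕ.* b ≡ suc (2 ℕ.* (a ℕ.+ b))
        dist = ℕRing.solve-∀
        eq : ∀ i j b → (i ℤ.- b) ℤ.* (i ℤ.- b) ℤ.+ (1ℤ ℤ.+ + 2 ℤ.* (i ℤ.+ j)) ≡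
                       ((1ℤ ℤ.+ i) ℤ.- b) ℤ.* ((1ℤ ℤ.+ i) ℤ.- b) ℤ.+ + 2 ℤ.* j ℤ.+ + 2 ℤ.* b
        eq = solve-∀

      i-b-1 : ∀ i b → + i ℤ.- + b ℤ.+ -1ℤ ≡ + i ℤ.- + suc b
      i-b-1 i b = eq (+ i) (+ b)
        where
        eq : ∀ i b → i ℤ.- b ℤ.+ -1ℤ ≡ i ℤ.- (1ℤ ℤ.+ b)
        eq = solve-∀

      i-b+1 : ∀ i b → + i ℤ.- + b ℤ.+ 1ℤ ≡ + suc i ℤ.- + b
      i-b+1 i b = eq (+ i) (+ b)
        where
        eq : ∀ i b → i ℤ.- b ℤ.+ 1ℤ ≡ (1ℤ ℤ.+ i) ℤ.- b
        eq = solve-∀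

      expansion : ℕ → ℕ → Carrier
      expansion n b = ∑▵ n (λ i j → term (+ i ℤ.- + b) * box q i j)

      *-[1+] : ∀ y z → y * (1# + z) ≈ y + y * z
      *-[1+] y z = trans (distribˡ _ _ _) (+-congʳ (*-identityʳ y))

      step⁻ : ∀ n b → expansion n b * (1# + χ -1ℤ * x ^ suc (2 ℕ.* b)) ≈ expansion (suc n) (suc b)
      step⁻ n b = begin
        expansion n b * (1# + χ -1ℤ * x ^ suc (2 ℕ.* b))                   ≈⟨ *-[1+] _ _ ⟩
        expansion n b + expansion n b * (χ -1ℤ * x ^ suc (2 ℕ.* b))        ≈⟨ +-congˡ (∑▵-*ʳ n _ _) ⟩
        expansion n b + ∑▵ n (λ i j → term (+ i ℤ.- + b) * box q i j * (χ -1ℤ * x ^ suc (2 ℕ.* b)))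
          ≈⟨ +-congˡ (∑▵-cong n (λ i j _ → term-*χ i -1ℤ (row⁻ i b) (i-b-1 i b) (box q i j))) ⟩
        expansion n b + ∑▵ n (λ i j → term (+ i ℤ.- + suc b) * (q ^ i * box q i j))
          ≈⟨ ∑▵-pascal {h = λ i j → term (+ i ℤ.- + suc b) * box q i j}
               (λ i → *-cong (reflexive (cong term (shift i))) (sym (box-0 q i)))
               (λ j → *-congˡ (sym (*-identityˡ _)))
               (λ i j → trans (*-congʳ (reflexive (cong term (shift i))))
                 (trans (distribˡ _ _ _) (+-congˡ (*-congʳ (reflexive (cong term (≡.sym (shift i))))))))
               n ⟩
        expansion (suc n) (suc b) ∎
        where
        shift : ∀ i → + suc i ℤ.- + suc b ≡ + i ℤ.- + b
        shift i = eq (+ i) (+ b)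
          where
          eq : ∀ i b → (1ℤ ℤ.+ i) ℤ.- (1ℤ ℤ.+ b) ≡ i ℤ.- b
          eq = solve-∀

      step⁺ : ∀ a b → expansion (a ℕ.+ b) b * (1# + χ 1ℤ * x ^ suc (2 ℕ.* a)) ≈ expansion (suc (a ℕ.+ b)) b
      step⁺ a b = begin
        expansion n b * (1# + χ 1ℤ * x ^ suc (2 ℕ.* a))                    ≈⟨ *-[1+] _ _ ⟩
        expansion n b + expansion n b * (χ 1ℤ * x ^ suc (2 ℕ.* a))         ≈⟨ +-congˡ (∑▵-*ʳ n _ _) ⟩
        expansion n b + ∑▵ n (λ i j → term (+ i ℤ.- + b) * box q i j * (χ 1ℤ * x ^ suc (2 ℕ.* a)))
          ≈⟨ +-congˡ (∑▵-cong n (λ i j p → term-*χ j 1ℤ (row⁺ i j a b p) (i-b+1 i b) (box q i j))) ⟩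
        expansion n b + ∑▵ n (λ i j → term (+ suc i ℤ.- + b) * (q ^ j * box q i j))
          ≈⟨ +-comm _ _ ⟩
        ∑▵ n (λ i j → term (+ suc i ℤ.- + b) * (q ^ j * box q i j)) + expansion n b
          ≈⟨ ∑▵-pascal {h = λ i j → term (+ i ℤ.- + b) * box q i j}
               (λ i → *-congˡ (sym (trans (*-identityˡ _) (box-0 q i))))
               (λ j → refl)
               (λ i j → trans (*-congˡ (trans (box-pascal q i j) (+-comm _ _))) (distribˡ _ _ _))
               n ⟩
        expansion (suc n) b ∎
        where n = a ℕ.+ b

    -- The finite form of the triple product, by induction on the number of factors: the q-binomial
    -- theorem recentred at `b`. `step⁻` appends a factor with z⁻¹, `step⁺` one with z.
    q-binomial : ∀ a b → tripleProduct a b ≈ expansion (a ℕ.+ b) b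
    q-binomial zero zero = begin
      1# * 1#                 ≈⟨ *-identityˡ 1# ⟩
      1#                      ≈⟨ χ-0 ⟨
      χ 0ℤ                    ≈⟨ *-identityʳ _ ⟨
      χ 0ℤ * 1#               ≈⟨ *-identityʳ _ ⟨
      χ 0ℤ * 1# * 1#          ∎
    q-binomial zero (suc b) =
      trans (sym (*-assoc _ _ _)) (trans (*-congʳ (q-binomial zero b)) (step⁻ b b))
    q-binomial (suc a) b =
      trans (*-xy∙z≈xz∙y _ _ _) (trans (*-congʳ (q-binomial a b)) (step⁺ a b))

    module _ (L : ℕ) (x-nilpotent : x ^ suc (2 ℕ.* L) ≈ 0#) where
      private
        vanish : ∀ {m} → suc (2 ℕ.* L) ≤ m → x ^ m ≈ 0#
        vanish {m} p = begin
          x ^ m                                                     ≡⟨ cong (x ^_) (≡.sym (ℕ.m∸n+n≡m p)) ⟩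
          x ^ (m ℕ.∸ suc (2 ℕ.* L) ℕ.+ suc (2 ℕ.* L))               ≈⟨ ^-homo-* x (m ℕ.∸ suc (2 ℕ.* L)) _ ⟩
          x ^ (m ℕ.∸ suc (2 ℕ.* L)) * x ^ suc (2 ℕ.* L)             ≈⟨ *-congˡ x-nilpotent ⟩
          x ^ (m ℕ.∸ suc (2 ℕ.* L)) * 0#                            ≈⟨ zeroʳ _ ⟩
          0#                                                        ∎

        2r≤r²+1 : ∀ r → 2 ℕ.* r ≤ r ℕ.* r ℕ.+ 1
        2r≤r²+1 zero    = ℕ.z≤n
        2r≤r²+1 (suc r) = ≡.subst₂ _≤_ (lhs r) (rhs r) (ℕ.m≤n+m (2 ℕ.+ 2 ℕ.* r) (r ℕ.* r))
          where
          lhs : ∀ r → 2 ℕ.+ 2 ℕ.* r ≡ 2 ℕ.* suc r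
          lhs = ℕRing.solve-∀
          rhs : ∀ r → r ℕ.* r ℕ.+ (2 ℕ.+ 2 ℕ.* r) ≡ suc r ℕ.* suc r ℕ.+ 1
          rhs = ℕRing.solve-∀

        -- From r² + 1 ≥ 2r follows r² + 2(m + 1) ≥ 2L + 1.
        power-vanish : ∀ m r → m ℕ.+ r ≡ L → x ^ (r ℕ.* r) * q ^ suc m ≈ 0#
        power-vanish m r ≡.refl = begin
          x ^ (r ℕ.* r) * q ^ suc m               ≈⟨ *-congˡ (^-assocʳ x 2 (suc m)) ⟩
          x ^ (r ℕ.* r) * x ^ (2 ℕ.* suc m)       ≈⟨ ^-homo-* x (r ℕ.* r) _ ⟨
          x ^ (r ℕ.* r ℕ.+ 2 ℕ.* suc m)           ≈⟨ vanish (≡.subst₂ _≤_ (lhs m r) (rhs m r) (ℕ.+-monoˡ-≤ (suc (2 ℕ.* m)) (2r≤r²+1 r))) ⟩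
          0#                                      ∎
          where
          lhs : ∀ m r → 2 ℕ.* r ℕ.+ suc (2 ℕ.* m) ≡ suc (2 ℕ.* (m ℕ.+ r))
          lhs = ℕRing.solve-∀
          rhs : ∀ m r → r ℕ.* r ℕ.+ 1 ℕ.+ suc (2 ℕ.* m) ≡ r ℕ.* r ℕ.+ 2 ℕ.* suc m
          rhs = ℕRing.solve-∀

        stable : ∀ m r a b → m ℕ.+ r ≡ L →
                 x ^ (r ℕ.* r) * box q (a ℕ.+ m) (b ℕ.+ m) ≈ x ^ (r ℕ.* r) * box q L L
        stable m r a b ≡.refl = trans (box-stable m (power-vanish m r ≡.refl) a b)
          (sym (≡.subst (λ k → x ^ (r ℕ.* r) * box q k k ≈ x ^ (r ℕ.* r) * box q m m) (ℕ.+-comm r m)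
                 (box-stable m (power-vanish m r ≡.refl) r r)))

        -- With r = |i - L|, the shorter side of the box is L - r, and the weight x^(r²) kills every
        -- power of q through which this box differs from the L × L box.
        central : ∀ i j → i ℕ.+ j ≡ L ℕ.+ L →
                  x ^ sq (+ i ℤ.- + L) * box q i j ≈ x ^ sq (+ i ℤ.- + L) * box q L L
        central i j p with ℕ.≤-total i L
        ... | inj₁ i≤L = ≡.subst₂ (λ k l → x ^ k * box q i l ≈ x ^ k * box q L L)
            (≡.sym sq-r) j≡ (stable i (L ℕ.∸ i) 0 ((L ℕ.∸ i) ℕ.+ (L ℕ.∸ i)) (ℕ.m+[n∸m]≡n i≤L))
          where
          r = L ℕ.∸ i
          sq-r : sq (+ i ℤ.- + L) ≡ r ℕ.* r
          sq-r = cong (λ k → k ℕ.* k) (≡.trans (cong ∣_∣ (ℤ.m-n≡m⊖n i L)) (ℤ.∣⊖∣-≤ i≤L))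
          j≡ : r ℕ.+ r ℕ.+ i ≡ j
          j≡ = ℕ.+-cancelˡ-≡ i _ _ (≡.trans (eq i r) (≡.trans (cong (λ k → k ℕ.+ k) (ℕ.m+[n∸m]≡n i≤L)) (≡.sym p)))
            where
            eq : ∀ i r → i ℕ.+ (r ℕ.+ r ℕ.+ i) ≡ (i ℕ.+ r) ℕ.+ (i ℕ.+ r)
            eq = ℕRing.solve-∀
        ... | inj₂ L≤i = ≡.subst₂ (λ k l → x ^ k * box q l j ≈ x ^ k * box q L L)
            (≡.sym sq-r) i≡ (stable j r (r ℕ.+ r) 0 j+r≡L)
          where
          r = i ℕ.∸ L
          sq-r : sq (+ i ℤ.- + L) ≡ r ℕ.* r
          sq-r = cong (λ k → k ℕ.* k) (cong ∣_∣ (≡.trans (ℤ.m-n≡m⊖n i L) (ℤ.⊖-≥ L≤i)))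
          j+r≡L : j ℕ.+ r ≡ L
          j+r≡L = ℕ.+-cancelˡ-≡ L _ _ (≡.trans (eq L j r) (≡.trans (cong (ℕ._+ j) (ℕ.m+[n∸m]≡n L≤i)) p))
            where
            eq : ∀ L j r → L ℕ.+ (j ℕ.+ r) ≡ (L ℕ.+ r) ℕ.+ j
            eq = ℕRing.solve-∀
          i≡ : r ℕ.+ r ℕ.+ j ≡ i
          i≡ = ≡.trans (eq r j) (≡.trans (cong (ℕ._+ r) j+r≡L) (ℕ.m+[n∸m]≡n L≤i))
            where
            eq : ∀ r j → r ℕ.+ r ℕ.+ j ≡ (j ℕ.+ r) ℕ.+ r
            eq = ℕRing.solve-∀

      term-supported : Supported L term
      term-supported m L<∣m∣ = trans (*-congˡ (vanish (2L<k² L<∣m∣))) (zeroʳ _)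
        where
        2L<k² : ∀ {k} → L < k → suc (2 ℕ.* L) ≤ k ℕ.* k
        2L<k² L<k = ℕ.≤-trans (ℕ.≤-trans (ℕ.m≤n+m (suc (2 ℕ.* L)) (L ℕ.* L)) (ℕ.≤-reflexive (eq L))) (ℕ.*-mono-≤ L<k L<k)
          where
          eq : ∀ L → L ℕ.* L ℕ.+ suc (2 ℕ.* L) ≡ suc L ℕ.* suc L
          eq = ℕRing.solve-∀

      -- After all boxes are replaced by the central one, it factors out of the finite identity. The
      -- parameter `k` fits the sum to the window shared by all theta series.
      jacobi : ∀ k → tripleProduct L L ≈ box q L L * ∑ᶻ (k ℕ.+ suc L) term
      jacobi k = begin
        tripleProduct L L
          ≈⟨ q-binomial L L ⟩
        ∑▵ (L ℕ.+ L) (λ i j → term (+ i ℤ.- + L) * box q i j)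
          ≈⟨ ∑▵-cong (L ℕ.+ L) (λ i j p → trans (*-assoc _ _ _) (trans (*-congˡ (central i j p)) (sym (*-assoc _ _ _)))) ⟩
        ∑▵ (L ℕ.+ L) (λ i j → term (+ i ℤ.- + L) * box q L L)
          ≈⟨ ∑▵-*ʳ (L ℕ.+ L) _ _ ⟨
        ∑▵ (L ℕ.+ L) (λ i j → term (+ i ℤ.- + L)) * box q L L
          ≈⟨ *-comm _ _ ⟩
        box q L L * ∑▵ (L ℕ.+ L) (λ i j → term (+ i ℤ.- + L))
          ≈⟨ *-congˡ (trans (sym (+-identityʳ _)) (+-congˡ (sym (term-supported -[1+ L ] ℕ.≤-refl)))) ⟩
        box q L L * (∑▵ (L ℕ.+ L) (λ i j → term (+ i ℤ.- + L)) + term -[1+ L ])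
          ≈⟨ *-congˡ (∑▵-centred L term) ⟩
        box q L L * ∑ᶻ (suc L) term
          ≈⟨ *-congˡ (∑ᶻ-extend term-supported (suc L) k ℕ.≤-refl) ⟨
        box q L L * ∑ᶻ (k ℕ.+ suc L) term ∎

-- Products of theta functions

parallelogram : ∀ p r → 2 ℕ.* sq p ℕ.+ 2 ℕ.* sq r ≡ sq (p ℤ.+ r) ℕ.+ sq (p ℤ.- r)
parallelogram p r = ℤ.+-injective (≡.trans
  (cong₂ ℤ._+_ (≡.trans (ℤ.pos-* 2 (sq p)) (cong (λ k → + 2 ℤ.* k) (+sq p)))
               (≡.trans (ℤ.pos-* 2 (sq r)) (cong (λ k → + 2 ℤ.* k) (+sq r))))
  (≡.trans (eq p r) (≡.sym (cong₂ ℤ._+_ (+sq (p ℤ.+ r)) (+sq (p ℤ.- r))))))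
  where
  eq : ∀ p r → + 2 ℤ.* (p ℤ.* p) ℤ.+ + 2 ℤ.* (r ℤ.* r) ≡ (p ℤ.+ r) ℤ.* (p ℤ.+ r) ℤ.+ (p ℤ.- r) ℤ.* (p ℤ.- r)
  eq = solve-∀

sq-neg : ∀ p → sq (ℤ.- p) ≡ sq p
sq-neg p = cong (λ k → k ℕ.* k) (ℤ.∣-i∣≡∣i∣ p)

-- Hence the truncation degree bounds the support of all the theta series, whatever `d` and `r`, and
-- one window suffices for them.
∣m∣≤∣dm+r∣ : ∀ d r → ∣ r ∣ < d → ∀ m → ∣ m ∣ ≤ ∣ + d ℤ.* m ℤ.+ r ∣
∣m∣≤∣dm+r∣ (suc d) r (ℕ.s≤s ∣r∣≤d) m = bound ∣ m ∣ ≡.refl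
  where
  open ℕ.≤-Reasoning
  cancel : ∀ a b → a ≡ (a ℤ.+ b) ℤ.- b
  cancel = solve-∀
  bound : ∀ k → ∣ m ∣ ≡ k → k ≤ ∣ + suc d ℤ.* m ℤ.+ r ∣
  bound zero    _  = ℕ.z≤n
  bound (suc k) eq = ℕ.+-cancelʳ-≤ ∣ r ∣ (suc k) _ (begin
    suc k ℕ.+ ∣ r ∣                                   ≤⟨ ℕ.+-monoʳ-≤ (suc k) (ℕ.≤-trans ∣r∣≤d (ℕ.m≤m*n d (suc k))) ⟩
    suc d ℕ.* suc k                                   ≡⟨ cong (suc d ℕ.*_) eq ⟨
    suc d ℕ.* ∣ m ∣                                   ≡⟨ ℤ.∣i*j∣≡∣i∣*∣j∣ (+ suc d) m ⟨
    ∣ + suc d ℤ.* m ∣                                 ≡⟨ cong ∣_∣ (cancel (+ suc d ℤ.* m) r) ⟩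
    ∣ (+ suc d ℤ.* m ℤ.+ r) ℤ.- r ∣                   ≤⟨ ℤ.∣i-j∣≤∣i∣+∣j∣ (+ suc d ℤ.* m ℤ.+ r) r ⟩
    ∣ + suc d ℤ.* m ℤ.+ r ∣ ℕ.+ ∣ r ∣                 ∎)

module ThetaFunctions (M : ℕ) .{{_ : NonZero M}} (N : ℕ) where
  open Truncated M N
  open Relation.Binary.Reasoning.Setoid setoid
  open Algebra.Properties.CommutativeSemigroup *-commutativeSemigroup using ()
    renaming (interchange to *-interchange)
  open Algebra.Properties.CommutativeSemiring.Exp series
  open BilateralSum series
  open JacobiTripleProduct series

  -- The least window that `∑ᶻ-product` admits for summands vanishing beyond N.
  B : ℕ
  B = suc (N ℕ.+ suc (suc (N ℕ.+ N)))

  mono-≡ : ∀ {m n i j} → m ≡ n → i ≡ j → mono m i ≈ mono n j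
  mono-≡ ≡.refl ≡.refl = refl

  θ : ℤ → ℕ → ℤ → Series
  θ c e p = mono (e ℕ.* sq p) (c ℤ.* p)

  -- By the parallelogram law for the exponents of X. The exponent of z depends on p + r alone, so
  -- the factor in p - r is free of z.
  θ-* : ∀ c e p r → θ c (2 ℕ.* e) p * θ c (2 ℕ.* e) r ≈ θ c e (p ℤ.+ r) * θ 0ℤ e (p ℤ.- r)
  θ-* c e p r = trans (mono-* _ _ _ _) (trans (mono-≡
    (≡.trans (dist e (sq p) (sq r)) (≡.trans (cong (e ℕ.*_) (parallelogram p r)) (ℕ.*-distribˡ-+ e _ _)))
    (eq c p r)) (sym (mono-* _ _ _ _)))
    where
    dist : ∀ e a b → 2 ℕ.* e ℕ.* a ℕ.+ 2 ℕ.* e ℕ.* b ≡ e ℕ.* (2 ℕ.* a ℕ.+ 2 ℕ.* b)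
    dist = ℕRing.solve-∀
    eq : ∀ c p r → c ℤ.* p ℤ.+ c ℤ.* r ≡ c ℤ.* (p ℤ.+ r) ℤ.+ 0ℤ ℤ.* (p ℤ.- r)
    eq = solve-∀

  Θ : ℤ → ℕ → ℕ → ℕ → Series
  Θ c d e r = ∑ᶻ B (λ m → θ c e (+ d ℤ.* m ℤ.+ + r))

  θ-supported : ∀ c {d e r} → r < d → 1 ≤ e → Supported N (λ m → θ c e (+ d ℤ.* m ℤ.+ + r))
  θ-supported c {d} {suc e} {r} r<d _ m N<∣m∣ = mono-large (ℕ.<-≤-trans N<∣m∣ (≤-square _ (∣m∣≤∣dm+r∣ d (+ r) r<d m)))
    where
    ≤-square : ∀ k → ∣ m ∣ ≤ k → ∣ m ∣ ≤ suc e ℕ.* (k ℕ.* k)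
    ≤-square zero    p = ℕ.≤-trans p ℕ.z≤n
    ≤-square (suc k) p = ℕ.≤-trans p (ℕ.≤-trans (ℕ.m≤m*n (suc k) (suc k)) (ℕ.m≤n*m (suc k ℕ.* suc k) (suc e)))

  -- In the coordinates of `∑ᶻ-product` the sums of the two indices are 2ds + 2r or 2ds + d + 2r and
  -- the differences 2dt or 2dt + d; `r` cancels in the latter.
  Θ² : ∀ c {d e r} → r < d → 1 ≤ e →
       Θ c d (2 ℕ.* e) r * Θ c d (2 ℕ.* e) r ≈
       Θ c (2 ℕ.* d) e (2 ℕ.* r) * Θ 0ℤ (2 ℕ.* d) e 0 + Θ c (2 ℕ.* d) e (d ℕ.+ 2 ℕ.* r) * Θ 0ℤ (2 ℕ.* d) e d
  Θ² c {d} {e} {r} r<d 1≤e = ∑ᶻ-product supp supp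
    (λ s t → trans (θ-* c e _ _) (*-cong (reflexive (cong (θ c e) (sum₀ s t))) (reflexive (cong (θ 0ℤ e) (difference₀ s t)))))
    (λ s t → trans (θ-* c e _ _) (*-cong (reflexive (cong (θ c e) (sum₁ s t))) (reflexive (cong (θ 0ℤ e) (difference₁ s t)))))
    ℕ.≤-refl
    where
    supp = θ-supported c {d} {2 ℕ.* e} {r} r<d (ℕ.≤-trans 1≤e (ℕ.m≤n*m e 2))

    pos : + (2 ℕ.* d) ≡ + 2 ℤ.* + d
    pos = ℤ.pos-* 2 d
    pos′ : + (2 ℕ.* r) ≡ + 2 ℤ.* + r
    pos′ = ℤ.pos-* 2 r

    sum₀ : ∀ s t → (+ d ℤ.* (s ℤ.+ t) ℤ.+ + r) ℤ.+ (+ d ℤ.* (s ℤ.+ ℤ.- t) ℤ.+ + r) ≡ + (2 ℕ.* d) ℤ.* s ℤ.+ + (2 ℕ.* r)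
    sum₀ s t = ≡.trans (eq (+ d) (+ r) s t) (≡.sym (cong₂ (λ a b → a ℤ.* s ℤ.+ b) pos pos′))
      where
      eq : ∀ d r s t → (d ℤ.* (s ℤ.+ t) ℤ.+ r) ℤ.+ (d ℤ.* (s ℤ.+ ℤ.- t) ℤ.+ r) ≡ + 2 ℤ.* d ℤ.* s ℤ.+ + 2 ℤ.* r
      eq = solve-∀
    difference₀ : ∀ s t → (+ d ℤ.* (s ℤ.+ t) ℤ.+ + r) ℤ.- (+ d ℤ.* (s ℤ.+ ℤ.- t) ℤ.+ + r) ≡ + (2 ℕ.* d) ℤ.* t ℤ.+ + 0
    difference₀ s t = ≡.trans (eq (+ d) (+ r) s t) (≡.sym (cong (λ a → a ℤ.* t ℤ.+ 0ℤ) pos))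
      where
      eq : ∀ d r s t → (d ℤ.* (s ℤ.+ t) ℤ.+ r) ℤ.- (d ℤ.* (s ℤ.+ ℤ.- t) ℤ.+ r) ≡ + 2 ℤ.* d ℤ.* t ℤ.+ 0ℤ
      eq = solve-∀
    sum₁ : ∀ s t → (+ d ℤ.* (s ℤ.+ t ℤ.+ 1ℤ) ℤ.+ + r) ℤ.+ (+ d ℤ.* (s ℤ.+ ℤ.- t) ℤ.+ + r) ≡ + (2 ℕ.* d) ℤ.* s ℤ.+ + (d ℕ.+ 2 ℕ.* r)
    sum₁ s t = ≡.trans (eq (+ d) (+ r) s t) (≡.sym (cong₂ (λ a b → a ℤ.* s ℤ.+ (+ d ℤ.+ b)) pos pos′))
      where
      eq : ∀ d r s t → (d ℤ.* (s ℤ.+ t ℤ.+ 1ℤ) ℤ.+ r) ℤ.+ (d ℤ.* (s ℤ.+ ℤ.- t) ℤ.+ r) ≡ + 2 ℤ.* d ℤ.* s ℤ.+ (d ℤ.+ + 2 ℤ.* r)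
      eq = solve-∀
    difference₁ : ∀ s t → (+ d ℤ.* (s ℤ.+ t ℤ.+ 1ℤ) ℤ.+ + r) ℤ.- (+ d ℤ.* (s ℤ.+ ℤ.- t) ℤ.+ + r) ≡ + (2 ℕ.* d) ℤ.* t ℤ.+ + d
    difference₁ s t = ≡.trans (eq (+ d) (+ r) s t) (≡.sym (cong (λ a → a ℤ.* t ℤ.+ + d) pos))
      where
      eq : ∀ d r s t → (d ℤ.* (s ℤ.+ t ℤ.+ 1ℤ) ℤ.+ r) ℤ.- (d ℤ.* (s ℤ.+ ℤ.- t) ℤ.+ r) ≡ + 2 ℤ.* d ℤ.* t ℤ.+ d
      eq = solve-∀

  Θ-cycle : ∀ c {d e} → 1 ≤ N → 1 ≤ d → 1 ≤ e → Θ c d e d ≈ Θ c d e 0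
  Θ-cycle c {d} {e} 1≤N 1≤d 1≤e = trans (∑ᶻ-cong B (λ m → reflexive (cong (θ c e) (eq (+ d) m))))
    (∑ᶻ-shift (θ-supported c {d} {e} {0} 1≤d 1≤e) 1ℤ (ℕ.s≤s (ℕ.+-monoʳ-≤ N (ℕ.s≤s ℕ.z≤n))))
    where
    eq : ∀ d m → d ℤ.* m ℤ.+ d ≡ d ℤ.* (m ℤ.+ 1ℤ) ℤ.+ 0ℤ
    eq = solve-∀

  -- As in θ, c = 1 gives a function of z and c = 0 its value at z = 1.
  𝔸 𝔹 : ℤ → ℕ → ℕ → Series
  𝔸 c f e = Θ c (2 ℕ.* f) e 0
  𝔹 c f e = Θ c (2 ℕ.* f) e f

  Θ²-𝔸𝔹 : ∀ c {f e} → 1 ≤ f → 1 ≤ e → Θ c f (2 ℕ.* e) 0 * Θ c f (2 ℕ.* e) 0 ≈ 𝔸 0ℤ f e * 𝔸 c f e + 𝔹 0ℤ f e * 𝔹 c f e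
  Θ²-𝔸𝔹 c {f} {e} 1≤f 1≤e = trans (Θ² c 1≤f 1≤e)
    (+-cong (*-comm _ _) (trans (*-congʳ (reflexive (cong (Θ c (2 ℕ.* f) e) (ℕ.+-identityʳ f)))) (*-comm _ _)))

  -- Squaring the residue f modulo 2f yields the residues 2f and 4f modulo 4f. The latter is 0 by
  -- `Θ-cycle`, so compared with `Θ²-𝔸𝔹` the roles of `𝔸` and `𝔹` are exchanged.
  𝔹²-𝔸𝔹 : ∀ c {f e} → 1 ≤ N → 1 ≤ f → 1 ≤ e →
          𝔹 c f (2 ℕ.* e) * 𝔹 c f (2 ℕ.* e) ≈ 𝔸 0ℤ (2 ℕ.* f) e * 𝔹 c (2 ℕ.* f) e + 𝔹 0ℤ (2 ℕ.* f) e * 𝔸 c (2 ℕ.* f) e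
  𝔹²-𝔸𝔹 c {f} {e} 1≤N 1≤f 1≤e = trans (Θ² c f<2f 1≤e)
    (+-cong (*-comm _ _) (trans (*-congʳ (trans (reflexive (cong (Θ c (2 ℕ.* (2 ℕ.* f)) e) (4f f)))
      (Θ-cycle c 1≤N (ℕ.≤-trans 1≤f (ℕ.≤-trans (ℕ.m≤n*m f 2) (ℕ.m≤n*m (2 ℕ.* f) 2))) 1≤e))) (*-comm _ _)))
    where
    f<2f : f < 2 ℕ.* f
    f<2f = ℕ.m<m+n f (≡.subst (0 <_) (≡.sym (ℕ.+-identityʳ f)) 1≤f)
    4f : ∀ f → 2 ℕ.* f ℕ.+ 2 ℕ.* f ≡ 2 ℕ.* (2 ℕ.* f)
    4f = ℕRing.solve-∀

  -- Splitting by the parity of the index; this is the dissection φ(q) = φ(q⁴) + 2qψ(q⁸).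
  Θ-split : ∀ {d e} → 1 ≤ d → 1 ≤ e → Θ 0ℤ d (4 ℕ.* e) 0 ≈ Θ 0ℤ (4 ℕ.* d) e 0 + Θ 0ℤ (4 ℕ.* d) e (2 ℕ.* d)
  Θ-split {d} {e} 1≤d 1≤e = begin
    ∑ᶻ B g                  ≈⟨ ∑ᶻ-extend (θ-supported 0ℤ {d} {4 ℕ.* e} {0} 1≤d (ℕ.≤-trans 1≤e (ℕ.m≤n*m e 4))) B B (ℕ.s≤s (ℕ.m≤m+n N _)) ⟨
    ∑ᶻ (B ℕ.+ B) g          ≈⟨ ∑ᶻ-parity B g ⟩
    _                       ≈⟨ +-cong (∑ᶻ-cong B (λ s → mono-≡ (deg (even s)) ≡.refl)) (∑ᶻ-cong B (λ s → mono-≡ (deg (odd s)) ≡.refl)) ⟩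
    _                       ∎
    where
    g : ℤ → Series
    g m = θ 0ℤ (4 ℕ.* e) (+ d ℤ.* m ℤ.+ 0ℤ)
    deg : ∀ {p r} → r ≡ + 2 ℤ.* p → 4 ℕ.* e ℕ.* sq p ≡ e ℕ.* sq r
    deg {p} ≡.refl = ≡.trans (eq e ∣ p ∣) (cong (λ k → e ℕ.* (k ℕ.* k)) (≡.sym (ℤ.∣i*j∣≡∣i∣*∣j∣ (+ 2) p)))
      where
      eq : ∀ e k → 4 ℕ.* e ℕ.* (k ℕ.* k) ≡ e ℕ.* ((2 ℕ.* k) ℕ.* (2 ℕ.* k))
      eq = ℕRing.solve-∀
    even : ∀ s → + (4 ℕ.* d) ℤ.* s ℤ.+ 0ℤ ≡ + 2 ℤ.* (+ d ℤ.* (s ℤ.+ s) ℤ.+ 0ℤ)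
    even s = ≡.trans (cong (λ a → a ℤ.* s ℤ.+ 0ℤ) (ℤ.pos-* 4 d)) (eq (+ d) s)
      where
      eq : ∀ d s → + 4 ℤ.* d ℤ.* s ℤ.+ 0ℤ ≡ + 2 ℤ.* (d ℤ.* (s ℤ.+ s) ℤ.+ 0ℤ)
      eq = solve-∀
    odd : ∀ s → + (4 ℕ.* d) ℤ.* s ℤ.+ + (2 ℕ.* d) ≡ + 2 ℤ.* (+ d ℤ.* (s ℤ.+ s ℤ.+ 1ℤ) ℤ.+ 0ℤ)
    odd s = ≡.trans (cong₂ (λ a b → a ℤ.* s ℤ.+ b) (ℤ.pos-* 4 d) (ℤ.pos-* 2 d)) (eq (+ d) s)
      where
      eq : ∀ d s → + 4 ℤ.* d ℤ.* s ℤ.+ + 2 ℤ.* d ≡ + 2 ℤ.* (d ℤ.* (s ℤ.+ s ℤ.+ 1ℤ) ℤ.+ 0ℤ)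
      eq = solve-∀

  half𝔹 : ℕ → ℕ → Series
  half𝔹 f e = ∑ B (λ i → θ 0ℤ e (+ (2 ℕ.* f) ℤ.* + i ℤ.+ + f))

  opaque
    unfolding ∑ᶻ
    -- The reflection m ↦ -1 - m negates 2fm + f and exchanges the two halves of the window.
    𝔹-double : ∀ f e → 𝔹 0ℤ f e ≈ half𝔹 f e + half𝔹 f e
    𝔹-double f e = trans (∑-cong B (λ i → +-congˡ (mono-≡ (cong (e ℕ.*_)
        (≡.trans (cong sq (eq′ i)) (sq-neg (+ (2 ℕ.* f) ℤ.* + i ℤ.+ + f)))) ≡.refl))) (∑-+ B _ _)
      where
      eq : ∀ d f i → (d ≡ f ℤ.+ f) → d ℤ.* (ℤ.- (1ℤ ℤ.+ i)) ℤ.+ f ≡ ℤ.- (d ℤ.* i ℤ.+ f)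
      eq _ f i ≡.refl = eq₁ f i
        where
        eq₁ : ∀ f i → (f ℤ.+ f) ℤ.* (ℤ.- (1ℤ ℤ.+ i)) ℤ.+ f ≡ ℤ.- ((f ℤ.+ f) ℤ.* i ℤ.+ f)
        eq₁ = solve-∀
      eq′ : ∀ i → + (2 ℕ.* f) ℤ.* -[1+ i ] ℤ.+ + f ≡ ℤ.- (+ (2 ℕ.* f) ℤ.* + i ℤ.+ + f)
      eq′ i = eq (+ (2 ℕ.* f)) (+ f) (+ i) (cong (λ k → + (f ℕ.+ k)) (ℕ.+-identityʳ f))

    -- The summand `g (+ K)` makes the half-open window symmetric, so that m and -m can be paired.
    ∑ᶻ-even : ∀ {g} → (∀ m → g (ℤ.- m) ≈ g m) → ∀ K →
              ∑ᶻ K g + g (+ K) ≈ g 0ℤ + (∑ K (λ i → g (+ suc i)) + ∑ K (λ i → g (+ suc i)))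
    ∑ᶻ-even {g} sym-g zero    = trans (+-identityˡ _) (sym (trans (+-congˡ (+-identityˡ _)) (+-identityʳ _)))
    ∑ᶻ-even {g} sym-g (suc K) = begin
      ∑ᶻ K g + (g (+ K) + g -[1+ K ]) + g (+ suc K)      ≈⟨ +-congʳ (+-assoc _ _ _) ⟨
      ∑ᶻ K g + g (+ K) + g -[1+ K ] + g (+ suc K)        ≈⟨ +-congʳ (+-cong (∑ᶻ-even sym-g K) (sym-g (+ suc K))) ⟩
      g 0ℤ + (x + x) + g (+ suc K) + g (+ suc K)         ≈⟨ +-assoc _ _ _ ⟩
      g 0ℤ + (x + x) + (g (+ suc K) + g (+ suc K))       ≈⟨ +-assoc _ _ _ ⟩
      g 0ℤ + ((x + x) + (g (+ suc K) + g (+ suc K)))     ≈⟨ +-congˡ (+-interchange _ _ _ _) ⟩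
      g 0ℤ + ((x + g (+ suc K)) + (x + g (+ suc K)))     ∎
      where
      open Algebra.Properties.CommutativeSemigroup +-commutativeSemigroup using ()
        renaming (interchange to +-interchange)
      x : Series
      x = ∑ K (λ i → g (+ suc i))

  -- Through this, theta series at z = 1 and z = -1 are seen to be 1 modulo 2 and drop out next to
  -- the coefficient 1024.
  ∑ᶻ-even-mod2 : ∀ {g} → Supported N g → (∀ m → g (ℤ.- m) ≈ g m) → g 0ℤ ≈ 1# → ∃ λ x → ∑ᶻ B g ≈ 1# + (x + x)
  ∑ᶻ-even-mod2 {g} supp sym-g g0 = _ , trans (sym (trans (+-congˡ (supp (+ B) (ℕ.s≤s (ℕ.m≤m+n N _)))) (+-identityʳ _)))
    (trans (∑ᶻ-even sym-g B) (+-congʳ g0))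

  θ-even : ∀ e d m → θ 0ℤ e (d ℤ.* (ℤ.- m) ℤ.+ 0ℤ) ≈ θ 0ℤ e (d ℤ.* m ℤ.+ 0ℤ)
  θ-even e d m = mono-≡ (cong (e ℕ.*_) (≡.trans (cong sq (eq d m)) (sq-neg (d ℤ.* m ℤ.+ 0ℤ)))) ≡.refl
    where
    eq : ∀ d m → d ℤ.* (ℤ.- m) ℤ.+ 0ℤ ≡ ℤ.- (d ℤ.* m ℤ.+ 0ℤ)
    eq = solve-∀

  θ-0 : ∀ c e d → θ c e (d ℤ.* 0ℤ ℤ.+ 0ℤ) ≈ 1#
  θ-0 c e d rewrite ℤ.*-zeroʳ d | ℕ.*-zeroʳ e | ℤ.*-zeroʳ c = mono-1

  𝔸-mod2 : ∀ {f e} → 1 ≤ f → 1 ≤ e → ∃ λ x → 𝔸 0ℤ f e ≈ 1# + (x + x)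
  𝔸-mod2 {f} {e} 1≤f 1≤e = ∑ᶻ-even-mod2 (θ-supported 0ℤ {2 ℕ.* f} {e} {0} (ℕ.≤-trans 1≤f (ℕ.m≤n*m f 2)) 1≤e)
    (θ-even e (+ (2 ℕ.* f))) (θ-0 0ℤ e (+ (2 ℕ.* f)))

  -- Theta functions with alternating signs

  -1# : Series
  -1# = ℕ.pred M ✕ 1#

  1+-1≈0 : 1# + -1# ≈ 0#
  1+-1≈0 = trans (reflexive (cong (_✕ 1#) (ℕ.suc-pred M))) (M✕≈0 1#)

  x-x≈0 : ∀ x → x + -1# * x ≈ 0#
  x-x≈0 x = begin
    x + -1# * x            ≈⟨ +-congʳ (*-identityˡ x) ⟨
    1# * x + -1# * x       ≈⟨ distribʳ x _ _ ⟨
    (1# + -1#) * x         ≈⟨ *-congʳ 1+-1≈0 ⟩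
    0# * x                 ≈⟨ zeroˡ x ⟩
    0#                     ∎

  -1*-1≈1 : -1# * -1# ≈ 1#
  -1*-1≈1 = begin
    -1# * -1#                    ≈⟨ +-identityˡ _ ⟨
    0# + -1# * -1#               ≈⟨ +-congʳ 1+-1≈0 ⟨
    1# + -1# + -1# * -1#         ≈⟨ +-assoc _ _ _ ⟩
    1# + (-1# + -1# * -1#)       ≈⟨ +-congˡ (x-x≈0 -1#) ⟩
    1# + 0#                      ≈⟨ +-identityʳ 1# ⟩
    1#                           ∎

  sgn : ℤ → Series
  sgn m = -1# ^ ∣ m ∣

  sgn-⊖ : ∀ m n → sgn (m ℤ.⊖ n) ≈ -1# ^ m * -1# ^ n
  sgn-⊖ zero    zero    = sym (*-identityˡ 1#)
  sgn-⊖ zero    (suc n) = sym (*-identityˡ _)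
  sgn-⊖ (suc m) zero    = sym (*-identityʳ _)
  sgn-⊖ (suc m) (suc n) = begin
    sgn (suc m ℤ.⊖ suc n)                        ≡⟨ cong sgn (ℤ.[1+m]⊖[1+n]≡m⊖n m n) ⟩
    sgn (m ℤ.⊖ n)                                ≈⟨ sgn-⊖ m n ⟩
    -1# ^ m * -1# ^ n                            ≈⟨ *-identityˡ _ ⟨
    1# * (-1# ^ m * -1# ^ n)                     ≈⟨ *-congʳ -1*-1≈1 ⟨
    (-1# * -1#) * (-1# ^ m * -1# ^ n)            ≈⟨ *-interchange _ _ _ _ ⟩
    (-1# * -1# ^ m) * (-1# * -1# ^ n)            ∎

  sgn-+ : ∀ m n → sgn (m ℤ.+ n) ≈ sgn m * sgn n
  sgn-+ (+ m)    (+ n)    = ^-homo-* -1# m n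
  sgn-+ (+ m)    -[1+ n ] = sgn-⊖ m (suc n)
  sgn-+ -[1+ m ] (+ n)    = trans (sgn-⊖ n (suc m)) (*-comm _ _)
  sgn-+ -[1+ m ] -[1+ n ] = trans (reflexive (cong (-1# ^_) (cong suc (≡.sym (ℕ.+-suc m n))))) (^-homo-* -1# (suc m) (suc n))

  sgn-neg : ∀ m → sgn (ℤ.- m) ≈ sgn m
  sgn-neg m = reflexive (cong (-1# ^_) (ℤ.∣-i∣≡∣i∣ m))

  Θ⁻ : ℤ → ℕ → ℕ → Series
  Θ⁻ c d e = ∑ᶻ B (λ m → sgn m * θ c e (+ d ℤ.* m ℤ.+ 0ℤ))

  Θ⁻-supported : ∀ c {d e} → 1 ≤ d → 1 ≤ e → Supported N (λ m → sgn m * θ c e (+ d ℤ.* m ℤ.+ 0ℤ))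
  Θ⁻-supported c {d} {e} 1≤d 1≤e m p = trans (*-congˡ (θ-supported c {d} {e} {0} 1≤d 1≤e m p)) (zeroʳ _)

  opaque
    unfolding ∑ᶻ
    -- The reflection m ↦ -1 - m keeps the square of 2dm + d and reverses the sign.
    ∑ᶻ-alternating : ∀ d e → ∑ᶻ B (λ m → sgn m * θ 0ℤ e (+ (2 ℕ.* d) ℤ.* m ℤ.+ + d)) ≈ 0#
    ∑ᶻ-alternating d e = ∑-0 B λ i → trans
      (+-congˡ (trans (*-assoc _ _ _) (*-congˡ (*-congˡ (mono-≡ (cong (e ℕ.*_) (≡.trans (cong sq (eq i)) (sq-neg (+ (2 ℕ.* d) ℤ.* + i ℤ.+ + d)))) ≡.refl)))))
      (x-x≈0 _)
      where
      eq : ∀ i → + (2 ℕ.* d) ℤ.* -[1+ i ] ℤ.+ + d ≡ ℤ.- (+ (2 ℕ.* d) ℤ.* + i ℤ.+ + d)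
      eq i = ≡.trans (cong (λ a → a ℤ.* -[1+ i ] ℤ.+ + d) (ℤ.pos-* 2 d))
        (≡.trans (eq₁ (+ d) (+ i)) (≡.sym (cong (λ a → ℤ.- (a ℤ.* + i ℤ.+ + d)) (ℤ.pos-* 2 d))))
        where
        eq₁ : ∀ d i → + 2 ℤ.* d ℤ.* (ℤ.- (1ℤ ℤ.+ i)) ℤ.+ d ≡ ℤ.- (+ 2 ℤ.* d ℤ.* i ℤ.+ d)
        eq₁ = solve-∀

  -- The sign of s - t is the product of those of s and t, and on the odd coset the factor in t is
  -- the vanishing alternating sum. For c = 0 this becomes φ(q) φ(-q) = φ(-q²)²; for c = 1 it is the
  -- theta side of F(z) F(-z).
  Θ-Θ⁻ : ∀ c {d e} → 1 ≤ d → 1 ≤ e → Θ c d (2 ℕ.* e) 0 * Θ⁻ c d (2 ℕ.* e) ≈ Θ⁻ c (2 ℕ.* d) e * Θ⁻ 0ℤ (2 ℕ.* d) e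
  Θ-Θ⁻ c {d} {e} 1≤d 1≤e = begin
    Θ c d (2 ℕ.* e) 0 * Θ⁻ c d (2 ℕ.* e)
      ≈⟨ ∑ᶻ-product (θ-supported c {d} {2 ℕ.* e} {0} 1≤d 1≤2e) (Θ⁻-supported c {d} {2 ℕ.* e} 1≤d 1≤2e)
           (λ s t → signed s t (sum₀ (+ d) s t) (difference₀ (+ d) s t))
           (λ s t → signed s t (sum₁ (+ d) s t) (difference₁ (+ d) s t)) ℕ.≤-refl ⟩
    ∑ᶻ B (λ s → sgn s * θ c e (+ 2 ℤ.* + d ℤ.* s ℤ.+ 0ℤ)) * ∑ᶻ B (λ t → sgn t * θ 0ℤ e (+ 2 ℤ.* + d ℤ.* t ℤ.+ 0ℤ))
      + ∑ᶻ B (λ s → sgn s * θ c e (+ 2 ℤ.* + d ℤ.* s ℤ.+ + d)) * ∑ᶻ B (λ t → sgn t * θ 0ℤ e (+ 2 ℤ.* + d ℤ.* t ℤ.+ + d))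
      ≡⟨ cong (λ a → ∑ᶻ B (λ s → sgn s * θ c e (a ℤ.* s ℤ.+ 0ℤ)) * ∑ᶻ B (λ t → sgn t * θ 0ℤ e (a ℤ.* t ℤ.+ 0ℤ))
                   + ∑ᶻ B (λ s → sgn s * θ c e (a ℤ.* s ℤ.+ + d)) * ∑ᶻ B (λ t → sgn t * θ 0ℤ e (a ℤ.* t ℤ.+ + d))) (≡.sym (ℤ.pos-* 2 d)) ⟩
    Θ⁻ c (2 ℕ.* d) e * Θ⁻ 0ℤ (2 ℕ.* d) e + _ * ∑ᶻ B (λ t → sgn t * θ 0ℤ e (+ (2 ℕ.* d) ℤ.* t ℤ.+ + d))
      ≈⟨ +-congˡ (trans (*-congˡ (∑ᶻ-alternating d e)) (zeroʳ _)) ⟩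
    Θ⁻ c (2 ℕ.* d) e * Θ⁻ 0ℤ (2 ℕ.* d) e + 0#
      ≈⟨ +-identityʳ _ ⟩
    Θ⁻ c (2 ℕ.* d) e * Θ⁻ 0ℤ (2 ℕ.* d) e ∎
    where
    1≤2e : 1 ≤ 2 ℕ.* e
    1≤2e = ℕ.≤-trans 1≤e (ℕ.m≤n*m e 2)

    signed : ∀ s t {p r p+r p-r} → p ℤ.+ r ≡ p+r → p ℤ.- r ≡ p-r →
             θ c (2 ℕ.* e) p * (sgn (s ℤ.+ ℤ.- t) * θ c (2 ℕ.* e) r) ≈ (sgn s * θ c e p+r) * (sgn t * θ 0ℤ e p-r)
    signed s t {p} {r} ≡.refl ≡.refl = begin
      θ c (2 ℕ.* e) p * (sgn (s ℤ.+ ℤ.- t) * θ c (2 ℕ.* e) r)     ≈⟨ x∙yz≈y∙xz _ _ _ ⟩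
      sgn (s ℤ.+ ℤ.- t) * (θ c (2 ℕ.* e) p * θ c (2 ℕ.* e) r)     ≈⟨ *-cong (trans (sgn-+ s (ℤ.- t)) (*-congˡ (sgn-neg t))) (θ-* c e p r) ⟩
      (sgn s * sgn t) * (θ c e (p ℤ.+ r) * θ 0ℤ e (p ℤ.- r))      ≈⟨ *-interchange _ _ _ _ ⟩
      (sgn s * θ c e (p ℤ.+ r)) * (sgn t * θ 0ℤ e (p ℤ.- r))      ∎
      where open Algebra.Properties.CommutativeSemigroup *-commutativeSemigroup using (x∙yz≈y∙xz)

    sum₀ : ∀ d s t → (d ℤ.* (s ℤ.+ t) ℤ.+ 0ℤ) ℤ.+ (d ℤ.* (s ℤ.+ ℤ.- t) ℤ.+ 0ℤ) ≡ + 2 ℤ.* d ℤ.* s ℤ.+ 0ℤ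
    sum₀ = solve-∀
    difference₀ : ∀ d s t → (d ℤ.* (s ℤ.+ t) ℤ.+ 0ℤ) ℤ.- (d ℤ.* (s ℤ.+ ℤ.- t) ℤ.+ 0ℤ) ≡ + 2 ℤ.* d ℤ.* t ℤ.+ 0ℤ
    difference₀ = solve-∀
    sum₁ : ∀ d s t → (d ℤ.* (s ℤ.+ t ℤ.+ 1ℤ) ℤ.+ 0ℤ) ℤ.+ (d ℤ.* (s ℤ.+ ℤ.- t) ℤ.+ 0ℤ) ≡ + 2 ℤ.* d ℤ.* s ℤ.+ d
    sum₁ = solve-∀
    difference₁ : ∀ d s t → (d ℤ.* (s ℤ.+ t ℤ.+ 1ℤ) ℤ.+ 0ℤ) ℤ.- (d ℤ.* (s ℤ.+ ℤ.- t) ℤ.+ 0ℤ) ≡ + 2 ℤ.* d ℤ.* t ℤ.+ d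
    difference₁ = solve-∀

  Θ⁻-mod2 : ∀ {d e} → 1 ≤ d → 1 ≤ e → ∃ λ x → Θ⁻ 0ℤ d e ≈ 1# + (x + x)
  Θ⁻-mod2 {d} {e} 1≤d 1≤e = ∑ᶻ-even-mod2 (Θ⁻-supported 0ℤ {d} {e} 1≤d 1≤e)
    (λ m → *-cong (sgn-neg m) (θ-even e (+ d) m)) (trans (*-identityˡ _) (θ-0 0ℤ e (+ d)))

  θ-rescale : ∀ d e m → θ 0ℤ e (+ (2 ℕ.* d) ℤ.* m ℤ.+ 0ℤ) ≈ θ 0ℤ (4 ℕ.* e) (+ d ℤ.* m ℤ.+ 0ℤ)
  θ-rescale d e m = mono-≡ (≡.sym (≡.trans (eq e ∣ + d ℤ.* m ℤ.+ 0ℤ ∣) (cong (λ k → e ℕ.* (k ℕ.* k))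
      (≡.trans (≡.sym (ℤ.∣i*j∣≡∣i∣*∣j∣ (+ 2) (+ d ℤ.* m ℤ.+ 0ℤ))) (cong ∣_∣ eq′))))) ≡.refl
    where
    eq : ∀ e k → 4 ℕ.* e ℕ.* (k ℕ.* k) ≡ e ℕ.* ((2 ℕ.* k) ℕ.* (2 ℕ.* k))
    eq = ℕRing.solve-∀
    eq′ : + 2 ℤ.* (+ d ℤ.* m ℤ.+ 0ℤ) ≡ + (2 ℕ.* d) ℤ.* m ℤ.+ 0ℤ
    eq′ = ≡.trans (eq₁ (+ d) m) (cong (λ a → a ℤ.* m ℤ.+ 0ℤ) (≡.sym (ℤ.pos-* 2 d)))
      where
      eq₁ : ∀ d m → + 2 ℤ.* (d ℤ.* m ℤ.+ 0ℤ) ≡ + 2 ℤ.* d ℤ.* m ℤ.+ 0ℤ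
      eq₁ = solve-∀

  -- The values at z = 1 and z = -1 of Σ zᵐ X^(k m²).
  Φ Φ⁻ : ℕ → Series
  Φ k = Θ 0ℤ 1 k 0
  Φ⁻ k = Θ⁻ 0ℤ 1 k

  Θ⁻-rescale : ∀ e → Θ⁻ 0ℤ 2 e ≈ Φ⁻ (4 ℕ.* e)
  Θ⁻-rescale e = ∑ᶻ-cong B (λ m → *-congˡ (θ-rescale 1 e m))

  Θ-rescale : ∀ e → 𝔸 0ℤ 1 e ≈ Φ (4 ℕ.* e)
  Θ-rescale e = ∑ᶻ-cong B (λ m → θ-rescale 1 e m)

  Φ-Φ⁻ : ∀ {e} → 1 ≤ e → Φ (2 ℕ.* e) * Φ⁻ (2 ℕ.* e) ≈ Φ⁻ (4 ℕ.* e) * Φ⁻ (4 ℕ.* e)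
  Φ-Φ⁻ {e} 1≤e = trans (Θ-Θ⁻ 0ℤ {1} ℕ.≤-refl 1≤e) (*-cong (Θ⁻-rescale e) (Θ⁻-rescale e))

  Φ⁻-inverse : ℕ → ℕ → Series
  Φ⁻-inverse e zero    = 1#
  Φ⁻-inverse e (suc s) = Φ (2 ℕ.* e) * (Φ⁻-inverse (2 ℕ.* e) s * Φ⁻-inverse (2 ℕ.* e) s)

-- The partition series, φ(-q)⁻¹ and P(q)² φ(-q) = P(q²)

module EtaQuotients (M : ℕ) .{{_ : NonZero M}} (N : ℕ) where
  open Truncated M N
  open Relation.Binary.Reasoning.Setoid setoid
  open Algebra.Properties.CommutativeSemigroup *-commutativeSemigroup using (x∙yz≈y∙xz; xy∙z≈xz∙y)
    renaming (interchange to *-interchange)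
  open Algebra.Properties.CommutativeSemiring.Exp series
  open BilateralSum series
  open JacobiTripleProduct series
  open ThetaFunctions M N

  punctured : (ℤ → Series) → ℤ → Series
  punctured g (+ zero)  = 0#
  punctured g (+ suc m) = g (+ suc m)
  punctured g -[1+ m ]  = g -[1+ m ]

  opaque
    unfolding ∑ᶻ
    ∑ᶻ-puncture : ∀ K g → ∑ᶻ (suc K) g ≈ g 0ℤ + ∑ᶻ (suc K) (punctured g)
    ∑ᶻ-puncture zero    g = trans (+-identityˡ _) (+-congˡ (sym (trans (+-identityˡ _) (+-identityˡ _))))
    ∑ᶻ-puncture (suc K) g = trans (+-congʳ (∑ᶻ-puncture K g)) (+-assoc _ _ _)

    Supp-∑ᶻ : ∀ {Q g} → (∀ m → Supp Q (g m)) → ∀ K → Supp Q (∑ᶻ K g)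
    Supp-∑ᶻ s zero    = Supp-0
    Supp-∑ᶻ s (suc K) = Supp-+ (Supp-∑ᶻ s K) (Supp-+ (s (+ K)) (s -[1+ K ]))

  Supp-∑ : ∀ {Q f} → (∀ i → Supp Q (f i)) → ∀ n → Supp Q (∑ n f)
  Supp-∑ s zero    = Supp-0
  Supp-∑ s (suc n) = Supp-+ (Supp-∑ s n) (s n)

  Φ⁻-trivial : ∀ {k} → N < k → Φ⁻ k ≈ 1#
  Φ⁻-trivial {k} N<k = begin
    ∑ᶻ B g                          ≈⟨ ∑ᶻ-puncture _ g ⟩
    g 0ℤ + ∑ᶻ B (punctured g)       ≈⟨ +-cong (trans (*-identityˡ _) (θ-0 0ℤ k 1ℤ)) (∑ᶻ-0 B vanish) ⟩
    1# + 0#                         ≈⟨ +-identityʳ 1# ⟩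
    1#                              ∎
    where
    g : ℤ → Series
    g m = sgn m * θ 0ℤ k (1ℤ ℤ.* m ℤ.+ 0ℤ)
    large : ∀ m → 1 ≤ ∣ m ∣ → g m ≈ 0#
    large m 1≤∣m∣ = trans (*-congˡ (mono-large (ℕ.<-≤-trans N<k (≡.subst (λ j → k ≤ k ℕ.* sq j) (eq m)
      (ℕ.m≤m*n k (sq m) {{ℕ.>-nonZero (ℕ.*-mono-≤ 1≤∣m∣ 1≤∣m∣)}}))))) (zeroʳ _)
      where
      eq : ∀ m → m ≡ 1ℤ ℤ.* m ℤ.+ 0ℤ
      eq = solve-∀
    vanish : ∀ m → punctured g m ≈ 0#
    vanish (+ zero)  = refl
    vanish (+ suc m) = large (+ suc m) (ℕ.s≤s ℕ.z≤n)
    vanish -[1+ m ]  = large -[1+ m ] (ℕ.s≤s ℕ.z≤n)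

  -- Φ⁻(k)⁻¹ = Φ(k) Φ⁻(2k)⁻², and Φ⁻(2ˢk) = 1 once 2ˢk exceeds the truncation degree.
  Φ⁻-inverseˡ : ∀ s {e} → 1 ≤ e → N < 2 ℕ.^ s ℕ.* (2 ℕ.* e) → Φ⁻ (2 ℕ.* e) * Φ⁻-inverse e s ≈ 1#
  Φ⁻-inverseˡ zero    {e} 1≤e p = trans (*-identityʳ _) (Φ⁻-trivial (≡.subst (N <_) (ℕ.+-identityʳ _) p))
  Φ⁻-inverseˡ (suc s) {e} 1≤e p = begin
    Φ⁻ k * (Φ k * (V * V))                  ≈⟨ *-assoc _ _ _ ⟨
    Φ⁻ k * Φ k * (V * V)                    ≈⟨ *-congʳ (*-comm _ _) ⟩
    Φ k * Φ⁻ k * (V * V)                    ≈⟨ *-congʳ (Φ-Φ⁻ 1≤e) ⟩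
    Φ⁻ (4 ℕ.* e) * Φ⁻ (4 ℕ.* e) * (V * V)   ≈⟨ *-interchange _ _ _ _ ⟩
    (Φ⁻ (4 ℕ.* e) * V) * (Φ⁻ (4 ℕ.* e) * V) ≈⟨ *-cong ih ih ⟩
    1# * 1#                                 ≈⟨ *-identityˡ 1# ⟩
    1#                                      ∎
    where
    k = 2 ℕ.* e
    V = Φ⁻-inverse k s
    4e : ∀ e → 4 ℕ.* e ≡ 2 ℕ.* (2 ℕ.* e)
    4e = ℕRing.solve-∀
    eq : ∀ a k → 2 ℕ.* a ℕ.* k ≡ a ℕ.* (2 ℕ.* k)
    eq = ℕRing.solve-∀
    ih : Φ⁻ (4 ℕ.* e) * V ≈ 1#
    ih = trans (*-congʳ (reflexive (cong Φ⁻ (4e e))))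
      (Φ⁻-inverseˡ s (ℕ.≤-trans 1≤e (ℕ.m≤n*m e 2)) (≡.subst (N <_) (eq (2 ℕ.^ s) k) p))

  X^ : ℕ → Series
  X^ k = mono k 0ℤ

  X^-^ : ∀ k m → X^ k ^ m ≈ X^ (k ℕ.* m)
  X^-^ k zero    = trans (sym mono-1) (mono-≡ (≡.sym (ℕ.*-zeroʳ k)) ≡.refl)
  X^-^ k (suc m) = trans (*-congˡ (X^-^ k m)) (trans (mono-* _ _ _ _) (mono-≡ (≡.sym (ℕ.*-suc k m)) ≡.refl))

  box-cong : ∀ {p q} → p ≈ q → ∀ i j → box p i j ≈ box q i j
  box-cong eq zero    j       = refl
  box-cong eq (suc i) zero    = refl
  box-cong eq (suc i) (suc j) = +-cong (box-cong eq i (suc j)) (*-cong (^-congˡ (suc i) eq) (box-cong eq (suc i) j))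

  monomials : Character
  monomials = record
    { χ = λ m → mono 0 m ; χ-0 = mono-1 ; χ-+ = λ m n → sym (mono-* 0 m 0 n) }

  signed : Character → Character
  signed X = record
    { χ = λ m → sgn m * χ m
    ; χ-0 = trans (*-identityˡ _) χ-0
    ; χ-+ = λ m n → trans (*-cong (sgn-+ m n) (χ-+ m n)) (*-interchange _ _ _ _) }
    where open Character X

  squared : Character → Character
  squared X = record
    { χ = λ m → χ (m ℤ.+ m)
    ; χ-0 = χ-0
    ; χ-+ = λ m n → trans (reflexive (cong χ (eq m n))) (χ-+ (m ℤ.+ m) (n ℤ.+ n)) }
    where
    open Character X
    eq : ∀ m n → m ℤ.+ n ℤ.+ (m ℤ.+ n) ≡ m ℤ.+ m ℤ.+ (n ℤ.+ n)
    eq = solve-∀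

  -- ∏(1 + zx)(1 + x/z) ∏(1 - zx)(1 - x/z) = ∏(1 - z²x²)(1 - x²/z²)
  tripleProduct-signed : ∀ X x a b →
    tripleProduct X x a b * tripleProduct (signed X) x a b ≈ tripleProduct (signed (squared X)) (x ^ 2) a b
  tripleProduct-signed X x a b = trans (*-interchange _ _ _ _) (*-cong
    (trans (sym (∏-* a _ _)) (∏-cong a (λ j → factor 1ℤ refl (suc (2 ℕ.* j)))))
    (trans (sym (∏-* b _ _)) (∏-cong b (λ j → factor -1ℤ refl (suc (2 ℕ.* j))))))
    where
    open Character X
    factor : ∀ m → sgn m ≈ -1# ^ 1 → ∀ k →
      (1# + χ m * x ^ k) * (1# + sgn m * χ m * x ^ k) ≈ 1# + sgn m * χ (m ℤ.+ m) * (x ^ 2) ^ k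
    factor m sgn≈ k = begin
      (1# + u) * (1# + sgn m * χ m * x ^ k)
        ≈⟨ *-congˡ (+-congˡ (trans (*-assoc _ _ _) (*-congʳ (trans sgn≈ (*-identityʳ _))))) ⟩
      (1# + u) * (1# + -1# * u)
        ≈⟨ distribʳ _ _ _ ⟩
      1# * (1# + -1# * u) + u * (1# + -1# * u)
        ≈⟨ +-cong (*-identityˡ _) (trans (distribˡ _ _ _) (+-congʳ (*-identityʳ u))) ⟩
      1# + -1# * u + (u + u * (-1# * u))
        ≈⟨ trans (+-assoc _ _ _) (+-congˡ (trans (sym (+-assoc _ _ _)) (+-congʳ (trans (+-comm _ _) (x-x≈0 u))))) ⟩
      1# + (0# + u * (-1# * u))
        ≈⟨ +-congˡ (trans (+-identityˡ _) (x∙yz≈y∙xz _ _ _)) ⟩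
      1# + -1# * (u * u)
        ≈⟨ +-congˡ (*-cong (sym (trans sgn≈ (*-identityʳ _))) (trans (*-interchange _ _ _ _) (*-cong (sym (χ-+ m m)) square))) ⟩
      1# + sgn m * (χ (m ℤ.+ m) * (x ^ 2) ^ k)
        ≈⟨ +-congˡ (*-assoc _ _ _) ⟨
      1# + sgn m * χ (m ℤ.+ m) * (x ^ 2) ^ k ∎
      where
      u = χ m * x ^ k
      square : x ^ k * x ^ k ≈ (x ^ 2) ^ k
      square = trans (sym (^-distrib-* x x k)) (^-congˡ k (*-congˡ (sym (*-identityʳ x))))

  -- The second bound makes the power 2L + 1 of X¹⁶ vanish. X¹⁶ = q^(1/2) is the smallest base of a
  -- triple product below.
  module Partitions (L : ℕ) (L≤N : L ≤ N) (N< : N < 16 ℕ.* suc (2 ℕ.* L)) where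

    -- Up to the truncation, ∏ 1/(1 - X^(kj)): all partitions of degree at most N fit in
    -- the box.
    P : ℕ → Series
    P k = box (X^ k) L L

    jacobi-X : ∀ X k → 16 ≤ k → tripleProduct X (X^ k) L L ≈ P (2 ℕ.* k) * ∑ᶻ B (term X (X^ k))
    jacobi-X X k 16≤k = trans
      (jacobi X (X^ k) L nilpotent (B ℕ.∸ suc L))
      (*-cong (box-cong (trans (X^-^ k 2) (mono-≡ (ℕ.*-comm k 2) ≡.refl)) L L)
        (reflexive (cong (λ b → ∑ᶻ b (term X (X^ k))) (ℕ.m∸n+n≡m (ℕ.s≤s (ℕ.≤-trans L≤N (ℕ.m≤m+n N _)))))))
      where
      nilpotent : X^ k ^ suc (2 ℕ.* L) ≈ 0#
      nilpotent = trans (X^-^ k (suc (2 ℕ.* L))) (mono-large (ℕ.<-≤-trans N< (ℕ.*-monoˡ-≤ (suc (2 ℕ.* L)) 16≤k)))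

    term-θ : ∀ k m → term monomials (X^ k) m ≈ θ 1ℤ k (1ℤ ℤ.* m ℤ.+ 0ℤ)
    term-θ k m = trans (*-congˡ (X^-^ k (sq m))) (trans (mono-* _ _ _ _) (mono-≡ (cong (λ p → k ℕ.* sq p) (eq m)) (eq′ m)))
      where
      eq : ∀ m → m ≡ 1ℤ ℤ.* m ℤ.+ 0ℤ
      eq = solve-∀
      eq′ : ∀ m → m ℤ.+ 0ℤ ≡ 1ℤ ℤ.* (1ℤ ℤ.* m ℤ.+ 0ℤ)
      eq′ = solve-∀

    jacobi-Θ : ∀ k → 16 ≤ k → tripleProduct monomials (X^ k) L L ≈ P (2 ℕ.* k) * Θ 1ℤ 1 k 0
    jacobi-Θ k 16≤k = trans (jacobi-X monomials k 16≤k) (*-congˡ (∑ᶻ-cong B (term-θ k)))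

    jacobi-Θ⁻ : ∀ k → 16 ≤ k → tripleProduct (signed monomials) (X^ k) L L ≈ P (2 ℕ.* k) * Θ⁻ 1ℤ 1 k
    jacobi-Θ⁻ k 16≤k = trans (jacobi-X (signed monomials) k 16≤k)
      (*-congˡ (∑ᶻ-cong B (λ m → trans (*-assoc _ _ _) (*-congˡ (term-θ k m)))))

    jacobi-Θ⁻-squared : ∀ e → 16 ≤ 4 ℕ.* e →
      tripleProduct (signed (squared monomials)) (X^ (4 ℕ.* e)) L L ≈ P (2 ℕ.* (4 ℕ.* e)) * Θ⁻ 1ℤ 2 e
    jacobi-Θ⁻-squared e 16≤ = trans (jacobi-X (signed (squared monomials)) (4 ℕ.* e) 16≤)
      (*-congˡ (∑ᶻ-cong B (λ m → trans (*-assoc _ _ _) (*-congˡ (term-θ² m)))))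
      where
      term-θ² : ∀ m → mono 0 (m ℤ.+ m) * X^ (4 ℕ.* e) ^ sq m ≈ θ 1ℤ e (+ 2 ℤ.* m ℤ.+ 0ℤ)
      term-θ² m = trans (*-congˡ (X^-^ (4 ℕ.* e) (sq m))) (trans (mono-* _ _ _ _) (mono-≡ deg (eq m)))
        where
        eq : ∀ m → m ℤ.+ m ℤ.+ 0ℤ ≡ 1ℤ ℤ.* (+ 2 ℤ.* m ℤ.+ 0ℤ)
        eq = solve-∀
        2m : ∀ m → + 2 ℤ.* m ≡ + 2 ℤ.* m ℤ.+ 0ℤ
        2m = solve-∀
        eq₁ : ∀ e k → 4 ℕ.* e ℕ.* (k ℕ.* k) ≡ e ℕ.* ((2 ℕ.* k) ℕ.* (2 ℕ.* k))
        eq₁ = ℕRing.solve-∀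
        deg : 4 ℕ.* e ℕ.* sq m ≡ e ℕ.* sq (+ 2 ℤ.* m ℤ.+ 0ℤ)
        deg = ≡.trans (eq₁ e ∣ m ∣) (cong (λ k → e ℕ.* (k ℕ.* k))
          (≡.trans (≡.sym (ℤ.∣i*j∣≡∣i∣*∣j∣ (+ 2) m)) (cong ∣_∣ (2m m))))

    Constant-θ : ∀ e p → Supp Constant (θ 0ℤ e p)
    Constant-θ e p = Supp-mono (ℤ.*-zeroˡ p)

    Constant-* : ∀ {u v} → Supp Constant u → Supp Constant v → Supp Constant (u * v)
    Constant-* = Supp-* (λ { ≡.refl ≡.refl → ≡.refl })

    Constant-1 : Supp Constant 1#
    Constant-1 = Supp-≈ mono-1 (Supp-mono ≡.refl)

    Constant-^ : ∀ {u} → Supp Constant u → ∀ n → Supp Constant (u ^ n)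
    Constant-^ s zero    = Constant-1
    Constant-^ s (suc n) = Constant-* s (Constant-^ s n)

    Constant-✕ : ∀ {u} → Supp Constant u → ∀ n → Supp Constant (n ✕ u)
    Constant-✕ s zero    = Supp-0
    Constant-✕ s (suc n) = Supp-+ s (Constant-✕ s n)

    Constant-sgn : ∀ m → Supp Constant (sgn m)
    Constant-sgn m = Constant-^ (Constant-✕ Constant-1 (ℕ.pred M)) ∣ m ∣

    Constant-Θ⁻ : ∀ d e → Supp Constant (Θ⁻ 0ℤ d e)
    Constant-Θ⁻ d e = Supp-∑ᶻ (λ m → Constant-* (Constant-sgn m) (Constant-θ e (+ d ℤ.* m ℤ.+ 0ℤ))) B

    Constant-box : ∀ {q} → Supp Constant q → ∀ i j → Supp Constant (box q i j)
    Constant-box s zero    j       = Constant-1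
    Constant-box s (suc i) zero    = Constant-1
    Constant-box s (suc i) (suc j) = Supp-+ (Constant-box s i (suc j))
      (Constant-* (Constant-^ s (suc i)) (Constant-box s (suc i) j))

    Constant-P : ∀ k → Supp Constant (P k)
    Constant-P k = Constant-box (Supp-mono ≡.refl) L L

    ∑ᶻ-constantTerm : ∀ g → g 0ℤ ≈ 1# → (∀ m → 1 ≤ ∣ m ∣ → Supp (λ x → ¬ Constant x) (g m)) → ∑ᶻ B g ≈₀ 1#
    ∑ᶻ-constantTerm g g0≈1 s = ≈₀.trans (≈⇒≈₀ (trans (∑ᶻ-puncture _ g) (+-congʳ g0≈1)))
      (≈₀.trans (≈₀-+ ≈₀.refl (≈₀-0 (Supp-∑ᶻ rest B))) (≈⇒≈₀ (+-identityʳ 1#)))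
      where
      rest : ∀ m → Supp (λ x → ¬ Constant x) (punctured g m)
      rest (+ zero)  = Supp-0
      rest (+ suc m) = s (+ suc m) (ℕ.s≤s ℕ.z≤n)
      rest -[1+ m ]  = s -[1+ m ] (ℕ.s≤s ℕ.z≤n)

    θ-nonconstant : ∀ {d} e → 1 ≤ d → ∀ m → 1 ≤ ∣ m ∣ → Supp (λ x → ¬ Constant x) (θ 1ℤ e (+ d ℤ.* m ℤ.+ 0ℤ))
    θ-nonconstant {d} e 1≤d m 1≤∣m∣ = Supp-mono λ eq → ℕ.<⇒≢ (ℕ.*-mono-≤ {1} {d} 1≤d 1≤∣m∣) (≡.sym (≡.trans
      (≡.sym (ℤ.∣i*j∣≡∣i∣*∣j∣ (+ d) m)) (cong ∣_∣ (≡.trans (≡.sym (simplify (+ d) m)) eq))))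
      where
      simplify : ∀ d m → 1ℤ ℤ.* (d ℤ.* m ℤ.+ 0ℤ) ≡ d ℤ.* m
      simplify = solve-∀

    Θ-constantTerm : ∀ {d} e → 1 ≤ d → Θ 1ℤ d e 0 ≈₀ 1#
    Θ-constantTerm {d} e 1≤d = ∑ᶻ-constantTerm _ (θ-0 1ℤ e (+ d)) (θ-nonconstant e 1≤d)

    Θ⁻-constantTerm : ∀ {d} e → 1 ≤ d → Θ⁻ 1ℤ d e ≈₀ 1#
    Θ⁻-constantTerm {d} e 1≤d = ∑ᶻ-constantTerm _ (trans (*-identityˡ _) (θ-0 1ℤ e (+ d)))
      (λ m p → Supp-* (λ { {m , _} ≡.refl ¬c eq → ¬c (≡.trans (≡.sym (ℤ.+-identityˡ _)) eq) })
        (Constant-sgn m) (θ-nonconstant e 1≤d m p))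

    tripleProduct-cong : ∀ X {x y} → x ≈ y → ∀ a b → tripleProduct X x a b ≈ tripleProduct X y a b
    tripleProduct-cong X eq a b = *-cong
      (∏-cong a (λ j → +-congˡ (*-congˡ (^-congˡ (suc (2 ℕ.* j)) eq))))
      (∏-cong b (λ j → +-congˡ (*-congˡ (^-congˡ (suc (2 ℕ.* j)) eq))))

    -- The product formulas give this identity only up to the common factor `Θ⁻ 1ℤ 2 e`, a series in
    -- z². Instead of being inverted, the factor is removed by comparing coefficients of z⁰, where
    -- it is 1; both sides being free of z, that comparison is enough.
    P²Φ⁻ : ∀ {e} → 8 ≤ e → P (2 ℕ.* (2 ℕ.* e)) * P (2 ℕ.* (2 ℕ.* e)) * Φ⁻ (4 ℕ.* e) ≈ P (2 ℕ.* (4 ℕ.* e))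
    P²Φ⁻ {e} 8≤e = trans (*-congˡ (sym (Θ⁻-rescale e))) (≈₀⇒≈
      (Constant-* (Constant-* (Constant-P k) (Constant-P k)) (Constant-Θ⁻ 2 e))
      (Constant-P (2 ℕ.* (4 ℕ.* e)))
      (≈₀.trans (≈₀.sym (unit-factor (Constant-* (Constant-* (Constant-P k) (Constant-P k)) (Constant-Θ⁻ 2 e))))
        (≈₀.trans (≈⇒≈₀ products) (unit-factor (Constant-P (2 ℕ.* (4 ℕ.* e)))))))
      where
      k = 2 ℕ.* (2 ℕ.* e)
      16≤2e : 16 ≤ 2 ℕ.* e
      16≤2e = ℕ.*-monoʳ-≤ 2 8≤e
      1≤e : 1 ≤ e
      1≤e = ℕ.≤-trans (ℕ.s≤s ℕ.z≤n) 8≤e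
      2e≤4e : 2 ℕ.* e ≤ 4 ℕ.* e
      2e≤4e = ℕ.*-monoˡ-≤ e {2} {4} (ℕ.s≤s (ℕ.s≤s ℕ.z≤n))

      unit-factor : ∀ {u} → Supp Constant u → u * Θ⁻ 1ℤ 2 e ≈₀ u
      unit-factor s = ≈₀.trans (≈₀-*ˡ s (Θ⁻-constantTerm {2} e (ℕ.s≤s ℕ.z≤n))) (≈⇒≈₀ (*-identityʳ _))

      products : P k * P k * Θ⁻ 0ℤ 2 e * Θ⁻ 1ℤ 2 e ≈ P (2 ℕ.* (4 ℕ.* e)) * Θ⁻ 1ℤ 2 e
      products = begin
        P k * P k * Θ⁻ 0ℤ 2 e * Θ⁻ 1ℤ 2 e
          ≈⟨ *-assoc _ _ _ ⟩
        P k * P k * (Θ⁻ 0ℤ 2 e * Θ⁻ 1ℤ 2 e)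
          ≈⟨ *-congˡ (trans (*-comm _ _) (sym (Θ-Θ⁻ 1ℤ {1} ℕ.≤-refl 1≤e))) ⟩
        P k * P k * (Θ 1ℤ 1 (2 ℕ.* e) 0 * Θ⁻ 1ℤ 1 (2 ℕ.* e))
          ≈⟨ *-interchange _ _ _ _ ⟩
        P k * Θ 1ℤ 1 (2 ℕ.* e) 0 * (P k * Θ⁻ 1ℤ 1 (2 ℕ.* e))
          ≈⟨ *-cong (jacobi-Θ (2 ℕ.* e) 16≤2e) (jacobi-Θ⁻ (2 ℕ.* e) 16≤2e) ⟨
        tripleProduct monomials (X^ (2 ℕ.* e)) L L * tripleProduct (signed monomials) (X^ (2 ℕ.* e)) L L
          ≈⟨ tripleProduct-signed monomials (X^ (2 ℕ.* e)) L L ⟩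
        tripleProduct (signed (squared monomials)) (X^ (2 ℕ.* e) ^ 2) L L
          ≈⟨ tripleProduct-cong (signed (squared monomials)) (trans (X^-^ (2 ℕ.* e) 2) (mono-≡ (eq e) ≡.refl)) L L ⟩
        tripleProduct (signed (squared monomials)) (X^ (4 ℕ.* e)) L L
          ≈⟨ jacobi-Θ⁻-squared e (ℕ.≤-trans 16≤2e 2e≤4e) ⟩
        P (2 ℕ.* (4 ℕ.* e)) * Θ⁻ 1ℤ 2 e ∎
        where
        eq : ∀ e → 2 ℕ.* e ℕ.* 2 ≡ 4 ℕ.* e
        eq = ℕRing.solve-∀

-- The constant term of T¹⁶

module ConstantTerm (n : ℕ) (1≤n : 1 ≤ n) where
  N : ℕ
  N = 32 ℕ.* n

  open Truncated 2048 N
  open Algebra.Properties.CommutativeSemiring.Exp series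
  open ThetaFunctions 2048 N
  open EtaQuotients 2048 N
  open ModularSolver series 2048 (M✕≈0 1#)

  1≤N : 1 ≤ N
  1≤N = ℕ.≤-trans 1≤n (ℕ.m≤n*m n 32)
  n≤N : n ≤ N
  n≤N = ℕ.m≤n*m n 32
  N< : N < 16 ℕ.* suc (2 ℕ.* n)
  N< = ≡.subst (N <_) (eq n) (ℕ.m<m+n N (ℕ.s≤s ℕ.z≤n))
    where
    eq : ∀ n → 32 ℕ.* n ℕ.+ 16 ≡ 16 ℕ.* suc (2 ℕ.* n)
    eq = ℕRing.solve-∀

  open Partitions n n≤N N<

  record Submonoid (Q : Monomial → Set) : Set where
    field
      unit∈ : Q unit
      ·-closed : ∀ {x y} → Q x → Q y → Q (x · y)

  module _ {Q : Monomial → Set} (S : Submonoid Q) where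
    open Submonoid S

    Supp-1 : Supp Q 1#
    Supp-1 = Supp-≈ mono-1 (Supp-mono unit∈)

    Supp-⊗ : ∀ {u v} → Supp Q u → Supp Q v → Supp Q (u * v)
    Supp-⊗ = Supp-* ·-closed

    Supp-^ : ∀ {u} → Supp Q u → ∀ k → Supp Q (u ^ k)
    Supp-^ s zero    = Supp-1
    Supp-^ s (suc k) = Supp-⊗ s (Supp-^ s k)

    Supp-✕1 : ∀ k → Supp Q (k ✕ 1#)
    Supp-✕1 zero    = Supp-0
    Supp-✕1 (suc k) = Supp-+ Supp-1 (Supp-✕1 k)

    -- Lets long polynomial expressions inherit a grading in X or a divisibility of z-exponents from
    -- their variables.
    Supp-⟦⟧ : ∀ {m} (p : Polynomial m) {ρ} → VecAll.All (Supp Q) ρ → Supp Q (⟦ p ⟧ ρ)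
    Supp-⟦⟧ (op [+] p q) s = Supp-+ (Supp-⟦⟧ p s) (Supp-⟦⟧ q s)
    Supp-⟦⟧ (op [*] p q) s = Supp-⊗ (Supp-⟦⟧ p s) (Supp-⟦⟧ q s)
    Supp-⟦⟧ (con c)      s = Supp-≈ (sym (⟨⟩-≈× c)) (Supp-✕1 c)
    Supp-⟦⟧ (var i)      s = VecAll.lookup⁺ s i
    Supp-⟦⟧ (p :^ k)     s = Supp-^ (Supp-⟦⟧ p s) k
    Supp-⟦⟧ (:- p)       s = Supp-⟦⟧ p s

    Supp-box : ∀ {q} → Supp Q q → ∀ i j → Supp Q (JacobiTripleProduct.box series q i j)
    Supp-box s zero    j       = Supp-1
    Supp-box s (suc i) zero    = Supp-1
    Supp-box s (suc i) (suc j) = Supp-+ (Supp-box s i (suc j)) (Supp-⊗ (Supp-^ s (suc i)) (Supp-box s (suc i) j))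

  module _ {m : ℕ} where
    -- The part of (x + y)⁸ even in x, written in u = x² and v = y².
    quartic : (u v : Polynomial m) → Polynomial m
    quartic u v = u :^ 4 :+ con 28 :* u :^ 3 :* v :+ con 70 :* u :^ 2 :* v :^ 2 :+ con 28 :* u :* v :^ 3 :+ v :^ 4

    -- (aA + cB)⁸ = quartic (a²A²) (c²B²) + AB odd₁
    odd₁ : (a c A BB : Polynomial m) → Polynomial m
    odd₁ a c A BB = con 8 :* a :^ 7 :* c :* A :^ 6 :+ con 56 :* a :^ 5 :* c :^ 3 :* A :^ 4 :* BB
      :+ con 56 :* a :^ 3 :* c :^ 5 :* A :^ 2 :* BB :^ 2 :+ con 8 :* a :* c :^ 7 :* BB :^ 3

    -- The coefficients of quartic (P (A + B)) (2 (w A + y B)).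
    k₄₀ k₃₁ k₂₂ : (P y w : Polynomial m) → Polynomial m
    k₄₀ P y w = P :^ 4 :+ con 56 :* P :^ 3 :* w :+ con 280 :* P :^ 2 :* w :^ 2 :+ con 224 :* P :* w :^ 3 :+ con 16 :* w :^ 4
    k₃₁ P y w = con 4 :* P :^ 4 :+ con 56 :* P :^ 3 :* (y :+ con 3 :* w) :+ con 560 :* P :^ 2 :* w :* (y :+ w)
      :+ con 224 :* P :* w :^ 2 :* (w :+ con 3 :* y) :+ con 64 :* w :^ 3 :* y
    k₂₂ P y w = con 6 :* P :^ 4 :+ con 168 :* P :^ 3 :* (w :+ y) :+ con 280 :* P :^ 2 :* (y :^ 2 :+ con 4 :* w :* y :+ w :^ 2)
      :+ con 672 :* P :* (w :* y) :* (w :+ y) :+ con 96 :* w :^ 2 :* y :^ 2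

    -- For the coefficients above, A and B are `α * A₂` and `b * B₂`, since αb(αB₂ + bA₂) = wA + yB
    -- with y = α², w = b²; hence the extra y² and w². Exchanging A and B exchanges `y` and `w`, so
    -- the remaining coefficients are `k₄₀` and `k₃₁` with swapped arguments.
    even₂ : (P y w AA BB : Polynomial m) → Polynomial m
    even₂ P y w AA BB = k₄₀ P y w :* y :^ 2 :* AA :^ 2 :+ k₂₂ P y w :* (y :* w) :* (AA :* BB) :+ k₄₀ P w y :* w :^ 2 :* BB :^ 2

    odd₂ : (P α b AA BB : Polynomial m) → Polynomial m
    odd₂ P α b AA BB = α :* b :* (k₃₁ P (α :* α) (b :* b) :* (α :* α) :* AA :+ k₃₁ P (b :* b) (α :* α) :* (b :* b) :* BB)

    -- The squares of `a`, `α` and `b` in terms of `γ` and `d`.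
    P₃ y₃ w₃ : (γ d : Polynomial m) → Polynomial m
    P₃ γ d = (γ :+ d) :* (γ :+ d)
    y₃ γ d = γ :* γ :+ d :* d
    w₃ γ d = γ :* d :+ d :* γ

    even₃ : (γ d AA BB : Polynomial m) → Polynomial m
    even₃ γ d AA BB = k₄₀ p y w :* y :^ 2 :* (γ :^ 2 :* AA :+ d :^ 2 :* BB)
        :+ k₂₂ p y w :* (y :* w) :* (γ :* d) :* (AA :+ BB)
        :+ k₄₀ p w y :* w :^ 2 :* (γ :^ 2 :* BB :+ d :^ 2 :* AA)
      where
      p = P₃ γ d
      y = y₃ γ d
      w = w₃ γ d

    odd₃ : (γ d : Polynomial m) → Polynomial m
    odd₃ γ d = k₄₀ p y w :* y :^ 2 :* w :+ k₂₂ p y w :* (y :* w) :* y :+ k₄₀ p w y :* w :^ 2 :* w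
      where
      p = P₃ γ d
      y = y₃ γ d
      w = w₃ γ d

    -- The expansion modulo 2048 of φ(q)⁸ φ(q²)²⁰ CT(T¹⁶), sorted by the exponents of
    -- q modulo 4.
    h₀ h₁ h₂ h₃ : (γ ε D⁴ D²E : Polynomial m) → Polynomial m
    h₀ γ ε D⁴ D²E = γ :^ 42 :* ε :+ con 1160 :* γ :^ 40 :* D²E :+ con 608 :* γ :^ 38 :* D⁴ :* ε
      :+ con 768 :* γ :^ 36 :* D⁴ :* D²E :+ con 1280 :* γ :^ 34 :* D⁴ :^ 2 :* ε
    h₁ γ ε D⁴ D²E = con 256 :* γ :^ 41 :* ε
    h₂ γ ε D⁴ D²E = con 576 :* γ :^ 40 :* ε :+ con 1536 :* γ :^ 38 :* D²E :+ con 1024 :* γ :^ 36 :* D⁴ :* ε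
    h₃ γ ε D⁴ D²E = γ :^ 39 :* ε

    reduced : (γ D ε E : Polynomial m) → Polynomial m
    reduced γ D ε E = h₀ γ ε D⁴ D²E :+ D :* h₁ γ ε D⁴ D²E :+ D :* D :* h₂ γ ε D⁴ D²E
        :+ con 1024 :* (D :* D :* D :* h₃ γ ε D⁴ D²E)
      where
      D⁴ = D :^ 4
      D²E = D :* D :* E

  v0 : ∀ {m} → Polynomial (suc m)
  v0 = var Data.Fin.zero
  v1 : ∀ {m} → Polynomial (suc (suc m))
  v1 = var (# 1)
  v2 : ∀ {m} → Polynomial (suc (suc (suc m)))
  v2 = var (# 2)
  v3 : ∀ {m} → Polynomial (suc (suc (suc (suc m))))
  v3 = var (# 3)
  v4 : ∀ {m} → Polynomial (suc (suc (suc (suc (suc m)))))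
  v4 = var (# 4)
  v5 : ∀ {m} → Polynomial (suc (suc (suc (suc (suc (suc m))))))
  v5 = var (# 5)

  expand₁ : ∀ ρ → ⟦ (v0 :* v2 :+ v1 :* v3) :^ 8 ⟧ ρ ≈
                  ⟦ quartic ((v0 :* v0) :* (v2 :* v2)) ((v1 :* v1) :* (v3 :* v3)) :+ v2 :* v3 :* odd₁ v0 v1 v2 (v3 :* v3) ⟧ ρ
  expand₁ = solveMod {4} ((v0 :* v2 :+ v1 :* v3) :^ 8)
    (quartic ((v0 :* v0) :* (v2 :* v2)) ((v1 :* v1) :* (v3 :* v3)) :+ v2 :* v3 :* odd₁ v0 v1 v2 (v3 :* v3))

  expand₂ : ∀ ρ → ⟦ quartic (v0 :* (v1 :* v3 :+ v2 :* v4)) ((v1 :* v2 :+ v2 :* v1) :* (v1 :* v4 :+ v2 :* v3)) ⟧ ρ ≈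
                  ⟦ even₂ v0 (v1 :* v1) (v2 :* v2) (v3 :* v3) (v4 :* v4) :+ v3 :* v4 :* odd₂ v0 v1 v2 (v3 :* v3) (v4 :* v4) ⟧ ρ
  expand₂ = solveMod {5} (quartic (v0 :* (v1 :* v3 :+ v2 :* v4)) ((v1 :* v2 :+ v2 :* v1) :* (v1 :* v4 :+ v2 :* v3)))
    (even₂ v0 (v1 :* v1) (v2 :* v2) (v3 :* v3) (v4 :* v4) :+ v3 :* v4 :* odd₂ v0 v1 v2 (v3 :* v3) (v4 :* v4))

  expand₃ : ∀ ρ → ⟦ even₂ (P₃ v0 v1) (y₃ v0 v1) (w₃ v0 v1) (v0 :* v2 :+ v1 :* v3) (v0 :* v3 :+ v1 :* v2) ⟧ ρ ≈
                  ⟦ even₃ v0 v1 (v2 :* v2) (v3 :* v3) :+ v2 :* v3 :* odd₃ v0 v1 ⟧ ρ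
  expand₃ = solveMod {4} (even₂ (P₃ v0 v1) (y₃ v0 v1) (w₃ v0 v1) (v0 :* v2 :+ v1 :* v3) (v0 :* v3 :+ v1 :* v2))
    (even₃ v0 v1 (v2 :* v2) (v3 :* v3) :+ v2 :* v3 :* odd₃ v0 v1)

  -- `even₃` is linear in its last two arguments, so the fourth squaring produces no new products of
  -- theta functions of z.
  expand₄ : ∀ ρ → ⟦ even₃ v0 v1 (v2 :* v4 :+ v3 :* v5) (v2 :* v5 :+ v3 :* v4) ⟧ ρ ≈
                  ⟦ even₃ v0 v1 v2 v3 :* v4 :+ v5 :* even₃ v0 v1 v3 v2 ⟧ ρ
  expand₄ = solveMod {6} (even₃ v0 v1 (v2 :* v4 :+ v3 :* v5) (v2 :* v5 :+ v3 :* v4))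
    (even₃ v0 v1 v2 v3 :* v4 :+ v5 :* even₃ v0 v1 v3 v2)

  -- Here v0 + 2 v1 is φ(q) and `y₃` is φ(q²)², whose tenth power is φ(q²)²⁰. The factors 2 in d =
  -- 2D and e = 2E make most terms of the expansion vanish modulo 2048.
  reduce : ∀ ρ → ⟦ (v0 :+ (v1 :+ v1)) :^ 8 :* y₃ v0 (v1 :+ v1) :^ 10 :* even₃ v0 (v1 :+ v1) v2 (v3 :+ v3) ⟧ ρ ≈
                 ⟦ reduced v0 v1 v2 v3 ⟧ ρ
  reduce = solveMod {4} ((v0 :+ (v1 :+ v1)) :^ 8 :* y₃ v0 (v1 :+ v1) :^ 10 :* even₃ v0 (v1 :+ v1) v2 (v3 :+ v3))
    (reduced v0 v1 v2 v3)

  -- With q = X³², these are a = φ(q), α = φ(q²), γ = φ(q⁴), ε = φ(q⁸),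
  -- c = 2q^(1/4)ψ(q²), b = 2q^(1/2)ψ(q⁴), d = 2qψ(q⁸) and e = 2q²ψ(q¹⁶).
  T a c α b γ d ε e : Series
  T = Θ 1ℤ 1 16 0
  a = 𝔸 0ℤ 1 8
  c = 𝔹 0ℤ 1 8
  α = 𝔸 0ℤ 2 4
  b = 𝔹 0ℤ 2 4
  γ = 𝔸 0ℤ 4 2
  d = 𝔹 0ℤ 4 2
  ε = 𝔸 0ℤ 8 1
  e = 𝔹 0ℤ 8 1

  a≈γ+d : a ≈ γ + d
  a≈γ+d = Θ-split {2} {2} (ℕ.s≤s ℕ.z≤n) (ℕ.s≤s ℕ.z≤n)

  a²≈P₃ : a * a ≈ (γ + d) * (γ + d)
  a²≈P₃ = *-cong a≈γ+d a≈γ+d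

  α²≈y₃ : α * α ≈ γ * γ + d * d
  α²≈y₃ = Θ²-𝔸𝔹 0ℤ {4} {2} (ℕ.s≤s ℕ.z≤n) (ℕ.s≤s ℕ.z≤n)

  b²≈w₃ : b * b ≈ γ * d + d * γ
  b²≈w₃ = 𝔹²-𝔸𝔹 0ℤ {2} {2} 1≤N (ℕ.s≤s ℕ.z≤n) (ℕ.s≤s ℕ.z≤n)

  c²≈αb+bα : c * c ≈ α * b + b * α
  c²≈αb+bα = 𝔹²-𝔸𝔹 0ℤ {1} {4} 1≤N (ℕ.s≤s ℕ.z≤n) (ℕ.s≤s ℕ.z≤n)

  record multiples (f : ℕ) (x : Monomial) : Set where
    constructor _,_
    field
      k    : ℤ
      z-eq : proj₂ x ≡ + (2 ℕ.* f) ℤ.* k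

  record odds (f : ℕ) (x : Monomial) : Set where
    constructor _,_
    field
      k    : ℤ
      z-eq : proj₂ x ≡ + (2 ℕ.* f) ℤ.* k ℤ.+ + f

  multiples-submonoid : ∀ f → Submonoid (multiples f)
  multiples-submonoid f = record
    { unit∈ = 0ℤ , ≡.sym (ℤ.*-zeroʳ (+ (2 ℕ.* f)))
    ; ·-closed = λ { (k , ≡.refl) (l , ≡.refl) → k ℤ.+ l , ≡.sym (ℤ.*-distribˡ-+ (+ (2 ℕ.* f)) k l) } }

  odds-odds : ∀ {f x y} → odds f x → odds f y → multiples f (x · y)
  odds-odds {f} {m , _} {m′ , _} (k , ≡.refl) (l , ≡.refl) = k ℤ.+ l ℤ.+ 1ℤ , (collect (cong (λ x → + (f ℕ.+ x)) (ℕ.+-identityʳ f)))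
    where
    collect : ∀ {p q} → p ≡ q ℤ.+ q → p ℤ.* k ℤ.+ q ℤ.+ (p ℤ.* l ℤ.+ q) ≡ p ℤ.* (k ℤ.+ l ℤ.+ 1ℤ)
    collect {q = q} ≡.refl = eq q k l
      where
      eq : ∀ q k l → (q ℤ.+ q) ℤ.* k ℤ.+ q ℤ.+ ((q ℤ.+ q) ℤ.* l ℤ.+ q) ≡ (q ℤ.+ q) ℤ.* (k ℤ.+ l ℤ.+ 1ℤ)
      eq = solve-∀

  multiples-odds : ∀ {f x y} → multiples f x → odds f y → odds f (x · y)
  multiples-odds {f} {m , _} {m′ , _} (k , ≡.refl) (l , ≡.refl) = k ℤ.+ l , eq (+ (2 ℕ.* f)) (+ f) k l
    where
    eq : ∀ p q k l → p ℤ.* k ℤ.+ (p ℤ.* l ℤ.+ q) ≡ p ℤ.* (k ℤ.+ l) ℤ.+ q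
    eq = solve-∀

  2k+1≢0 : ∀ k → ¬ k ℤ.+ k ℤ.+ 1ℤ ≡ 0ℤ
  2k+1≢0 (+ k)    eq with () ← ≡.trans (≡.sym (cong +_ (ℕ.+-comm (k ℕ.+ k) 1))) eq
  2k+1≢0 -[1+ k ] eq with () ← ≡.trans (≡.sym (-m-1+1 (suc (k ℕ.+ k)))) eq

  odds-nonconstant : ∀ {f} → 1 ≤ f → ∀ {x} → odds f x → ¬ Constant x
  odds-nonconstant {suc f} _ {m , _} (k , ≡.refl) eq =
    2k+1≢0 k (ℤ.*-cancelˡ-≡ (+ suc f) _ _ (≡.trans (≡.trans (factor (cong (λ x → + suc (f ℕ.+ x)) (cong suc (ℕ.+-identityʳ f)))) eq) (≡.sym (ℤ.*-zeroʳ (+ suc f)))))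
    where
    factor : ∀ {p q} → p ≡ q ℤ.+ q → q ℤ.* (k ℤ.+ k ℤ.+ 1ℤ) ≡ p ℤ.* k ℤ.+ q
    factor {q = q} ≡.refl = eq′ q k
      where
      eq′ : ∀ q k → q ℤ.* (k ℤ.+ k ℤ.+ 1ℤ) ≡ (q ℤ.+ q) ℤ.* k ℤ.+ q
      eq′ = solve-∀

  Supp-𝔸 : ∀ f e → Supp (multiples f) (𝔸 1ℤ f e)
  Supp-𝔸 f e = Supp-∑ᶻ (λ m → Supp-mono (m , eq (+ (2 ℕ.* f)) m)) B
    where
    eq : ∀ d m → 1ℤ ℤ.* (d ℤ.* m ℤ.+ 0ℤ) ≡ d ℤ.* m
    eq = solve-∀

  Supp-𝔹 : ∀ f e → Supp (odds f) (𝔹 1ℤ f e)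
  Supp-𝔹 f e = Supp-∑ᶻ (λ m → Supp-mono (m , ℤ.*-identityˡ _)) B

  Supp-weaken : ∀ {Q R : Monomial → Set} → (∀ x → Q x → R x) → ∀ {u} → Supp Q u → Supp R u
  Supp-weaken Q⊆R s = mkSupp λ bf bg eq → apply s bf bg (λ x q → eq x (Q⊆R x q))

  Constant-Θ : ∀ d e r → Supp Constant (Θ 0ℤ d e r)
  Constant-Θ d e r = Supp-∑ᶻ (λ m → Constant-θ e (+ d ℤ.* m ℤ.+ + r)) B

  Constant⇒multiples : ∀ f {u} → Supp Constant u → Supp (multiples f) u
  Constant⇒multiples f = Supp-weaken (λ _ p → 0ℤ , ≡.trans p (≡.sym (ℤ.*-zeroʳ (+ (2 ℕ.* f)))))

  Constant-a : Supp Constant a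
  Constant-a = Constant-Θ 2 8 0
  Constant-c : Supp Constant c
  Constant-c = Constant-Θ 2 8 1
  Constant-α : Supp Constant α
  Constant-α = Constant-Θ 4 4 0
  Constant-b : Supp Constant b
  Constant-b = Constant-Θ 4 4 2
  Constant-γ : Supp Constant γ
  Constant-γ = Constant-Θ 8 2 0
  Constant-d : Supp Constant d
  Constant-d = Constant-Θ 8 2 4
  Constant-ε : Supp Constant ε
  Constant-ε = Constant-Θ 16 1 0
  Constant-e : Supp Constant e
  Constant-e = Constant-Θ 16 1 8

  -- All z-exponents of the product are odd multiples of `f`, so none of them is 0.
  cross-term : ∀ {f e u} → 1 ≤ f → Supp (multiples f) u → 𝔸 1ℤ f e * 𝔹 1ℤ f e * u ≈₀ 0#
  cross-term {f} {e} {u} 1≤f s = ≈₀-0 (Supp-weaken (λ x → odds-nonconstant 1≤f {x})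
    (Supp-≈ (*-comm _ _) (Supp-* (λ {x} {y} → multiples-odds {x = x} {y}) s (Supp-* (λ {x} {y} → multiples-odds {x = x} {y}) (Supp-𝔸 f e) (Supp-𝔹 f e)))))

  Supp-𝔹² : ∀ f e → Supp (multiples f) (𝔹 1ℤ f e * 𝔹 1ℤ f e)
  Supp-𝔹² f e = Supp-* (λ {x} {y} → odds-odds {x = x} {y}) (Supp-𝔹 f e) (Supp-𝔹 f e)

  +-≈₀-0 : ∀ {u v} → v ≈₀ 0# → u + v ≈₀ u
  +-≈₀-0 p = ≈₀.trans (≈₀-+ ≈₀.refl p) (≈⇒≈₀ (+-identityʳ _))

  T¹⁶-constantTerm : T ^ 16 ≈₀ ⟦ even₃ v0 v1 v2 v3 ⟧ (γ ∷ d ∷ ε ∷ e ∷ [])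
  T¹⁶-constantTerm = begin
    T ^ 16
      ≈⟨ ≈⇒≈₀ (trans (sym (^-assocʳ T 2 8)) (^-congˡ 8 (trans (*-congˡ (*-identityʳ T)) T²))) ⟩
    (a * A₁ + c * B₁) ^ 8
      ≈⟨ ≈⇒≈₀ (expand₁ (a ∷ c ∷ A₁ ∷ B₁ ∷ [])) ⟩
    ⟦ quartic ((v0 :* v0) :* (v2 :* v2)) ((v1 :* v1) :* (v3 :* v3)) :+ v2 :* v3 :* odd₁ v0 v1 v2 (v3 :* v3) ⟧ (a ∷ c ∷ A₁ ∷ B₁ ∷ [])
      ≈⟨ +-≈₀-0 (cross-term {1} {8} ℕ.≤-refl (Supp-⟦⟧ (multiples-submonoid 1) (odd₁ v0 v1 v2 v3)
           (z Constant-a ∷ z Constant-c ∷ Supp-𝔸 1 8 ∷ Supp-𝔹² 1 8 ∷ []))) ⟩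
    -- With the odd part gone, `c` occurs only through its square, which is 2αb.
    ⟦ quartic v0 v1 ⟧ ((a * a) * (A₁ * A₁) ∷ (c * c) * (B₁ * B₁) ∷ [])
      ≈⟨ ≈⇒≈₀ (⟦⟧-cong (quartic v0 v1) (*-congˡ A₁² ∷ *-cong c²≈αb+bα B₁² ∷ [])) ⟩
    ⟦ quartic v0 v1 ⟧ ((a * a) * (α * A₂ + b * B₂) ∷ (α * b + b * α) * (α * B₂ + b * A₂) ∷ [])
      ≈⟨ ≈⇒≈₀ (expand₂ (a * a ∷ α ∷ b ∷ A₂ ∷ B₂ ∷ [])) ⟩
    ⟦ even₂ v0 (v1 :* v1) (v2 :* v2) (v3 :* v3) (v4 :* v4) :+ v3 :* v4 :* odd₂ v0 v1 v2 (v3 :* v3) (v4 :* v4) ⟧ (a * a ∷ α ∷ b ∷ A₂ ∷ B₂ ∷ [])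
      ≈⟨ +-≈₀-0 (cross-term {2} {4} (ℕ.s≤s ℕ.z≤n) (Supp-⟦⟧ (multiples-submonoid 2) (odd₂ v0 v1 v2 (v3 :* v3) v4)
           (z (Constant-* Constant-a Constant-a) ∷ z Constant-α ∷ z Constant-b ∷ Supp-𝔸 2 4 ∷ Supp-𝔹² 2 4 ∷ []))) ⟩
    ⟦ even₂ v0 v1 v2 v3 v4 ⟧ (a * a ∷ α * α ∷ b * b ∷ A₂ * A₂ ∷ B₂ * B₂ ∷ [])
      ≈⟨ ≈⇒≈₀ (⟦⟧-cong (even₂ v0 v1 v2 v3 v4) (a²≈P₃ ∷ α²≈y₃ ∷ b²≈w₃ ∷ A₂² ∷ B₂² ∷ [])) ⟩
    ⟦ even₂ v0 v1 v2 v3 v4 ⟧ ((γ + d) * (γ + d) ∷ γ * γ + d * d ∷ γ * d + d * γ ∷ γ * A₃ + d * B₃ ∷ γ * B₃ + d * A₃ ∷ [])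
      ≈⟨ ≈⇒≈₀ (expand₃ (γ ∷ d ∷ A₃ ∷ B₃ ∷ [])) ⟩
    ⟦ even₃ v0 v1 (v2 :* v2) (v3 :* v3) :+ v2 :* v3 :* odd₃ v0 v1 ⟧ (γ ∷ d ∷ A₃ ∷ B₃ ∷ [])
      ≈⟨ +-≈₀-0 (cross-term {4} {2} (ℕ.s≤s ℕ.z≤n) (Supp-⟦⟧ (multiples-submonoid 4) (odd₃ v0 v1)
           (z Constant-γ ∷ z Constant-d ∷ []))) ⟩
    ⟦ even₃ v0 v1 v2 v3 ⟧ (γ ∷ d ∷ A₃ * A₃ ∷ B₃ * B₃ ∷ [])
      ≈⟨ ≈⇒≈₀ (⟦⟧-cong (even₃ v0 v1 v2 v3) (refl ∷ refl ∷ A₃² ∷ B₃² ∷ [])) ⟩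
    ⟦ even₃ v0 v1 v2 v3 ⟧ (γ ∷ d ∷ ε * A₄ + e * B₄ ∷ ε * B₄ + e * A₄ ∷ [])
      ≈⟨ ≈⇒≈₀ (expand₄ (γ ∷ d ∷ ε ∷ e ∷ A₄ ∷ B₄ ∷ [])) ⟩
    ⟦ even₃ v0 v1 v2 v3 ⟧ (γ ∷ d ∷ ε ∷ e ∷ []) * A₄ + B₄ * ⟦ even₃ v0 v1 v2 v3 ⟧ (γ ∷ d ∷ e ∷ ε ∷ [])
      ≈⟨ +-≈₀-0 (≈₀-0 (Supp-weaken (λ x → odds-nonconstant {8} (ℕ.s≤s ℕ.z≤n) {x}) (Supp-≈ (*-comm _ _) (Supp-* (λ {x} {y} → multiples-odds {x = x} {y})
           (Supp-⟦⟧ (multiples-submonoid 8) (even₃ v0 v1 v2 v3)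
             (z Constant-γ ∷ z Constant-d ∷ z Constant-e ∷ z Constant-ε ∷ []))
           (Supp-𝔹 8 1))))) ⟩
    -- The coefficient of `A₄` is free of z, and the term of `A₄` at z⁰ is 1.
    ⟦ even₃ v0 v1 v2 v3 ⟧ (γ ∷ d ∷ ε ∷ e ∷ []) * A₄
      ≈⟨ ≈₀-*ˡ (Supp-⟦⟧ constants (even₃ v0 v1 v2 v3) (Constant-γ ∷ Constant-d ∷ Constant-ε ∷ Constant-e ∷ []))
           (Θ-constantTerm {16} 1 (ℕ.s≤s ℕ.z≤n)) ⟩
    ⟦ even₃ v0 v1 v2 v3 ⟧ (γ ∷ d ∷ ε ∷ e ∷ []) * 1#
      ≈⟨ ≈⇒≈₀ (*-identityʳ _) ⟩
    ⟦ even₃ v0 v1 v2 v3 ⟧ (γ ∷ d ∷ ε ∷ e ∷ []) ∎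
    where
    open Relation.Binary.Reasoning.Setoid ≈₀-setoid
    A₁ B₁ A₂ B₂ A₃ B₃ A₄ B₄ : Series
    A₁ = 𝔸 1ℤ 1 8
    B₁ = 𝔹 1ℤ 1 8
    A₂ = 𝔸 1ℤ 2 4
    B₂ = 𝔹 1ℤ 2 4
    A₃ = 𝔸 1ℤ 4 2
    B₃ = 𝔹 1ℤ 4 2
    A₄ = 𝔸 1ℤ 8 1
    B₄ = 𝔹 1ℤ 8 1
    1≤ : ∀ {m} → 1 ≤ suc m
    1≤ = ℕ.s≤s ℕ.z≤n
    T² : T * T ≈ a * A₁ + c * B₁
    T² = Θ²-𝔸𝔹 1ℤ {1} {8} 1≤ 1≤
    A₁² : A₁ * A₁ ≈ α * A₂ + b * B₂
    A₁² = Θ²-𝔸𝔹 1ℤ {2} {4} 1≤ 1≤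
    B₁² : B₁ * B₁ ≈ α * B₂ + b * A₂
    B₁² = 𝔹²-𝔸𝔹 1ℤ {1} {4} 1≤N 1≤ 1≤
    A₂² : A₂ * A₂ ≈ γ * A₃ + d * B₃
    A₂² = Θ²-𝔸𝔹 1ℤ {4} {2} 1≤ 1≤
    B₂² : B₂ * B₂ ≈ γ * B₃ + d * A₃
    B₂² = 𝔹²-𝔸𝔹 1ℤ {2} {2} 1≤N 1≤ 1≤
    A₃² : A₃ * A₃ ≈ ε * A₄ + e * B₄
    A₃² = Θ²-𝔸𝔹 1ℤ {8} {1} 1≤ 1≤
    B₃² : B₃ * B₃ ≈ ε * B₄ + e * A₄
    B₃² = 𝔹²-𝔸𝔹 1ℤ {4} {1} 1≤N 1≤ 1≤
    z : ∀ {f u} → Supp Constant u → Supp (multiples f) u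
    z {f} = Constant⇒multiples f
    constants : Submonoid Constant
    constants = record { unit∈ = ≡.refl ; ·-closed = λ { ≡.refl ≡.refl → ≡.refl } }

-- The coefficients of P(q)¹⁶ CT(T¹⁶)

m<2^m : ∀ m → m < 2 ℕ.^ m
m<2^m zero    = ℕ.s≤s ℕ.z≤n
m<2^m (suc m) = ℕ.≤-trans (ℕ.+-mono-≤ (ℕ.m^n>0 2 m) (m<2^m m))
  (ℕ.≤-reflexive (cong (2 ℕ.^ m ℕ.+_) (≡.sym (ℕ.+-identityʳ _))))

triangle : ℕ → ℕ
triangle zero    = 0
triangle (suc i) = triangle i ℕ.+ suc i

2*triangle : ∀ i → 2 ℕ.* triangle i ≡ i ℕ.* suc i
2*triangle zero    = ≡.refl
2*triangle (suc i) = ≡.trans (ℕ.*-distribˡ-+ 2 (triangle i) (suc i)) (≡.trans (cong (ℕ._+ 2 ℕ.* suc i) (2*triangle i)) (eq i))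
  where
  eq : ∀ i → i ℕ.* suc i ℕ.+ 2 ℕ.* suc i ≡ suc i ℕ.* suc (suc i)
  eq = ℕRing.solve-∀

record Graded (c r : ℕ) (x : Monomial) : Set where
  constructor graded
  field
    quotient : ℕ
    degree   : proj₁ x ≡ r ℕ.+ quotient ℕ.* c
    constant : proj₂ x ≡ 0ℤ

Graded-· : ∀ {c r s x y} → Graded c r x → Graded c s y → Graded c (r ℕ.+ s) (x · y)
Graded-· {c} {r} {s} (graded k ≡.refl ≡.refl) (graded l ≡.refl ≡.refl) = graded (k ℕ.+ l) (eq c r s k l) ≡.refl
  where
  eq : ∀ c r s k l → r ℕ.+ k ℕ.* c ℕ.+ (s ℕ.+ l ℕ.* c) ≡ r ℕ.+ s ℕ.+ (k ℕ.+ l) ℕ.* c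
  eq = ℕRing.solve-∀

Graded-% : ∀ {c r x} .{{_ : NonZero c}} → Graded c r x → proj₁ x % c ≡ r % c
Graded-% {c} {r} (graded k ≡.refl _) = [m+kn]%n≡m%n r k c

module ScaledEquality {c ℓ} (S : CommutativeSemiring c ℓ) (h : CommutativeSemiring.Carrier S) where
  open CommutativeSemiring S
  open Algebra.Properties.Semiring.Exp semiring using (_^_)
  open Algebra.Properties.CommutativeSemigroup *-commutativeSemigroup using (x∙yz≈y∙xz)

  infix 4 _≈ʰ_
  record _≈ʰ_ (u v : Carrier) : Set ℓ where
    constructor scaled
    field h*-≈ : h * u ≈ h * v
  open _≈ʰ_ public

  ≈ʰ-sym : ∀ {u v} → u ≈ʰ v → v ≈ʰ u
  ≈ʰ-sym (scaled p) = scaled (sym p)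

  ≈ʰ-trans : ∀ {u v w} → u ≈ʰ v → v ≈ʰ w → u ≈ʰ w
  ≈ʰ-trans (scaled p) (scaled q) = scaled (trans p q)

  ≈⇒≈ʰ : ∀ {u v} → u ≈ v → u ≈ʰ v
  ≈⇒≈ʰ p = scaled (*-congˡ p)

  -- One copy of `h` suffices: it is attached to the first factor, then moved to the second.
  ≈ʰ-* : ∀ {u u′ v v′} → u ≈ʰ u′ → v ≈ʰ v′ → u * v ≈ʰ u′ * v′
  ≈ʰ-* (scaled p) (scaled q) = scaled (trans (sym (*-assoc _ _ _)) (trans (*-congʳ p)
    (trans (*-assoc _ _ _) (trans (x∙yz≈y∙xz _ _ _) (trans (*-congˡ q) (x∙yz≈y∙xz _ _ _))))))

  ≈ʰ-^1 : ∀ {u} → u ≈ʰ 1# → ∀ k → u ^ k ≈ʰ 1#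
  ≈ʰ-^1 p zero    = ≈⇒≈ʰ refl
  ≈ʰ-^1 p (suc k) = ≈ʰ-trans (≈ʰ-* p (≈ʰ-^1 p k)) (≈⇒≈ʰ (*-identityˡ 1#))

module Coefficients (n : ℕ) (1≤n : 1 ≤ n) where
  open ConstantTerm n 1≤n
  open Truncated 2048 N
  open Algebra.Properties.CommutativeSemiring.Exp series
  open BilateralSum series using (∑)
  open ThetaFunctions 2048 N
  open EtaQuotients 2048 N
  open ModularSolver series 2048 (M✕≈0 1#)
  open Partitions n n≤N N<
  open Algebra.Properties.CommutativeSemigroup *-commutativeSemigroup using (x∙yz≈y∙xz)
    renaming (interchange to *-interchange)

  D E : Series
  D = half𝔹 4 2
  E = half𝔹 8 1

  Graded-submonoid : ∀ c → Submonoid (Graded c 0)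
  Graded-submonoid c = record { unit∈ = graded 0 ≡.refl ≡.refl ; ·-closed = Graded-· }

  θ-graded : ∀ {c} r e p k → e ℕ.* sq p ≡ r ℕ.+ k ℕ.* c → Supp (Graded c r) (θ 0ℤ e p)
  θ-graded r e p k eq = Supp-mono (graded k eq (ℤ.*-zeroˡ p))

  γ-graded : Supp (Graded 128 0) γ
  γ-graded = Supp-∑ᶻ (λ m → θ-graded 0 2 (+ 8 ℤ.* m ℤ.+ 0ℤ) (sq m) (eq m)) B
    where
    eq₁ : ∀ k → 2 ℕ.* ((8 ℕ.* k) ℕ.* (8 ℕ.* k)) ≡ (k ℕ.* k) ℕ.* 128
    eq₁ = ℕRing.solve-∀
    eq : ∀ m → 2 ℕ.* sq (+ 8 ℤ.* m ℤ.+ 0ℤ) ≡ sq m ℕ.* 128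
    eq m = ≡.trans (cong (λ k → 2 ℕ.* (k ℕ.* k)) (≡.trans (cong ∣_∣ (ℤ.+-identityʳ (+ 8 ℤ.* m))) (ℤ.∣i*j∣≡∣i∣*∣j∣ (+ 8) m))) (eq₁ ∣ m ∣)

  ε-graded : Supp (Graded 128 0) ε
  ε-graded = Supp-∑ᶻ (λ m → θ-graded 0 1 (+ 16 ℤ.* m ℤ.+ 0ℤ) (2 ℕ.* sq m) (eq m)) B
    where
    eq₁ : ∀ k → 1 ℕ.* ((16 ℕ.* k) ℕ.* (16 ℕ.* k)) ≡ 2 ℕ.* (k ℕ.* k) ℕ.* 128
    eq₁ = ℕRing.solve-∀
    eq : ∀ m → 1 ℕ.* sq (+ 16 ℤ.* m ℤ.+ 0ℤ) ≡ 2 ℕ.* sq m ℕ.* 128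
    eq m = ≡.trans (cong (λ k → 1 ℕ.* (k ℕ.* k)) (≡.trans (cong ∣_∣ (ℤ.+-identityʳ (+ 16 ℤ.* m))) (ℤ.∣i*j∣≡∣i∣*∣j∣ (+ 16) m))) (eq₁ ∣ m ∣)

  private
    ∣ai+b∣ : ∀ a i b → ∣ + a ℤ.* + i ℤ.+ + b ∣ ≡ a ℕ.* i ℕ.+ b
    ∣ai+b∣ a i b = cong (λ m → ∣ m ℤ.+ + b ∣) (≡.sym (ℤ.pos-* a i))

  -- The exponents 2(8i + 4)² are 32 + 256 i(i + 1)/2, in accordance with D = qψ(q⁸). The modulus
  -- 256, finer than the 128 of the other gradings, is what decides the second congruence.
  D-graded : Supp (Graded 256 32) D
  D-graded = Supp-∑ (λ i → θ-graded 32 2 (+ 8 ℤ.* + i ℤ.+ + 4) (triangle i) (eq i)) B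
    where
    eq₁ : ∀ i → 2 ℕ.* ((8 ℕ.* i ℕ.+ 4) ℕ.* (8 ℕ.* i ℕ.+ 4)) ≡ 32 ℕ.+ (i ℕ.* suc i) ℕ.* 128
    eq₁ = ℕRing.solve-∀
    eq₂ : ∀ t → 32 ℕ.+ 2 ℕ.* t ℕ.* 128 ≡ 32 ℕ.+ t ℕ.* 256
    eq₂ = ℕRing.solve-∀
    eq : ∀ i → 2 ℕ.* sq (+ 8 ℤ.* + i ℤ.+ + 4) ≡ 32 ℕ.+ triangle i ℕ.* 256
    eq i = ≡.trans (cong (λ k → 2 ℕ.* (k ℕ.* k)) (∣ai+b∣ 8 i 4)) (≡.trans (eq₁ i)
      (≡.trans (cong (λ k → 32 ℕ.+ k ℕ.* 128) (≡.sym (2*triangle i))) (eq₂ (triangle i))))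

  E-graded : Supp (Graded 128 64) E
  E-graded = Supp-∑ (λ i → θ-graded 64 1 (+ 16 ℤ.* + i ℤ.+ + 8) (2 ℕ.* (i ℕ.* suc i)) (eq i)) B
    where
    eq₁ : ∀ i → 1 ℕ.* ((16 ℕ.* i ℕ.+ 8) ℕ.* (16 ℕ.* i ℕ.+ 8)) ≡ 64 ℕ.+ 2 ℕ.* (i ℕ.* suc i) ℕ.* 128
    eq₁ = ℕRing.solve-∀
    eq : ∀ i → 1 ℕ.* sq (+ 16 ℤ.* + i ℤ.+ + 8) ≡ 64 ℕ.+ 2 ℕ.* (i ℕ.* suc i) ℕ.* 128
    eq i = ≡.trans (cong (λ k → 1 ℕ.* (k ℕ.* k)) (∣ai+b∣ 16 i 8)) (eq₁ i)

  Graded-256⇒128 : ∀ {r u} → Supp (Graded 256 r) u → Supp (Graded 128 r) u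
  Graded-256⇒128 {r} = Supp-weaken λ { x (graded k deg const) → graded (2 ℕ.* k) (≡.trans deg (eq r k)) const }
    where
    eq : ∀ r k → r ℕ.+ k ℕ.* 256 ≡ r ℕ.+ 2 ℕ.* k ℕ.* 128
    eq = ℕRing.solve-∀

  Supp-Graded-* : ∀ {c r s u v} → Supp (Graded c r) u → Supp (Graded c s) v → Supp (Graded c (r ℕ.+ s)) (u * v)
  Supp-Graded-* = Supp-* Graded-·

  Graded-drop : ∀ {c u} → Supp (Graded c c) u → Supp (Graded c 0) u
  Graded-drop = Supp-weaken λ { x (graded k deg const) → graded (suc k) deg const }

  D-graded₁₂₈ : Supp (Graded 128 32) D
  D-graded₁₂₈ = Graded-256⇒128 D-graded

  D²-graded : Supp (Graded 128 64) (D * D)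
  D²-graded = Supp-Graded-* D-graded₁₂₈ D-graded₁₂₈

  D⁴-graded : Supp (Graded 128 0) (D ^ 4)
  D⁴-graded = Supp-≈ (solveMod {1} (v0 :* v0 :* (v0 :* v0)) (v0 :^ 4) (D ∷ []))
    (Graded-drop (Supp-Graded-* D²-graded D²-graded))

  D²E-graded : Supp (Graded 128 0) (D * D * E)
  D²E-graded = Graded-drop (Supp-Graded-* D²-graded E-graded)

  P-graded : ∀ k → Supp (Graded k 0) (P k)
  P-graded k = Supp-box (Graded-submonoid k) (Supp-mono (graded 1 (≡.sym (ℕ.+-identityʳ k)) ≡.refl)) n n

  Φ-graded : ∀ {c} j → Supp (Graded c 0) (Φ (j ℕ.* c))
  Φ-graded {c} j = Supp-∑ᶻ (λ m → θ-graded 0 (j ℕ.* c) (1ℤ ℤ.* m ℤ.+ 0ℤ) (j ℕ.* sq (1ℤ ℤ.* m ℤ.+ 0ℤ)) (eq j c (sq (1ℤ ℤ.* m ℤ.+ 0ℤ)))) B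
    where
    eq : ∀ j c k → j ℕ.* c ℕ.* k ≡ j ℕ.* k ℕ.* c
    eq = ℕRing.solve-∀

  Φ⁻-inverse-graded : ∀ s j → Supp (Graded 128 0) (Φ⁻-inverse (j ℕ.* 64) s)
  Φ⁻-inverse-graded zero    j = Supp-1 (Graded-submonoid 128)
  Φ⁻-inverse-graded (suc s) j = Supp-⊗ S (≡.subst (λ k → Supp (Graded 128 0) (Φ k)) (eq₁ j) (Φ-graded j)) (Supp-⊗ S ih ih)
    where
    S = Graded-submonoid 128
    eq₁ : ∀ j → j ℕ.* 128 ≡ 2 ℕ.* (j ℕ.* 64)
    eq₁ = ℕRing.solve-∀
    ih : Supp (Graded 128 0) (Φ⁻-inverse (2 ℕ.* (j ℕ.* 64)) s)
    ih = ≡.subst (λ k → Supp (Graded 128 0) (Φ⁻-inverse k s)) (ℕ.*-assoc 2 j 64) (Φ⁻-inverse-graded s (2 ℕ.* j))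

  -- κ is a series in q⁴, because P 128 and Φ⁻ 128 are.
  U κ : Series
  U = Φ⁻-inverse 64 N
  κ = P 128 ^ 4 * U ^ 40

  U-inverse : Φ⁻ 128 * U ≈ 1#
  -- N doublings exceed the truncation degree, as N < 2^N.
  U-inverse = Φ⁻-inverseˡ N {64} (ℕ.s≤s ℕ.z≤n) (ℕ.<-≤-trans (m<2^m N) (ℕ.m≤m*n (2 ℕ.^ N) 128))

  κ-graded : Supp (Graded 128 0) κ
  κ-graded = Supp-⊗ S (Supp-^ S (P-graded 128) 4) (Supp-^ S (Φ⁻-inverse-graded N 1) 40)
    where S = Graded-submonoid 128

  a≈Φ : a ≈ Φ 32
  a≈Φ = Θ-rescale 8

  α≈Φ : α ≈ Φ 64
  α≈Φ = BilateralSum.∑ᶻ-cong series B (λ m → trans (θ-rescale 2 4 m) (θ-rescale 1 16 m))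

  -- Two applications of `P²Φ⁻` give P(q⁴)⁴ = P(q)¹⁶ φ(-q)⁸ φ(-q²)⁴. The factor φ(q)⁸ turns φ(-q)⁸
  -- into φ(-q²)¹⁶, then φ(q²)²⁰ turns φ(-q²)²⁰ into φ(-q⁴)⁴⁰, and `U ^ 40` cancels that.
  P32^16 : P 32 ^ 16 ≈ κ * (a ^ 8 * α ^ 20)
  P32^16 = sym (begin
    P 128 ^ 4 * U ^ 40 * (a ^ 8 * α ^ 20)
      ≈⟨ ⟦⟧-cong (v0 :^ 4 :* v1 :^ 40 :* (v2 :^ 8 :* v3 :^ 20))
           (trans (sym (P²Φ⁻ {16} 1≤8)) (*-congʳ (*-cong P64 P64)) ∷ refl ∷ a≈Φ ∷ α≈Φ ∷ []) ⟩
    (p * p * m₃₂ * (p * p * m₃₂) * m₆₄) ^ 4 * U ^ 40 * (Φ 32 ^ 8 * Φ 64 ^ 20)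
      ≈⟨ solveMod {6} ((v0 :* v0 :* v1 :* (v0 :* v0 :* v1) :* v2) :^ 4 :* v3 :^ 40 :* (v4 :^ 8 :* v5 :^ 20))
           (v0 :^ 16 :* (v4 :* v1) :^ 8 :* v2 :^ 4 :* v5 :^ 20 :* v3 :^ 40)
           (p ∷ m₃₂ ∷ m₆₄ ∷ U ∷ Φ 32 ∷ Φ 64 ∷ []) ⟩
    p ^ 16 * (Φ 32 * m₃₂) ^ 8 * m₆₄ ^ 4 * Φ 64 ^ 20 * U ^ 40
      ≈⟨ *-congʳ (*-congʳ (*-congʳ (*-congˡ (^-congˡ 8 (Φ-Φ⁻ {16} 1≤))))) ⟩
    p ^ 16 * (m₆₄ * m₆₄) ^ 8 * m₆₄ ^ 4 * Φ 64 ^ 20 * U ^ 40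
      ≈⟨ solveMod {4} (v0 :^ 16 :* (v1 :* v1) :^ 8 :* v1 :^ 4 :* v2 :^ 20 :* v3 :^ 40)
           (v0 :^ 16 :* (v2 :* v1) :^ 20 :* v3 :^ 40) (p ∷ m₆₄ ∷ Φ 64 ∷ U ∷ []) ⟩
    p ^ 16 * (Φ 64 * m₆₄) ^ 20 * U ^ 40
      ≈⟨ *-congʳ (*-congˡ (^-congˡ 20 (Φ-Φ⁻ {32} 1≤))) ⟩
    p ^ 16 * (m₁₂₈ * m₁₂₈) ^ 20 * U ^ 40
      ≈⟨ solveMod {3} (v0 :^ 16 :* (v1 :* v1) :^ 20 :* v2 :^ 40) (v0 :^ 16 :* (v1 :* v2) :^ 40) (p ∷ m₁₂₈ ∷ U ∷ []) ⟩
    p ^ 16 * (m₁₂₈ * U) ^ 40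
      ≈⟨ *-congˡ (trans (^-congˡ 40 U-inverse) (1^ 40)) ⟩
    p ^ 16 * 1#
      ≈⟨ *-identityʳ _ ⟩
    p ^ 16 ∎)
    where
    open Relation.Binary.Reasoning.Setoid setoid
    1≤8 : ∀ {k} → 8 ≤ 8 ℕ.+ k
    1≤8 = ℕ.m≤m+n 8 _
    1≤ : ∀ {k} → 1 ≤ suc k
    1≤ = ℕ.s≤s ℕ.z≤n
    p m₃₂ m₆₄ m₁₂₈ : Series
    p = P 32
    m₃₂ = Φ⁻ 32
    m₆₄ = Φ⁻ 64
    m₁₂₈ = Φ⁻ 128
    P64 : P 64 ≈ p * p * m₃₂
    P64 = sym (P²Φ⁻ {8} ℕ.≤-refl)
    1^ : ∀ k → 1# ^ k ≈ 1#
    1^ zero    = refl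
    1^ (suc k) = trans (*-identityˡ _) (1^ k)

  constant-a⁸α²⁰ : Supp Constant (κ * (a ^ 8 * α ^ 20))
  constant-a⁸α²⁰ = Constant-* (Supp-weaken (λ _ → Graded.constant) κ-graded)
    (Constant-* (Constant-^ Constant-a 8) (Constant-^ Constant-α 20))

  P32^16*T^16 : P 32 ^ 16 * T ^ 16 ≈₀ κ * ⟦ reduced v0 v1 v2 v3 ⟧ (γ ∷ D ∷ ε ∷ E ∷ [])
  P32^16*T^16 = begin
    P 32 ^ 16 * T ^ 16
      ≈⟨ ≈⇒≈₀ (*-congʳ P32^16) ⟩
    κ * (a ^ 8 * α ^ 20) * T ^ 16
      ≈⟨ ≈₀-*ˡ constant-a⁸α²⁰ T¹⁶-constantTerm ⟩
    κ * (a ^ 8 * α ^ 20) * ⟦ even₃ v0 v1 v2 v3 ⟧ (γ ∷ d ∷ ε ∷ e ∷ [])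
      ≈⟨ ≈⇒≈₀ (trans (*-assoc _ _ _) (*-congˡ (*-congʳ (*-congˡ α²⁰)))) ⟩
    κ * ⟦ v0 :^ 8 :* v1 :^ 10 :* even₃ v2 v3 v4 v5 ⟧ (a ∷ α * α ∷ γ ∷ d ∷ ε ∷ e ∷ [])
      ≈⟨ ≈⇒≈₀ (*-congˡ (⟦⟧-cong (v0 :^ 8 :* v1 :^ 10 :* even₃ v2 v3 v4 v5)
           (trans a≈γ+d (+-congˡ d≈D+D) ∷ trans α²≈y₃ (+-congˡ (*-cong d≈D+D d≈D+D)) ∷ refl ∷ d≈D+D ∷ refl ∷ 𝔹-double 8 1 ∷ []))) ⟩
    κ * ⟦ v0 :^ 8 :* v1 :^ 10 :* even₃ v2 v3 v4 v5 ⟧ (γ + (D + D) ∷ γ * γ + (D + D) * (D + D) ∷ γ ∷ D + D ∷ ε ∷ E + E ∷ [])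
      ≈⟨ ≈⇒≈₀ (*-congˡ (reduce (γ ∷ D ∷ ε ∷ E ∷ []))) ⟩
    κ * ⟦ reduced v0 v1 v2 v3 ⟧ (γ ∷ D ∷ ε ∷ E ∷ []) ∎
    where
    open Relation.Binary.Reasoning.Setoid ≈₀-setoid
    α²⁰ : α ^ 20 ≈ (α * α) ^ 10
    α²⁰ = trans (sym (^-assocʳ α 2 10)) (^-congˡ 10 (*-congˡ (*-identityʳ α)))
    d≈D+D : d ≈ D + D
    d≈D+D = 𝔹-double 4 2

  w : Series
  w = κ * (D * D * D * (γ ^ 39 * ε))

  coeff-+ : ∀ u v → coeff N (u + v) ≡ coeff N u ℕ.+ coeff N v
  coeff-+ u v = ∫-⊕ u v (indicator N)

  coeff-≈ : ∀ {u v} → u ≈ v → coeff N u ∼ coeff N v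
  coeff-≈ p = coeff-≈₀ ℕ.≤-refl (≈⇒≈₀ p)

  coeff-⟨⟩ : ∀ k u → coeff N (⟨ k ⟩ * u) ∼ k ℕ.* coeff N u
  coeff-⟨⟩ k u = ∼.trans
    (coeff-≈ (trans (*-congʳ (⟨⟩-≈× k)) (trans (×-assoc-* k 1# u) (×-congʳ k (*-identityˡ u)))))
    (∼-reflexive (∫-✕ k u (indicator N)))
    where open import Algebra.Properties.Semiring.Mult semiring using (×-assoc-*; ×-congʳ)

  coeff-graded : ∀ {c r u} .{{_ : NonZero c}} → Supp (Graded c r) u → ¬ N % c ≡ r % c → coeff N u ∼ 0
  coeff-graded s N≢r = coeff-Supp ℕ.≤-refl s (λ g → N≢r (Graded-% g))

  -- Since q⁴ = X¹²⁸, the parts with `h₀`, `h₁`, `h₂` have exponents 0, 32, 64 modulo 128 and do not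
  -- reach N.
  coeff-P32^16*T^16 : N % 128 ≡ 96 → coeff N (P 32 ^ 16 * T ^ 16) ∼ 1024 ℕ.* coeff N w
  coeff-P32^16*T^16 N≡96 = begin
    coeff N (P 32 ^ 16 * T ^ 16)
      ≈⟨ coeff-≈₀ ℕ.≤-refl P32^16*T^16 ⟩
    coeff N (κ * (H₀ + D * H₁ + D * D * H₂ + ⟨ 1024 ⟩ * (D * D * D * H₃)))
      ≈⟨ coeff-≈ (solveMod {6} (v0 :* (v1 :+ v2 :+ v3 :+ v4 :* v5)) (v0 :* v1 :+ v0 :* v2 :+ v0 :* v3 :+ v4 :* (v0 :* v5))
           (κ ∷ H₀ ∷ D * H₁ ∷ D * D * H₂ ∷ ⟨ 1024 ⟩ ∷ D * D * D * H₃ ∷ [])) ⟩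
    coeff N (κ * H₀ + κ * (D * H₁) + κ * (D * D * H₂) + ⟨ 1024 ⟩ * w)
      ≡⟨ ≡.trans (coeff-+ _ _) (cong (ℕ._+ coeff N (⟨ 1024 ⟩ * w)) (≡.trans (coeff-+ _ _)
           (cong (ℕ._+ coeff N (κ * (D * D * H₂))) (coeff-+ _ _)))) ⟩
    coeff N (κ * H₀) ℕ.+ coeff N (κ * (D * H₁)) ℕ.+ coeff N (κ * (D * D * H₂)) ℕ.+ coeff N (⟨ 1024 ⟩ * w)
      ≈⟨ +-∼-cong (+-∼-cong (+-∼-cong
           (coeff-graded {128} {0} (Supp-Graded-* κ-graded (K h₀′)) (≢ λ ()))
           (coeff-graded {128} {32} (Supp-Graded-* κ-graded (Supp-Graded-* D-graded₁₂₈ (K h₁′))) (≢ λ ())))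
           (coeff-graded {128} {64} (Supp-Graded-* κ-graded (Supp-Graded-* D²-graded (K h₂′))) (≢ λ ())))
           (coeff-⟨⟩ 1024 w) ⟩
    1024 ℕ.* coeff N w ∎
    where
    open Relation.Binary.Reasoning.Setoid ∼-setoid
    h₀′ h₁′ h₂′ h₃′ : Polynomial 4
    h₀′ = h₀ v0 v1 v2 v3
    h₁′ = h₁ v0 v1 v2 v3
    h₂′ = h₂ v0 v1 v2 v3
    h₃′ = h₃ v0 v1 v2 v3
    ρ = γ ∷ ε ∷ D ^ 4 ∷ D * D * E ∷ []
    H₀ H₁ H₂ H₃ : Series
    H₀ = ⟦ h₀′ ⟧ ρ
    H₁ = ⟦ h₁′ ⟧ ρ
    H₂ = ⟦ h₂′ ⟧ ρ
    H₃ = ⟦ h₃′ ⟧ ρ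
    K : ∀ p → Supp (Graded 128 0) (⟦ p ⟧ ρ)
    K p = Supp-⟦⟧ (Graded-submonoid 128) p (γ-graded ∷ ε-graded ∷ D⁴-graded ∷ D²E-graded ∷ [])
    ≢ : ∀ {r} → ¬ 96 ≡ r → ¬ N % 128 ≡ r
    ≢ 96≢r eq = 96≢r (≡.trans (≡.sym N≡96) eq)

  -- Multiplication by 1024 turns congruences modulo 2 into equalities.
  open ScaledEquality series ⟨ 1024 ⟩

  even-part : ∀ {u} → (∃ λ x → u ≈ 1# + (x + x)) → u ≈ʰ 1#
  even-part {u} (x , eq) = scaled (trans (*-congˡ eq)
    (solveMod {2} (con 1024 :* (v0 :+ (v1 :+ v1))) (con 1024 :* v0) (1# ∷ x ∷ [])))

  Φ⁻≈₂1 : Φ⁻ 128 ≈ʰ 1#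
  Φ⁻≈₂1 = even-part (Θ⁻-mod2 {1} {128} (ℕ.s≤s ℕ.z≤n) (ℕ.s≤s ℕ.z≤n))

  -- The inverse of a series that is 1 modulo 2 is 1 modulo 2.
  U≈₂1 : U ≈ʰ 1#
  U≈₂1 = ≈ʰ-trans (≈⇒≈ʰ (sym (*-identityˡ U)))
    (≈ʰ-trans (≈ʰ-* (≈ʰ-sym Φ⁻≈₂1) (≈⇒≈ʰ refl)) (≈⇒≈ʰ U-inverse))

  P128²≈₂P256 : P 128 * P 128 ≈ʰ P 256
  P128²≈₂P256 = ≈ʰ-trans (≈⇒≈ʰ (sym (*-identityʳ _)))
    (≈ʰ-trans (≈ʰ-* (≈⇒≈ʰ refl) (≈ʰ-sym Φ⁻≈₂1)) (≈⇒≈ʰ (P²Φ⁻ {32} (ℕ.m≤m+n 8 24))))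

  w≈₂ : w ≈ʰ P 256 * P 256 * (D * (D * D))
  w≈₂ = ≈ʰ-trans (≈ʰ-* κ≈₂ (≈ʰ-* (≈⇒≈ʰ refl) (≈ʰ-* (≈ʰ-^1 γ≈₂1 39) ε≈₂1)))
    (≈⇒≈ʰ (*-cong (*-identityʳ _) (trans (*-congˡ (*-identityʳ 1#)) (trans (*-identityʳ _) (*-assoc D D D)))))
    where
    γ≈₂1 : γ ≈ʰ 1#
    γ≈₂1 = even-part (𝔸-mod2 {4} {2} (ℕ.s≤s ℕ.z≤n) (ℕ.s≤s ℕ.z≤n))
    ε≈₂1 : ε ≈ʰ 1#
    ε≈₂1 = even-part (𝔸-mod2 {8} {1} (ℕ.s≤s ℕ.z≤n) (ℕ.s≤s ℕ.z≤n))
    P⁴ : P 128 ^ 4 ≈ P 128 * P 128 * (P 128 * P 128)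
    P⁴ = solveMod {1} (v0 :^ 4) (v0 :* v0 :* (v0 :* v0)) (P 128 ∷ [])
    κ≈₂ : κ ≈ʰ P 256 * P 256 * 1#
    κ≈₂ = ≈ʰ-* (≈ʰ-trans (≈⇒≈ʰ P⁴) (≈ʰ-* P128²≈₂P256 P128²≈₂P256)) (≈ʰ-^1 U≈₂1 40)

  -- Modulo 2, `w` is D³ times a series in X²⁵⁶, and D³ has exponents 96 modulo 256.
  coeff-w : ¬ N % 256 ≡ 96 → 1024 ℕ.* coeff N w ∼ 0
  coeff-w N≢96 = ∼.trans (∼.sym (coeff-⟨⟩ 1024 w)) (∼.trans (coeff-≈ (h*-≈ w≈₂)) (∼.trans (coeff-⟨⟩ 1024 _)
    (∼-1024 (coeff-graded {256} {96}
      (Supp-Graded-* (Supp-Graded-* (P-graded 256) (P-graded 256)) (Supp-Graded-* D-graded (Supp-Graded-* D-graded D-graded))) N≢96))))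
    where
    ∼-1024 : ∀ {k} → k ∼ 0 → 1024 ℕ.* k ∼ 0
    ∼-1024 {k} p = mk∼ (≡.trans (%-distribˡ-* 1024 k 2048) (cong (λ r → 1024 ℕ.* r % 2048) (%-≡ p)))
      where open import Data.Nat.DivMod using (%-distribˡ-*)

-- Counting arrays

indicate : ∀ {p} {P : Set p} → Dec P → ℕ
indicate P? = if does P? then 1 else 0

module _ {A : Set} where
  length-filter : ∀ {p} {P : Pred A p} (P? : Decidable P) xs → length (filter P? xs) ≡ ∫ xs (λ x → indicate (P? x))
  length-filter P? [] = ≡.sym (∫-[] _)
  length-filter P? (x ∷ xs) with P? x in eq
  ... | yes _ = ≡.trans (cong suc (length-filter P? xs))
    (≡.sym (≡.trans (∫-∷ x xs _) (cong (λ p → indicate p ℕ.+ ∫ xs (λ x → indicate (P? x))) eq)))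
  ... | no _  = ≡.trans (length-filter P? xs)
    (≡.sym (≡.trans (∫-∷ x xs _) (cong (λ p → indicate p ℕ.+ ∫ xs (λ x → indicate (P? x))) eq)))

  ∫-cartesianProduct : {C : Set} (xs : List A) (ys : List C) (f : A × C → ℕ) →
    ∫ (cartesianProduct xs ys) f ≡ ∫ xs (λ x → ∫ ys (λ y → f (x , y)))
  ∫-cartesianProduct []       ys f = ≡.trans (∫-[] f) (≡.sym (∫-[] _))
  ∫-cartesianProduct (x ∷ xs) ys f = ≡.trans (∫-++ (map (x ,_) ys) _ f)
    (≡.trans (cong₂ ℕ._+_ (∫-map (x ,_) ys f) (∫-cartesianProduct xs ys f)) (≡.sym (∫-∷ x xs _)))

  ∫-congᴬ : ∀ {q} {Q : Pred A q} {xs} {f g : A → ℕ} → All Q xs → (∀ {x} → Q x → f x ≡ g x) → ∫ xs f ≡ ∫ xs g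
  ∫-congᴬ [] eq = ≡.trans (∫-[] _) (≡.sym (∫-[] _))
  ∫-congᴬ {xs = x ∷ xs} (q ∷ qs) eq = ≡.trans (∫-∷ x xs _) (≡.trans (cong₂ ℕ._+_ (eq q) (∫-congᴬ qs eq)) (≡.sym (∫-∷ x xs _)))

  sublists-All : ∀ {q} {Q : Pred A q} {xs} → All Q xs → All (All Q) (sublists xs)
  sublists-All []       = [] ∷ []
  sublists-All (q ∷ qs) = All.++⁺ (All.map⁺ (All.map (q ∷_) (sublists-All qs))) (sublists-All qs)

  -- Sublists of the ordered list of entries are ordered, so among pairs of them only the monomial
  -- weight decides which are Frobenius partitions.
  sublists-AllPairs : ∀ {r} {R : Rel A r} {xs} → AllPairs R xs → All (AllPairs R) (sublists xs)
  sublists-AllPairs []       = [] ∷ []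
  sublists-AllPairs (r ∷ rs) = All.++⁺
    (All.map⁺ (All.zipWith (λ (p , q) → p ∷ q) (sublists-All r , sublists-AllPairs rs)))
    (sublists-AllPairs rs)

entriesBelow-< : ∀ k n → All ((_< n) ∘ proj₁) (entriesBelow k n)
entriesBelow-< k zero    = []
entriesBelow-< k (suc n) = All.++⁺ (All.map⁺ (All.universal (λ _ → ℕ.n<1+n n) _))
  (All.map ℕ.m<n⇒m<1+n (entriesBelow-< k n))

entriesBelow-ordered : ∀ k n → AllPairs _≻_ (entriesBelow k n)
entriesBelow-ordered k zero    = []
entriesBelow-ordered k (suc n) = AllPairs.++⁺
  (AllPairs.map⁺ (AllPairs.tabulate⁺-< λ i<j → inj₂ (≡.refl , i<j)))
  (entriesBelow-ordered k n)
  (All.map⁺ (All.universal (λ _ → All.map inj₁ (entriesBelow-< k n)) _))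

module _ {k : ℕ} where
  -- An entry a of the top (s = 1) or bottom (s = -1) row contributes
  -- z^s X^(16(2a+1)), so that an array has degree 32 (r + Σa + Σb).
  entryWeight : ℤ → ColoredInt k → Monomial
  entryWeight s (a , _) = 16 ℕ.* suc (2 ℕ.* a) , s

  rowWeight : ℤ → Row k → Monomial
  rowWeight s []       = unit
  rowWeight s (x ∷ xs) = entryWeight s x · rowWeight s xs

  rowWeight-degree : ∀ s xs → proj₁ (rowWeight s xs) ≡ 16 ℕ.* (2 ℕ.* rowSum xs ℕ.+ length xs)
  rowWeight-degree s []             = ≡.refl
  rowWeight-degree s ((a , _) ∷ xs) = ≡.trans (cong (16 ℕ.* suc (2 ℕ.* a) ℕ.+_) (rowWeight-degree s xs)) (eq a (rowSum xs) (length xs))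
    where
    eq : ∀ a r l → 16 ℕ.* suc (2 ℕ.* a) ℕ.+ 16 ℕ.* (2 ℕ.* r ℕ.+ l) ≡ 16 ℕ.* (2 ℕ.* (a ℕ.+ r) ℕ.+ suc l)
    eq = ℕRing.solve-∀

  rowWeight-charge : ∀ s xs → proj₂ (rowWeight s xs) ≡ s ℤ.* + length xs
  rowWeight-charge s []       = ≡.sym (ℤ.*-zeroʳ s)
  rowWeight-charge s (x ∷ xs) = ≡.trans (cong (λ t → s ℤ.+ t) (rowWeight-charge s xs)) (eq s (+ length xs))
    where
    eq : ∀ s l → s ℤ.+ s ℤ.* l ≡ s ℤ.* (1ℤ ℤ.+ l)
    eq = solve-∀

  arrayWeight : Row k × Row k → Monomial
  arrayWeight (xs , ys) = rowWeight 1ℤ xs · rowWeight -1ℤ ys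

  arrayWeight-degree : ∀ xs ys → proj₁ (arrayWeight (xs , ys)) ≡
    16 ℕ.* (2 ℕ.* (rowSum xs ℕ.+ rowSum ys) ℕ.+ (length xs ℕ.+ length ys))
  arrayWeight-degree xs ys = ≡.trans (cong₂ ℕ._+_ (rowWeight-degree 1ℤ xs) (rowWeight-degree -1ℤ ys))
    (eq (rowSum xs) (length xs) (rowSum ys) (length ys))
    where
    eq : ∀ a l b m → 16 ℕ.* (2 ℕ.* a ℕ.+ l) ℕ.+ 16 ℕ.* (2 ℕ.* b ℕ.+ m) ≡ 16 ℕ.* (2 ℕ.* (a ℕ.+ b) ℕ.+ (l ℕ.+ m))
    eq = ℕRing.solve-∀

  arrayWeight-charge : ∀ xs ys → proj₂ (arrayWeight (xs , ys)) ≡ + length xs ℤ.- + length ys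
  arrayWeight-charge xs ys = ≡.trans (cong₂ ℤ._+_ (rowWeight-charge 1ℤ xs) (rowWeight-charge -1ℤ ys)) (eq (+ length xs) (+ length ys))
    where
    eq : ∀ l m → 1ℤ ℤ.* l ℤ.+ -1ℤ ℤ.* m ≡ l ℤ.- m
    eq = solve-∀

  frobenius⇒weight : ∀ {n xs ys} → IsFrobeniusPartition k n (xs , ys) → arrayWeight (xs , ys) ≡ (32 ℕ.* n , 0ℤ)
  frobenius⇒weight {n} {xs} {ys} (isFrobeniusPartition _ _ len wt) = cong₂ _,_
    (≡.trans (arrayWeight-degree xs ys) (≡.trans (cong (λ m → 16 ℕ.* (2 ℕ.* (rowSum xs ℕ.+ rowSum ys) ℕ.+ (length xs ℕ.+ m))) (≡.sym len))
      (≡.trans (eq (rowSum xs ℕ.+ rowSum ys) (length xs)) (cong (32 ℕ.*_) wt))))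
    (≡.trans (arrayWeight-charge xs ys) (ℤ.i≡j⇒i-j≡0 (cong +_ len)))
    where
    eq : ∀ s l → 16 ℕ.* (2 ℕ.* s ℕ.+ (l ℕ.+ l)) ≡ 32 ℕ.* (l ℕ.+ s)
    eq = ℕRing.solve-∀

  -- The exponent of z is the difference of the row lengths. Once it is 0, the halves contributed by
  -- the entries add up to the row length in the weight.
  weight⇒frobenius : ∀ {n xs ys} → Linked _≻_ xs → Linked _≻_ ys → arrayWeight (xs , ys) ≡ (32 ℕ.* n , 0ℤ) →
                     IsFrobeniusPartition k n (xs , ys)
  weight⇒frobenius {n} {xs} {ys} oˣ oʸ wt = isFrobeniusPartition oˣ oʸ len
    (ℕ.*-cancelˡ-≡ _ _ 32 (≡.trans (≡.sym (eq (rowSum xs ℕ.+ rowSum ys) (length xs)))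
      (≡.trans (cong (λ m → 16 ℕ.* (2 ℕ.* (rowSum xs ℕ.+ rowSum ys) ℕ.+ (length xs ℕ.+ m))) len)
        (≡.trans (≡.sym (arrayWeight-degree xs ys)) (cong proj₁ wt)))))
    where
    eq : ∀ s l → 16 ℕ.* (2 ℕ.* s ℕ.+ (l ℕ.+ l)) ≡ 32 ℕ.* (l ℕ.+ s)
    eq = ℕRing.solve-∀
    len : length xs ≡ length ys
    len = ℤ.+-injective (ℤ.i-j≡0⇒i≡j _ _ (≡.trans (≡.sym (arrayWeight-charge xs ys)) (cong proj₂ wt)))

module Counting (M : ℕ) .{{_ : NonZero M}} (N : ℕ) where
  open Truncated M N
  open Algebra.Properties.CommutativeSemiring.Exp series
  open Algebra.Properties.CommutativeSemigroup *-commutativeSemigroup using ()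
    renaming (interchange to *-interchange)
  open JacobiTripleProduct series using (∏; ∏-cong; ∏-*; tripleProduct)
  open ThetaFunctions M N using (mono-≡)
  open EtaQuotients M N using (monomials; X^; X^-^)

  rowSeries : ∀ {k} → ℤ → List (ColoredInt k) → Series
  rowSeries s xs = map (rowWeight s) (sublists xs)

  rowSeries-∷ : ∀ {k} s x (xs : List (ColoredInt k)) → rowSeries s (x ∷ xs) ≈ (1# + (entryWeight s x ∷ [])) * rowSeries s xs
  rowSeries-∷ s x xs = exact λ f → begin
    ∫ (map (rowWeight s) (map (x ∷_) S ++ S)) f
      ≡⟨ ∫-map (rowWeight s) _ f ⟩
    ∫ (map (x ∷_) S ++ S) (f ∘ rowWeight s)
      ≡⟨ ∫-++ (map (x ∷_) S) S _ ⟩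
    ∫ (map (x ∷_) S) (f ∘ rowWeight s) ℕ.+ ∫ S (f ∘ rowWeight s)
      ≡⟨ cong (ℕ._+ ∫ S (f ∘ rowWeight s)) (∫-map (x ∷_) S _) ⟩
    ∫ S (λ ys → f (entryWeight s x · rowWeight s ys)) ℕ.+ ∫ S (λ ys → f (rowWeight s ys))
      ≡⟨ ℕ.+-comm (∫ S (λ ys → f (entryWeight s x · rowWeight s ys))) _ ⟩
    ∫ S (λ ys → f (rowWeight s ys)) ℕ.+ ∫ S (λ ys → f (entryWeight s x · rowWeight s ys))
      ≡⟨ cong₂ ℕ._+_ (≡.trans (∫-cong S (λ ys → cong f (≡.sym (·-identityˡ _)))) (≡.sym (∫-map (rowWeight s) S _)))
                     (≡.sym (∫-map (rowWeight s) S _)) ⟩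
    ∫ (rowSeries s xs) (λ y → f (unit · y)) ℕ.+ ∫ (rowSeries s xs) (λ y → f (entryWeight s x · y))
      ≡⟨ cong₂ ℕ._+_ (∫-𝟙 _) (∫-single (entryWeight s x) _) ⟨
    ∫ 𝟙 (λ y → ∫ (rowSeries s xs) (λ y′ → f (y · y′))) ℕ.+ ∫ (entryWeight s x ∷ []) _
      ≡⟨ ∫-⊕ 𝟙 (entryWeight s x ∷ []) _ ⟨
    ∫ (1# + (entryWeight s x ∷ [])) (λ y → ∫ (rowSeries s xs) (λ y′ → f (y · y′)))
      ≡⟨ ∫-⊗ _ (rowSeries s xs) f ⟨
    ∫ ((1# + (entryWeight s x ∷ [])) * rowSeries s xs) f ∎
    where
    open ≡.≡-Reasoning
    S = sublists xs

  entryFactor : ℤ → ℕ → Series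
  entryFactor s a = 1# + mono (16 ℕ.* suc (2 ℕ.* a)) s

  rowSeries-level : ∀ {k} s n (fs : List (Fin k)) xs →
    rowSeries s (map (n ,_) fs ++ xs) ≈ entryFactor s n ^ length fs * rowSeries s xs
  rowSeries-level s n []       xs = sym (*-identityˡ _)
  rowSeries-level s n (f ∷ fs) xs = trans (rowSeries-∷ s (n , f) (map (n ,_) fs ++ xs))
    (trans (*-congˡ (rowSeries-level s n fs xs)) (sym (*-assoc _ _ _)))

  rowSeries-entriesBelow : ∀ k s n → rowSeries s (entriesBelow k n) ≈ ∏ n (entryFactor s) ^ k
  rowSeries-entriesBelow k s zero    = trans (exact λ f → ≡.trans (∫-single _ f) (≡.sym (∫-𝟙 f))) (sym (1^ k))
    where
    1^ : ∀ k → 1# ^ k ≈ 1#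
    1^ zero    = refl
    1^ (suc k) = trans (*-identityˡ _) (1^ k)
  rowSeries-entriesBelow k s (suc n) = trans (rowSeries-level s n (allFin k) (entriesBelow k n))
    (trans (*-cong (reflexive (cong (entryFactor s n ^_) (length-tabulate {n = k} (λ i → i)))) (rowSeries-entriesBelow k s n))
      (trans (*-comm _ _) (sym (^-distrib-* _ _ k))))

  cφ-coeff : ∀ k n → cφ k n ≡ ∫ (rowSeries 1ℤ (entriesBelow k n) * rowSeries -1ℤ (entriesBelow k n)) (indicator (32 ℕ.* n))
  cφ-coeff k n = begin
    length (filter (isFrobeniusPartition? k n) (cartesianProduct rows rows))
      ≡⟨ length-filter (isFrobeniusPartition? k n) (cartesianProduct rows rows) ⟩
    ∫ (cartesianProduct rows rows) (λ array → indicate (isFrobeniusPartition? k n array))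
      ≡⟨ ∫-cartesianProduct rows rows _ ⟩
    ∫ rows (λ xs → ∫ rows (λ ys → indicate (isFrobeniusPartition? k n (xs , ys))))
      ≡⟨ ∫-congᴬ ordered (λ oˣ → ∫-congᴬ ordered (λ oʸ → agree (AllPairs⇒Linked oˣ) (AllPairs⇒Linked oʸ))) ⟩
    ∫ rows (λ xs → ∫ rows (λ ys → indicator (32 ℕ.* n) (arrayWeight (xs , ys))))
      ≡⟨ ∫-cong rows (λ xs → ≡.sym (∫-map (rowWeight -1ℤ) rows _)) ⟩
    ∫ rows (λ xs → ∫ (rowSeries -1ℤ (entriesBelow k n)) (λ y → indicator (32 ℕ.* n) (rowWeight 1ℤ xs · y)))
      ≡⟨ ∫-map (rowWeight 1ℤ) rows _ ⟨
    ∫ (rowSeries 1ℤ (entriesBelow k n)) (λ x → ∫ (rowSeries -1ℤ (entriesBelow k n)) (λ y → indicator (32 ℕ.* n) (x · y)))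
      ≡⟨ ∫-⊗ _ _ _ ⟨
    ∫ (rowSeries 1ℤ (entriesBelow k n) * rowSeries -1ℤ (entriesBelow k n)) (indicator (32 ℕ.* n)) ∎
    where
    open ≡.≡-Reasoning
    rows = sublists (entriesBelow k n)

    ordered : All (AllPairs _≻_) rows
    ordered = sublists-AllPairs (entriesBelow-ordered k n)

    agree : ∀ {xs ys} → Linked _≻_ xs → Linked _≻_ ys →
            indicate (isFrobeniusPartition? k n (xs , ys)) ≡ indicator (32 ℕ.* n) (arrayWeight (xs , ys))
    agree {xs} {ys} oˣ oʸ with isFrobeniusPartition? k n (xs , ys)
    ... | yes F = ≡.sym (indicator-≡ (frobenius⇒weight F))
    ... | no ¬F = ≡.sym (indicator-≢ _ (λ eq → ¬F (weight⇒frobenius oˣ oʸ eq)))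

  tripleProduct-entryFactors : ∀ n → ∏ n (entryFactor 1ℤ) * ∏ n (entryFactor -1ℤ) ≈ tripleProduct monomials (X^ 16) n n
  tripleProduct-entryFactors n = *-cong (∏-cong n (factor 1ℤ)) (∏-cong n (factor -1ℤ))
    where
    factor : ∀ s j → entryFactor s j ≈ 1# + mono 0 s * X^ 16 ^ suc (2 ℕ.* j)
    factor s j = +-congˡ (sym (trans (*-congˡ (X^-^ 16 (suc (2 ℕ.* j)))) (trans (mono-* _ _ _ _) (mono-≡ ≡.refl (ℤ.+-identityʳ s)))))

  -- Restricting entries to values below n leaves exactly n factors of each kind, so the finite
  -- triple product arises directly, without passing to an infinite product.
  cφ-tripleProduct : ∀ k n → 32 ℕ.* n ≤ N → cφ k n ∼ coeff (32 ℕ.* n) (tripleProduct monomials (X^ 16) n n ^ k)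
  cφ-tripleProduct k n 32n≤N = ∼.trans (∼-reflexive (cφ-coeff k n)) (coeff-≈₀ 32n≤N (≈⇒≈₀
    (trans (*-cong (rowSeries-entriesBelow k 1ℤ n) (rowSeries-entriesBelow k -1ℤ n))
      (trans (sym (^-distrib-* _ _ k)) (^-congˡ k (tripleProduct-entryFactors n))))))

-- Divisibility of cφ₁₆(n)

module _ (n : ℕ) (1≤n : 1 ≤ n) where
  open ConstantTerm n 1≤n using (N; n≤N; N<; T)
  open Coefficients n 1≤n using (w; coeff-P32^16*T^16; coeff-≈; coeff-w)
  open Truncated 2048 N
  open EtaQuotients 2048 N
  open Algebra.Properties.CommutativeSemiring.Exp series
  open Partitions n n≤N N<
  open Counting 2048 N

  cφ-coeff-w : N % 128 ≡ 96 → cφ 16 n ∼ 1024 ℕ.* coeff N w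
  cφ-coeff-w N≡96 = ∼.trans (cφ-tripleProduct 16 n ℕ.≤-refl) (∼.trans
    (coeff-≈ (trans (^-congˡ 16 (jacobi-Θ 16 ℕ.≤-refl)) (^-distrib-* (P 32) T 16)))
    (coeff-P32^16*T^16 N≡96))

  1024∣cφ : N % 128 ≡ 96 → 1024 ∣ cφ 16 n
  -- The residue modulo 2048 and the multiple of 2048 split off from it are both divisible by 1024.
  1024∣cφ N≡96 = ≡.subst (1024 ∣_) (≡.sym (m≡m%n+[m/n]*n (cφ 16 n) 2048)) (∣m∣n⇒∣m+n
    (≡.subst (1024 ∣_) (≡.sym (%-≡ (cφ-coeff-w N≡96)))
      (%-presˡ-∣ (∣m⇒∣m*n (coeff N w) (divides 1 ≡.refl)) (divides 2 ≡.refl)))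
    (∣n⇒∣m*n (cφ 16 n / 2048) (divides 2 ≡.refl)))

  2048∣cφ : N % 128 ≡ 96 → ¬ N % 256 ≡ 96 → 2048 ∣ cφ 16 n
  2048∣cφ N≡96 N≢96 = m%n≡0⇒n∣m (cφ 16 n) 2048 (%-≡ (∼.trans (cφ-coeff-w N≡96) (coeff-w N≢96)))

open import Data.Nat using (ℕ; _+_; _*_)
open import Data.Nat.Divisibility using (_∣_)
open import Data.Product using (_×_)

theorem1p1 : (∀ (n : ℕ) → 1024 ∣ cφ 16 (4 * n + 3)) × (∀ (n : ℕ) → 2048 ∣ cφ 16 (8 * n + 7))
theorem1p1 = part₁ , part₂
  where
  part₁ : ∀ n → 1024 ∣ cφ 16 (4 * n + 3)
  part₁ n = 1024∣cφ (4 * n + 3) (ℕ.m≤n⇒m≤o+n (4 * n) (ℕ.s≤s ℕ.z≤n))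
    (≡.trans (cong (_% 128) (eq n)) ([m+kn]%n≡m%n 96 n 128))
    where
    eq : ∀ n → 32 * (4 * n + 3) ≡ 96 + n * 128
    eq = ℕRing.solve-∀

  part₂ : ∀ n → 2048 ∣ cφ 16 (8 * n + 7)
  -- The degree 32(8n + 7) is 224 modulo 256, hence 96 modulo 128 but not modulo 256.
  part₂ n = 2048∣cφ (8 * n + 7) (ℕ.m≤n⇒m≤o+n (8 * n) (ℕ.s≤s ℕ.z≤n))
    (≡.trans (cong (_% 128) (eq₁ n)) ([m+kn]%n≡m%n 96 (2 * n + 1) 128))
    (λ p → 224≢96 (≡.trans (≡.sym (≡.trans (cong (_% 256) (eq₂ n)) ([m+kn]%n≡m%n 224 n 256))) p))
    where
    eq₁ : ∀ n → 32 * (8 * n + 7) ≡ 96 + (2 * n + 1) * 128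
    eq₁ = ℕRing.solve-∀
    eq₂ : ∀ n → 32 * (8 * n + 7) ≡ 224 + n * 256
    eq₂ = ℕRing.solve-∀
    224≢96 : ¬ 224 ≡ 96
    224≢96 ()
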